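{- Let $n$ be an even positive integer and let $\ell$ be a positive integer such that $\ell\le 2^n/n$ and $\ell$ divides the number of edges of $Q_n$ (which is $n2^{n-1}$). Then there is an edge decomposition of $Q_n$ into paths of length $\ell$.
   Context: $Q_n$ denotes the $n$-dimensional hypercube: its vertex set is $\{0,1\}^n$ and two vertices are adjacent iff they differ in exactly one coordinate. An edge decomposition of a graph into subgraphs means the subgraphs are pairwise edge-disjoint and their union is the graph. The length of a path is its number of edges. -}

module Defs where

open import Data.Bool using (Bool; true; false; not)
open import Data.Bool.Properties using () renaming (_≟_ to _≟ᵇ_)
open import Data.Nat using (ℕ; zero; suc; _+_; _*_; _∸_; _^_; _≤_; _<_)
open import Data.Fin using (Fin)
open import Data.Vec using (Vec; []; _∷_; lookup; _[_]≔_)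
open import Data.Vec.Properties using (≡-dec)
open import Data.List using (List; []; _∷_; map)
open import Data.Nat.ListAction using (sum)
open import Data.Product using (Σ; ∃; _×_; _,_)
open import Data.Sum using (_⊎_)
open import Relation.Binary.PropositionalEquality using (_≡_; _≢_)
open import Relation.Nullary using (Dec; yes; no; ¬_)
open import Relation.Nullary.Decidable using (⌊_⌋; _×-dec_; _⊎-dec_)

Vertex : ℕ → Set
Vertex n = Vec Bool n

_≟ᵛ_ : ∀ {n} (u v : Vertex n) → Dec (u ≡ v)
_≟ᵛ_ = ≡-dec _≟ᵇ_

Adjacent : ∀ {n} → Vertex n → Vertex n → Set
Adjacent {n} u v =
  Σ (Fin n) λ i → (lookup u i ≢ lookup v i) ×
    (∀ j → j ≢ i → lookup u j ≡ lookup v j)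

record Path (n ℓ : ℕ) : Set where
  field
    vert     : Vec (Vertex n) (suc ℓ)
    distinct : ∀ (i j : Fin (suc ℓ)) → lookup vert i ≡ lookup vert j → i ≡ j
    adjacent : ∀ (i : Fin ℓ) →
      Adjacent (lookup vert (Data.Fin.inject₁ i)) (lookup vert (Data.Fin.suc i))
open Path public

sameEdge : ∀ {n} → Vertex n → Vertex n → Vertex n → Vertex n → Bool
sameEdge a b u v =
  ⌊ ((a ≟ᵛ u) ×-dec (b ≟ᵛ v)) ⊎-dec ((a ≟ᵛ v) ×-dec (b ≟ᵛ u)) ⌋

boolToℕ : Bool → ℕ
boolToℕ true  = 1
boolToℕ false = 0

edgeCountVec : ∀ {n k} → Vertex n → Vertex n → Vec (Vertex n) k → ℕ
edgeCountVec a b []               = 0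
edgeCountVec a b (u ∷ [])         = 0
edgeCountVec a b (u ∷ v ∷ rest)   =
  boolToℕ (sameEdge a b u v) + edgeCountVec a b (v ∷ rest)

edgeCount : ∀ {n ℓ} → Vertex n → Vertex n → Path n ℓ → ℕ
edgeCount a b p = edgeCountVec a b (vert p)

-- An edge decomposition of Q_n into paths of length ℓ: a finite family of
-- paths of length ℓ (each of whose edges is an edge of Q_n, by definition
-- of Path) such that every edge {a , b} of Q_n is used exactly once in
-- total (so the paths are pairwise edge-disjoint and cover all edges).
PathDecomposition : ℕ → ℕ → Set
PathDecomposition n ℓ =
  Σ (List (Path n ℓ)) λ ps →
    ∀ (a b : Vertex n) → Adjacent a b →
      sum (map (edgeCount a b) ps) ≡ 1

numEdges : ℕ → ℕ
numEdges n = n * 2 ^ (n ∸ 1)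

{-# OPTIONS --safe #-}

-- Identify Q_{2m} with Z4^m, where Z4 is the 4-cycle.
--
-- For even e, Z4^e decomposes into e Hamiltonian cycles.  Start with e directed closed walks (tracks) around a single
-- 4-cycle, which are carried by one class of e parallel generators.  Split a class in two by passing from the vertex
-- set V to V × Z4, where the new coordinate counts the uses of the first part.  A track remains a single cycle when it
-- uses the first part an odd number of times in total; this is achieved by fixed patterns on groups of four vertices at
-- which the class is used by the same tracks.  When every class is a single generator, the vertex set is Z4^e and
-- every generator is used at each vertex by exactly one track.
--
-- Write Q_{2m} = Z4 × G and let G be decomposed into a Hamiltonian cycle X and further cycles (loops).  A single closed
-- trail through all edges follows X four times in the four copies of G and inserts each loop at two rows, in a lap that
-- visits two copies of it.  If the loops are longer than ℓ and the last rows, at least ℓ of them, carry no lap, then any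
-- ℓ + 1 consecutive vertices of the trail are distinct, and the trail can be cut into paths of length ℓ.  For odd m take
-- the Hamiltonian decomposition of G = Z4^(m-1).  For even m take G = Z4 × Z4^(m-2), where a boustrophedon walk over a
-- Hamiltonian cycle of Z4^(m-2) is Hamiltonian; here ℓ < 4^(m-2) is required, and in the remaining cases ℓ divides 4^m,
-- so that the Hamiltonian cycles of Z4^m can be cut one by one.
module Submission where

open import Defs
open import Data.Bool using (Bool; true; false; if_then_else_; not; _xor_)
open import Data.Bool.Properties using (xor-same; not-involutive) renaming (_≟_ to _≟ᵇ_)
open import Data.Empty using (⊥; ⊥-elim)
open import Data.Fin as Fin using (Fin; inject₁)
open import Data.Fin.Properties using (any?; all?) renaming (_≟_ to _≟ᶠ_)
open import Data.List using (List; []; _∷_; _++_; map; length; take; drop)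
open import Data.List.Properties using (length-++; ++-assoc; ++-identityʳ; length-take; length-drop; take++drop≡id; take-map; length-map; map-++)
open import Data.List.Relation.Unary.All as All using (All; []; _∷_)
import Data.List.Relation.Unary.All.Properties as Allₚ
open import Data.List.Relation.Unary.AllPairs using ([]; _∷_)
open import Data.List.Relation.Unary.Unique.Propositional using (Unique)
import Data.List.Relation.Unary.Unique.Propositional.Properties as Uniqueₚ
open import Data.Maybe using (Maybe; just; nothing)
open import Data.Nat using (ℕ; zero; suc; _+_; _*_; _∸_; _^_; _≤_; _<_; _>_; z≤n; s≤s; _≤?_; s≤s⁻¹; >-nonZero; ⌊_/2⌋; ⌈_/2⌉)
open import Data.Nat.Divisibility using (_∣_; _∣?_; divides)
open import Data.Nat.ListAction using (sum)
open import Data.Nat.ListAction.Properties using (sum-++)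
open import Data.Nat.Properties
open import Data.Nat.Tactic.RingSolver using (solve-∀)
open import Data.Product using (Σ; ∃; ∃₂; _×_; _,_; proj₁; proj₂)
open import Data.Product.Properties using () renaming (≡-dec to ×-≡-dec)
open import Data.Sum using (_⊎_; inj₁; inj₂)
open import Data.Unit using (⊤; tt)
open import Data.Vec as Vec using (Vec; []; _∷_; lookup; fromList; toList)
open import Data.Vec.Properties using (∷-injectiveˡ; ∷-injectiveʳ; length-toList; toList-++; toList∘fromList) renaming (≡-dec to vec-≡-dec)
open import Relation.Binary.PropositionalEquality
open import Relation.Nullary using (¬_; Dec; yes; no; does; ¬?)
open import Relation.Nullary.Decidable using (⌊_⌋; _×-dec_; _⊎-dec_; _→-dec_; from-yes)

-- A decomposition is always stated as an identity for arbitrary weights on arcs: the weights of the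
-- cycles add up to the weight `E` of the cube. Such sums survive products, cutting and regrouping,
-- and special weights recover what is needed: the indicator of an edge gives "exactly once", the
-- constant 1 gives lengths, a weight that detects non-edges gives adjacency. In the same way being
-- Hamiltonian is an identity between sums over vertices.
--
-- Parity shapes the construction. Each track has to use the first part of a class an odd number of
-- times, whereas the number of all these uses is a multiple of the number of vertices, hence of
-- four. So the number of tracks must be even, and tracks can be made odd only two at a time; this
-- is why they are grouped in pairs. It is also why an even m needs a detour: the tower has nothing
-- to offer for Z4^(m-1), and the product of Z4 with Z4^(m-2) has to replace it at the price of
-- shorter loops.

private variable
  A B : Set

-- Walks and their slices

∑ : List A → (A → ℕ) → ℕ
∑ []      f = 0
∑ (x ∷ l) f = f x + ∑ l f

∑-cong : (l : List A) {f g : A → ℕ} → (∀ x → f x ≡ g x) → ∑ l f ≡ ∑ l g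
∑-cong []      e = refl
∑-cong (x ∷ l) e = cong₂ _+_ (e x) (∑-cong l e)

∑-++ : (l l′ : List A) (f : A → ℕ) → ∑ (l ++ l′) f ≡ ∑ l f + ∑ l′ f
∑-++ []      l′ f = refl
∑-++ (x ∷ l) l′ f = trans (cong (f x +_) (∑-++ l l′ f)) (sym (+-assoc (f x) _ _))

∑-map : (h : A → B) (l : List A) (f : B → ℕ) → ∑ (map h l) f ≡ ∑ l (λ x → f (h x))
∑-map h []      f = refl
∑-map h (x ∷ l) f = cong (f (h x) +_) (∑-map h l f)

+-interchange : ∀ a b c d → (a + b) + (c + d) ≡ (a + c) + (b + d)
+-interchange = solve-∀

∑-+ : (l : List A) (f g : A → ℕ) → ∑ l (λ x → f x + g x) ≡ ∑ l f + ∑ l g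
∑-+ []      f g = refl
∑-+ (x ∷ l) f g = trans (cong (f x + g x +_) (∑-+ l f g)) (+-interchange (f x) (g x) _ _)

∑-0 : (l : List A) → ∑ l (λ _ → 0) ≡ 0
∑-0 []      = refl
∑-0 (x ∷ l) = ∑-0 l

∑-swap : (l : List A) (l′ : List B) (f : A → B → ℕ) →
         ∑ l (λ x → ∑ l′ (f x)) ≡ ∑ l′ (λ y → ∑ l (λ x → f x y))
∑-swap []      l′ f = sym (∑-0 l′)
∑-swap (x ∷ l) l′ f = trans (cong (∑ l′ (f x) +_) (∑-swap l l′ f))
  (sym (∑-+ l′ (f x) (λ y → ∑ l (λ x → f x y))))

∑-const : (l : List A) (k : ℕ) → ∑ l (λ _ → k) ≡ length l * k
∑-const []      k = refl
∑-const (x ∷ l) k = cong (k +_) (∑-const l k)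

-- A walk is given by its initial vertex x and the list of the vertices visited after x.

end : A → List A → A
end x []       = x
end x (y ∷ ys) = end y ys

end-++ : (x : A) (ys zs : List A) → end x (ys ++ zs) ≡ end (end x ys) zs
end-++ x []       zs = refl
end-++ x (y ∷ ys) zs = end-++ y ys zs

end-map : (h : A → B) (x : A) (ys : List A) → end (h x) (map h ys) ≡ h (end x ys)
end-map h x []       = refl
end-map h x (y ∷ ys) = end-map h y ys

wt : (A → A → ℕ) → A → List A → ℕ
wt w x []       = 0
wt w x (y ∷ ys) = w x y + wt w y ys

wt-++ : (w : A → A → ℕ) (x : A) (ys zs : List A) →
        wt w x (ys ++ zs) ≡ wt w x ys + wt w (end x ys) zs
wt-++ w x []       zs = refl
wt-++ w x (y ∷ ys) zs = trans (cong (w x y +_) (wt-++ w y ys zs)) (sym (+-assoc (w x y) _ _))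

wt-map : (h : A → B) (w : B → B → ℕ) (x : A) (ys : List A) →
         wt w (h x) (map h ys) ≡ wt (λ u v → w (h u) (h v)) x ys
wt-map h w x []       = refl
wt-map h w x (y ∷ ys) = cong (w (h x) (h y) +_) (wt-map h w y ys)

wt-1 : (x : A) (ys : List A) → wt (λ _ _ → 1) x ys ≡ length ys
wt-1 x []       = refl
wt-1 x (y ∷ ys) = cong suc (wt-1 y ys)

Chain : (A → A → Set) → A → List A → Set
Chain R x []       = ⊤
Chain R x (y ∷ ys) = R x y × Chain R y ys

chain-++ˡ : ∀ {R : A → A → Set} (x : A) ys {zs} → Chain R x (ys ++ zs) → Chain R x ys
chain-++ˡ x []       c       = tt
chain-++ˡ x (y ∷ ys) (r , c) = r , chain-++ˡ y ys c

chain-++ʳ : ∀ {R : A → A → Set} (x : A) ys {zs} → Chain R x (ys ++ zs) → Chain R (end x ys) zs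
chain-++ʳ x []       c       = c
chain-++ʳ x (y ∷ ys) (r , c) = chain-++ʳ y ys c

-- “Locally distinct”: no window of ℓ + 1 entries has a repetition, as is needed to cut a walk into paths of length ℓ.
LD : ℕ → List A → Set
LD ℓ []       = ⊤
LD ℓ (x ∷ xs) = All (x ≢_) (take ℓ xs) × LD ℓ xs

module _ {A : Set} (ℓ : ℕ) where

  LD-unique : {xs : List A} → Unique xs → LD ℓ xs
  LD-unique []       = tt
  LD-unique (a ∷ us) = Allₚ.take⁺ ℓ a , LD-unique us

  LD-suffix : (xs : List A) {ys : List A} → LD ℓ (xs ++ ys) → LD ℓ ys
  LD-suffix []       d       = d
  LD-suffix (x ∷ xs) (_ , d) = LD-suffix xs d

  take-cross : ∀ k {P : A → Set} (xs : List A) {ys} → All P (take k xs) → All P ys →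
               All P (take k (xs ++ ys))
  take-cross k       []       p       q = Allₚ.take⁺ k q
  take-cross zero    (x ∷ xs) p       q = []
  take-cross (suc k) (x ∷ xs) (p ∷ ps) q = p ∷ take-cross k xs ps q

  LD-++ : {xs ys : List A} → LD ℓ xs → LD ℓ ys → All (λ x → All (x ≢_) ys) xs → LD ℓ (xs ++ ys)
  LD-++ {[]}     _       e _        = e
  LD-++ {x ∷ xs} (a , d) e (b ∷ bs) = take-cross ℓ xs a b , LD-++ d e bs

  take-long : ∀ k (xs : List A) {ys} → k ≤ length xs → take k (xs ++ ys) ≡ take k xs
  take-long zero    xs       _       = refl
  take-long (suc k) (x ∷ xs) (s≤s p) = cong (x ∷_) (take-long k xs p)

  -- No stretch of ℓ + 1 consecutive entries meets both sides of a segment of length at least ℓ.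
  LD-glue : (xs ys : List A) {zs : List A} → ℓ ≤ length ys →
            LD ℓ (xs ++ ys) → LD ℓ (ys ++ zs) → LD ℓ (xs ++ ys ++ zs)
  LD-glue []       ys      p d       e = e
  LD-glue (x ∷ xs) ys {zs} p (a , d) e = subst (All (x ≢_)) eq a , LD-glue xs ys p d e
    where
    long : ℓ ≤ length (xs ++ ys)
    long = ≤-trans p (≤-trans (m≤n+m _ (length xs)) (≤-reflexive (sym (length-++ xs))))
    eq : take ℓ (xs ++ ys) ≡ take ℓ (xs ++ ys ++ zs)
    eq = trans (sym (take-long ℓ (xs ++ ys) long)) (cong (take ℓ) (++-assoc xs ys zs))

  take-short : ∀ k {P : A → Set} (xs : List A) {ys} → length xs ≤ k → All P (take k (xs ++ ys)) → All P xs
  take-short k       []       _       _        = []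
  take-short (suc k) (x ∷ xs) (s≤s p) (q ∷ qs) = q ∷ take-short k xs p qs

  LD-prefix : (xs : List A) {ys : List A} → length xs ≤ suc ℓ → LD ℓ (xs ++ ys) → Unique xs
  LD-prefix []       _       _       = []
  LD-prefix (x ∷ xs) (s≤s p) (a , d) = take-short ℓ xs p a ∷ LD-prefix xs (m≤n⇒m≤1+n p) d

vec-of : (ys : List A) (k : ℕ) → length ys ≡ k → Σ (Vec A k) λ v → toList v ≡ ys
vec-of ys _ refl = fromList ys , toList∘fromList ys

ind : ∀ {n} → Vertex n → Vertex n → Vertex n → Vertex n → ℕ
ind a b u v = boolToℕ (sameEdge a b u v)

module Cut {n : ℕ} (ℓ : ℕ) where

  all-lookup : ∀ {k} {P : Vertex n → Set} (v : Vec (Vertex n) k) → All P (toList v) → ∀ i → P (lookup v i)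
  all-lookup (x Vec.∷ v) (p ∷ ps) Fin.zero    = p
  all-lookup (x Vec.∷ v) (p ∷ ps) (Fin.suc i) = all-lookup v ps i

  lookup-inj : ∀ {k} (v : Vec (Vertex n) k) → Unique (toList v) → ∀ i j → lookup v i ≡ lookup v j → i ≡ j
  lookup-inj (x Vec.∷ v) (a ∷ u) Fin.zero    Fin.zero    e = refl
  lookup-inj (x Vec.∷ v) (a ∷ u) Fin.zero    (Fin.suc j) e = ⊥-elim (all-lookup v a j e)
  lookup-inj (x Vec.∷ v) (a ∷ u) (Fin.suc i) Fin.zero    e = ⊥-elim (all-lookup v a i (sym e))
  lookup-inj (x Vec.∷ v) (a ∷ u) (Fin.suc i) (Fin.suc j) e = cong Fin.suc (lookup-inj v u i j e)

  chain-lookup : ∀ {k} x (v : Vec (Vertex n) k) → Chain Adjacent x (toList v) → ∀ i →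
                 Adjacent (lookup (x Vec.∷ v) (inject₁ i)) (lookup v i)
  chain-lookup x (y Vec.∷ v) (r , c) Fin.zero    = r
  chain-lookup x (y Vec.∷ v) (r , c) (Fin.suc i) = chain-lookup y v c i

  count-wt : ∀ {k} a b x (v : Vec (Vertex n) k) → edgeCountVec a b (x Vec.∷ v) ≡ wt (ind a b) x (toList v)
  count-wt a b x Vec.[]      = refl
  count-wt a b x (y Vec.∷ v) = cong (ind a b x y +_) (count-wt a b y v)

  toPath : ∀ x (v : Vec (Vertex n) ℓ) → Chain Adjacent x (toList v) → Unique (x ∷ toList v) → Path n ℓ
  toPath x v c u = record
    { vert = x Vec.∷ v ; distinct = lookup-inj (x Vec.∷ v) u ; adjacent = chain-lookup x v c }

  -- Successive paths share a vertex, so the list of the remaining walk has to begin again with the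
  -- last vertex of the piece cut off.
  end-split : (x : Vertex n) (ys zs : List (Vertex n)) →
              ∃ λ ps → x ∷ ys ++ zs ≡ ps ++ end x ys ∷ zs
  end-split x []       zs = [] , refl
  end-split x (y ∷ ys) zs with end-split y ys zs
  ... | ps , e = x ∷ ps , cong (x ∷_) e

  cutVec : ∀ r x (v : Vec (Vertex n) (r * ℓ)) → Chain Adjacent x (toList v) → LD ℓ (x ∷ toList v) →
           Σ (List (Path n ℓ)) λ ps → ∀ a b → sum (map (edgeCount a b) ps) ≡ wt (ind a b) x (toList v)
  cutVec zero    x Vec.[] c d = [] , λ a b → refl
  cutVec (suc r) x v      c d with Vec.splitAt ℓ v
  ... | v₁ , v₂ , refl rewrite toList-++ v₁ v₂ =
    let xs = toList v₁
        (ps , e) = end-split x xs (toList v₂)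
        p = toPath x v₁ (chain-++ˡ x xs c)
              (LD-prefix ℓ (x ∷ xs) (≤-reflexive (cong suc (length-toList v₁))) d)
        (rest , h) = cutVec r (end x xs) v₂ (chain-++ʳ x xs c) (LD-suffix ℓ ps (subst (LD ℓ) e d))
    in p ∷ rest , λ a b → trans (cong₂ _+_ (count-wt a b x v₁) (h a b)) (sym (wt-++ (ind a b) x xs (toList v₂)))

  cut : ∀ r x ys → length ys ≡ r * ℓ → Chain Adjacent x ys → LD ℓ (x ∷ ys) →
        Σ (List (Path n ℓ)) λ ps → ∀ a b → sum (map (edgeCount a b) ps) ≡ wt (ind a b) x ys
  cut r x ys e c d with vec-of ys (r * ℓ) e
  ... | v , refl = cutVec r x v c d

-- Extending a family of cycles over Z4

data Z4 : Set where
  z0 z1 z2 z3 : Z4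

s : Z4 → Z4
s z0 = z1
s z1 = z2
s z2 = z3
s z3 = z0

Σ₄ : (Z4 → ℕ) → ℕ
Σ₄ f = f z0 + (f z1 + (f z2 + f z3))

Σ₄-cong : ∀ {f g : Z4 → ℕ} → (∀ z → f z ≡ g z) → Σ₄ f ≡ Σ₄ g
Σ₄-cong e = cong₂ _+_ (e z0) (cong₂ _+_ (e z1) (cong₂ _+_ (e z2) (e z3)))

Σ₄-+ : (f g : Z4 → ℕ) → Σ₄ (λ z → f z + g z) ≡ Σ₄ f + Σ₄ g
Σ₄-+ f g = lemma (f z0) (f z1) (f z2) (f z3) (g z0) (g z1) (g z2) (g z3)
  where
  lemma : ∀ a b c d a′ b′ c′ d′ → (a + a′) + ((b + b′) + ((c + c′) + (d + d′))) ≡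
          (a + (b + (c + d))) + (a′ + (b′ + (c′ + d′)))
  lemma = solve-∀

infixl 6 _⊕_ _⊖_

_⊕_ : Z4 → ℕ → Z4
z ⊕ zero  = z
z ⊕ suc n = s z ⊕ n

_⊖_ : Z4 → Z4 → Z4
x ⊖ z0 = x
x ⊖ z1 = s (s (s x))
x ⊖ z2 = s (s x)
x ⊖ z3 = s x

⊕-+ : ∀ z a b → z ⊕ (a + b) ≡ z ⊕ a ⊕ b
⊕-+ z zero    b = refl
⊕-+ z (suc a) b = ⊕-+ (s z) a b

s⁴ : ∀ z → s (s (s (s z))) ≡ z
s⁴ z0 = refl
s⁴ z1 = refl
s⁴ z2 = refl
s⁴ z3 = refl

s-⊖ : ∀ x z → s x ⊖ z ≡ s (x ⊖ z)
s-⊖ x z0 = refl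
s-⊖ x z1 = refl
s-⊖ x z2 = refl
s-⊖ x z3 = refl

s-⊖-s : ∀ x z → s x ⊖ s z ≡ x ⊖ z
s-⊖-s x z0 = s⁴ x
s-⊖-s x z1 = refl
s-⊖-s x z2 = refl
s-⊖-s x z3 = refl

⊕-⊖ : ∀ x b z → x ⊕ b ⊖ z ≡ (x ⊖ z) ⊕ b
⊕-⊖ x zero    z = refl
⊕-⊖ x (suc b) z = trans (⊕-⊖ (s x) b z) (cong (_⊕ b) (s-⊖ x z))

-- Makes the difference of the joint coordinate and the new one a coordinate for the second part of
-- a divided class.
⊕-⊖-⊕ : ∀ x a b z → x ⊕ (a + b) ⊖ (z ⊕ a) ≡ (x ⊖ z) ⊕ b
⊕-⊖-⊕ x zero    b z = ⊕-⊖ x b z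
⊕-⊖-⊕ x (suc a) b z = trans (⊕-⊖-⊕ (s x) a b (s z)) (cong (_⊕ b) (s-⊖-s x z))

Σ₄-s : (f : Z4 → ℕ) → Σ₄ (λ z → f (s z)) ≡ Σ₄ f
Σ₄-s f = lemma (f z0) (f z1) (f z2) (f z3)
  where
  lemma : ∀ a b c d → b + (c + (d + a)) ≡ a + (b + (c + d))
  lemma = solve-∀

Σ₄-⊕ : ∀ n (f : Z4 → ℕ) → Σ₄ (λ z → f (z ⊕ n)) ≡ Σ₄ f
Σ₄-⊕ zero    f = refl
Σ₄-⊕ (suc n) f = trans (Σ₄-s (λ z → f (z ⊕ n))) (Σ₄-⊕ n f)

Σ₄-swap : (f : Z4 → Z4 → ℕ) → Σ₄ (λ y → Σ₄ λ z → f y z) ≡ Σ₄ (λ z → Σ₄ λ y → f y z)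
Σ₄-swap f = sym (trans (Σ₄-+ (f z0) (λ z → f z1 z + (f z2 z + f z3 z))) (cong (Σ₄ (f z0) +_)
  (trans (Σ₄-+ (f z1) (λ z → f z2 z + f z3 z)) (cong (Σ₄ (f z1) +_) (Σ₄-+ (f z2) (f z3))))))

-- The shear from (y , z) to (z , y ⊖ z) permutes the pairs; hence the vertex set remains a full
-- product when a joint coordinate is divided in two.
Σ₄-⊖ : (f : Z4 → Z4 → ℕ) → Σ₄ (λ y → Σ₄ λ z → f z (y ⊖ z)) ≡ Σ₄ (λ a → Σ₄ λ b → f a b)
Σ₄-⊖ f = trans (Σ₄-swap (λ y z → f z (y ⊖ z))) (Σ₄-cong λ z → turn z (f z))
  where
  turn : ∀ z (g : Z4 → ℕ) → Σ₄ (λ y → g (y ⊖ z)) ≡ Σ₄ g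
  turn z0 g = refl
  turn z1 g = Σ₄-⊕ 3 g
  turn z2 g = Σ₄-⊕ 2 g
  turn z3 g = Σ₄-⊕ 1 g

s² : ∀ r → (∀ z → z ⊕ (r + r) ≡ z) ⊎ (∀ z → z ⊕ (r + r) ≡ s (s z))
s² zero = inj₁ λ z → refl
s² (suc r) with s² r
... | inj₁ e = inj₂ λ z → trans (cong (s z ⊕_) (+-suc r r)) (e (s (s z)))
... | inj₂ e = inj₁ λ z → trans (cong (s z ⊕_) (+-suc r r)) (trans (e (s (s z))) (s⁴ z))

Odd : ℕ → Set
Odd n = ∃ λ r → n ≡ suc (r + r)

-- An odd number is 1 or 3 modulo 4, hence a generator of Z4; its first four multiples are all the
-- elements.
odd-step : ∀ n → Odd n → (∀ z → z ⊕ n ≡ s z) ⊎ (∀ z → z ⊕ n ≡ s (s (s z)))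
odd-step _ (r , refl) with s² r
... | inj₁ e = inj₁ λ z → e (s z)
... | inj₂ e = inj₂ λ z → e (s z)

odd-return : ∀ n → Odd n → ∀ z → z ⊕ n ⊕ n ⊕ n ⊕ n ≡ z
odd-return n o z with odd-step n o
... | inj₁ e rewrite e z | e (s z) | e (s (s z)) | e (s (s (s z))) = s⁴ z
... | inj₂ e rewrite e z | e (s (s (s z))) | s⁴ (s (s z)) | e (s (s z)) | s⁴ (s z) | e (s z) = s⁴ z

odd-sum : ∀ n → Odd n → (f : Z4 → ℕ) →
          f z0 + (f (z0 ⊕ n) + (f (z0 ⊕ n ⊕ n) + f (z0 ⊕ n ⊕ n ⊕ n))) ≡ Σ₄ f
odd-sum n o f with odd-step n o
... | inj₁ e rewrite e z0 | e z1 | e z2 = refl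
... | inj₂ e rewrite e z0 | e z3 | e z2 = lemma (f z0) (f z1) (f z2) (f z3)
  where
  lemma : ∀ a b c d → a + (d + (c + b)) ≡ a + (b + (c + d))
  lemma = solve-∀

pow : (A → A) → A → ℕ → A
pow F v zero    = v
pow F v (suc n) = pow F (F v) n

osum : (A → A) → (A → ℕ) → A → ℕ → ℕ
osum F f v zero    = 0
osum F f v (suc n) = f v + osum F f (F v) n

pow-+ : (F : A → A) (v : A) (a b : ℕ) → pow F v (a + b) ≡ pow F (pow F v a) b
pow-+ F v zero    b = refl
pow-+ F v (suc a) b = pow-+ F (F v) a b

osum-+ : (F : A → A) (f : A → ℕ) (v : A) (a b : ℕ) →
         osum F f v (a + b) ≡ osum F f v a + osum F f (pow F v a) b
osum-+ F f v zero    b = refl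
osum-+ F f v (suc a) b = trans (cong (f v +_) (osum-+ F f (F v) a b)) (sym (+-assoc (f v) _ _))

-- By orb and ret, each F t permutes the vertices listed in all in a single cycle of length N.
record Dyn (T V : Set) : Set where
  field
    all : List V
    F   : T → V → V
    v₀  : V
    N   : ℕ
    orb : ∀ t f → osum (F t) f v₀ N ≡ ∑ all f
    ret : ∀ t → pow (F t) v₀ N ≡ v₀

all₄ : List A → List (A × Z4)
all₄ []      = []
all₄ (v ∷ l) = (v , z0) ∷ (v , z1) ∷ (v , z2) ∷ (v , z3) ∷ all₄ l

∑-all₄ : (l : List A) (f : A × Z4 → ℕ) → ∑ (all₄ l) f ≡ ∑ l (λ v → Σ₄ λ z → f (v , z))
∑-all₄ []      f = refl
∑-all₄ (v ∷ l) f rewrite ∑-all₄ l f = lemma (f (v , z0)) (f (v , z1)) (f (v , z2)) (f (v , z3)) _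
  where
  lemma : ∀ a b c d e → a + (b + (c + (d + e))) ≡ a + (b + (c + d)) + e
  lemma = solve-∀

-- A skew product: while `F t` runs once around its cycle, the height in Z4 changes by the total of
-- `κ t`. As this total is odd, four successive laps start at four different heights and join to one
-- cycle of length 4N.
module Extend {T V : Set} (D : Dyn T V) (κ : T → V → ℕ) (odd : ∀ t → Odd (∑ (Dyn.all D) (κ t))) where
  open Dyn D

  F₄ : T → V × Z4 → V × Z4
  F₄ t (v , z) = F t v , z ⊕ κ t v

  pow₄ : ∀ t v z n → pow (F₄ t) (v , z) n ≡ (pow (F t) v n , z ⊕ osum (F t) (κ t) v n)
  pow₄ t v z zero    = refl
  pow₄ t v z (suc n) = trans (pow₄ t (F t v) (z ⊕ κ t v) n) (cong (pow (F t) (F t v) n ,_) (sym (⊕-+ z (κ t v) _)))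

  turn : T → ℕ
  turn t = osum (F t) (κ t) v₀ N

  turn-odd : ∀ t → Odd (turn t)
  turn-odd t = proj₁ (odd t) , trans (orb t (κ t)) (proj₂ (odd t))

  lap : ∀ t z → pow (F₄ t) (v₀ , z) N ≡ (v₀ , z ⊕ turn t)
  lap t z = trans (pow₄ t v₀ z N) (cong (_, z ⊕ turn t) (ret t))

  -- For all four starting heights together, the shift made at each step merely permutes the
  -- heights.
  osum₄ : ∀ t (f : V × Z4 → ℕ) v n →
          Σ₄ (λ z → osum (F₄ t) f (v , z) n) ≡ osum (F t) (λ u → Σ₄ λ z → f (u , z)) v n
  osum₄ t f v zero    = refl
  osum₄ t f v (suc n) = trans (Σ₄-+ (λ z → f (v , z)) (λ z → osum (F₄ t) f (F t v , z ⊕ κ t v) n))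
    (cong (Σ₄ (λ z → f (v , z)) +_)
      (trans (Σ₄-⊕ (κ t v) (λ z → osum (F₄ t) f (F t v , z) n)) (osum₄ t f (F t v) n)))

  osum-lap : ∀ t f z n → osum (F₄ t) f (v₀ , z) (N + n) ≡
             osum (F₄ t) f (v₀ , z) N + osum (F₄ t) f (v₀ , z ⊕ turn t) n
  osum-lap t f z n = trans (osum-+ (F₄ t) f (v₀ , z) N n)
    (cong (λ p → osum (F₄ t) f (v₀ , z) N + osum (F₄ t) f p n) (lap t z))

  pow-lap : ∀ t z n → pow (F₄ t) (v₀ , z) (N + n) ≡ pow (F₄ t) (v₀ , z ⊕ turn t) n
  pow-lap t z n = trans (pow-+ (F₄ t) (v₀ , z) N n) (cong (λ p → pow (F₄ t) p n) (lap t z))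

  extend : Dyn T (V × Z4)
  extend = record
    { all = all₄ all ; F = F₄ ; v₀ = v₀ , z0 ; N = N + (N + (N + N)) ; orb = orb₄ ; ret = ret₄ }
    where
    ret₄ : ∀ t → pow (F₄ t) (v₀ , z0) (N + (N + (N + N))) ≡ (v₀ , z0)
    ret₄ t = trans (pow-lap t z0 _) (trans (pow-lap t _ _) (trans (pow-lap t _ _) (trans (lap t _)
      (cong (v₀ ,_) (odd-return (turn t) (turn-odd t) z0)))))
    orb₄ : ∀ t f → osum (F₄ t) f (v₀ , z0) (N + (N + (N + N))) ≡ ∑ (all₄ all) f
    orb₄ t f = begin
      osum (F₄ t) f (v₀ , z0) (N + (N + (N + N)))
        ≡⟨ trans (osum-lap t f z0 _) (cong (g z0 +_) (trans (osum-lap t f _ _)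
             (cong (g (z0 ⊕ n) +_) (osum-lap t f _ _)))) ⟩
      g z0 + (g (z0 ⊕ n) + (g (z0 ⊕ n ⊕ n) + g (z0 ⊕ n ⊕ n ⊕ n)))
        ≡⟨ odd-sum n (turn-odd t) g ⟩
      Σ₄ g                                       ≡⟨ osum₄ t f v₀ N ⟩
      osum (F t) (λ u → Σ₄ λ z → f (u , z)) v₀ N ≡⟨ orb t _ ⟩
      ∑ all (λ u → Σ₄ λ z → f (u , z))           ≡⟨ ∑-all₄ all f ⟨
      ∑ (all₄ all) f                             ∎
      where
      open ≡-Reasoning
      n = turn t
      g : Z4 → ℕ
      g z = osum (F₄ t) f (v₀ , z) N

-- Patterns for dividing a class of parallel generators

infix 4 _≈₂_

-- Congruence modulo 2 with the left side known to be the larger one. The direction keeps the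
-- witness in ℕ, and `a ≈₂ 1` holds the data of `Odd a`.
record _≈₂_ (a b : ℕ) : Set where
  constructor _,_
  field
    half-excess : ℕ
    excess      : a ≡ b + (half-excess + half-excess)

≈-reflexive : ∀ {a b} → a ≡ b → a ≈₂ b
≈-reflexive refl = 0 , sym (+-identityʳ _)

≈-trans : ∀ {a b c} → a ≈₂ b → b ≈₂ c → a ≈₂ c
≈-trans {c = c} (r , refl) (r′ , refl) = r′ + r , lemma c r r′
  where
  lemma : ∀ c r r′ → c + (r′ + r′) + (r + r) ≡ c + (r′ + r + (r′ + r))
  lemma = solve-∀

≈-+ : ∀ {a b c d} → a ≈₂ b → c ≈₂ d → a + c ≈₂ b + d
≈-+ {b = b} {d = d} (r , refl) (r′ , refl) = r + r′ , lemma b d r r′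
  where
  lemma : ∀ b d r r′ → b + (r + r) + (d + (r′ + r′)) ≡ b + d + (r + r′ + (r + r′))
  lemma = solve-∀

≈-join : ∀ {a b c d e f} → a ≡ b + c → b ≈₂ d → c ≈₂ e → d + e ≡ f → a ≈₂ f
≈-join refl p q refl = ≈-+ p q

≈-substʳ : ∀ {a b c} → a ≈₂ b → b ≡ c → a ≈₂ c
≈-substʳ p refl = p

module Pattern (U : Set) where

  Track : Set
  Track = U × Bool

  -- A list of tracks split into units {(u , true) , (u , false)} and single tracks.
  Shape : Set
  Shape = List U × List Track

  pair : (Track → ℕ) → U → ℕ
  pair g u = g (u , true) + g (u , false)

  W : (Track → ℕ) → Shape → ℕ
  W g (us , rs) = ∑ us (pair g) + ∑ rs g

  len : Shape → ℕ
  len ([]     , rs) = length rs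
  len (u ∷ us , rs) = suc (suc (len (us , rs)))

  len≡ : ∀ us rs → len (us , rs) ≡ length us + length us + length rs
  len≡ []       rs = refl
  len≡ (u ∷ us) rs = trans (cong (2 +_) (len≡ us rs)) (lemma (length us) (length rs))
    where
    lemma : ∀ k r → 2 + (k + k + r) ≡ suc k + suc k + r
    lemma = solve-∀

  W-1 : ∀ h → W (λ _ → 1) h ≡ len h
  W-1 (us , rs) = trans (cong₂ _+_ (∑-const us 2) (∑-const rs 1))
    (trans (lemma (length us) (length rs)) (sym (len≡ us rs)))
    where
    lemma : ∀ a b → a * 2 + b * 1 ≡ a + a + b
    lemma = solve-∀

  infixr 5 _⊞_

  _⊞_ : Shape → Shape → Shape
  (us , rs) ⊞ (us′ , rs′) = us ++ us′ , rs ++ rs′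

  W-⊞ : ∀ g h h′ → W g (h ⊞ h′) ≡ W g h + W g h′
  W-⊞ g (us , rs) (us′ , rs′) = trans (cong₂ _+_ (∑-++ us us′ (pair g)) (∑-++ rs rs′ g))
    (+-interchange (∑ us (pair g)) _ _ _)

  len-⊞ : ∀ h h′ → len (h ⊞ h′) ≡ len h + len h′
  len-⊞ (us , rs) (us′ , rs′) = begin
    len (us ++ us′ , rs ++ rs′)  ≡⟨ len≡ (us ++ us′) _ ⟩
    length (us ++ us′) + length (us ++ us′) + length (rs ++ rs′)
      ≡⟨ cong₂ (λ a b → a + a + b) (length-++ us) (length-++ rs) ⟩
    (length us + length us′) + (length us + length us′) + (length rs + length rs′)
      ≡⟨ lemma (length us) (length us′) (length rs) (length rs′) ⟩
    (length us + length us + length rs) + (length us′ + length us′ + length rs′)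
      ≡⟨ cong₂ _+_ (len≡ us rs) (len≡ us′ rs′) ⟨
    len (us , rs) + len (us′ , rs′) ∎
    where
    open ≡-Reasoning
    lemma : ∀ a b c d → (a + b) + (a + b) + (c + d) ≡ (a + a + c) + (b + b + d)
    lemma = solve-∀

  Split : Set
  Split = Shape × Shape

  _⊞₂_ : Split → Split → Split
  (h , k) ⊞₂ (h′ , k′) = h ⊞ h′ , k ⊞ k′

  -- A quad consists of four vertices z0, …, z3 with the same shape h; sp z h divides the tracks at the vertex z.
  -- Over the quad, the first part must meet every track of a unit an odd number of times and every other track
  -- an even number of times, and every unit must reappear once in the first part and once in the second one.
  record Good (q q₁ q₂ : ℕ) (sp : Z4 → Shape → Split) : Set where
    field
      len₁  : ∀ z h → len h ≡ q → len (proj₁ (sp z h)) ≡ q₁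
      len₂  : ∀ z h → len h ≡ q → len (proj₂ (sp z h)) ≡ q₂
      bag   : ∀ z h → len h ≡ q → ∀ g → W g (proj₁ (sp z h)) + W g (proj₂ (sp z h)) ≡ W g h
      odd   : ∀ h → len h ≡ q → ∀ g → Σ₄ (λ z → W g (proj₁ (sp z h))) ≈₂ ∑ (proj₁ h) (pair g)
      home₁ : 2 ≤ q₁ → ∀ h → len h ≡ q → ∀ g → Σ₄ (λ z → ∑ (proj₁ (proj₁ (sp z h))) g) ≡ ∑ (proj₁ h) g
      home₂ : 2 ≤ q₂ → ∀ h → len h ≡ q → ∀ g → Σ₄ (λ z → ∑ (proj₁ (proj₂ (sp z h))) g) ≡ ∑ (proj₁ h) g

  -- The constant weight 1 turns the equality of bags into additivity of lengths.
  complement : ∀ {q q₁ q₂} (sp : Z4 → Shape → Split) → q ≡ q₁ + q₂ →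
    (∀ z h → len h ≡ q → len (proj₁ (sp z h)) ≡ q₁) →
    (∀ z h → len h ≡ q → ∀ g → W g (proj₁ (sp z h)) + W g (proj₂ (sp z h)) ≡ W g h) →
    ∀ z h → len h ≡ q → len (proj₂ (sp z h)) ≡ q₂
  complement {q₁ = q₁} sp q≡ len₁ bag z h e = +-cancelˡ-≡ q₁ _ _ (trans
    (cong₂ _+_ (sym (trans (W-1 (proj₁ (sp z h))) (len₁ z h e))) (sym (W-1 (proj₂ (sp z h)))))
    (trans (bag z h e (λ _ → 1)) (trans (W-1 h) (trans e q≡))))

  ∅ : Split
  ∅ = ([] , []) , ([] , [])

  -- With one place in each part there is no room for a home. One member of the unit meets the first
  -- part three times and the other once, so both counts are odd.
  split₂ : Z4 → Shape → Split
  split₂ z  ([]     , x ∷ y ∷ []) = ([] , x ∷ []) , ([] , y ∷ [])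
  split₂ z0 (u ∷ [] , []) = ([] , (u , false) ∷ []) , ([] , (u , true) ∷ [])
  split₂ _  (u ∷ [] , []) = ([] , (u , true) ∷ []) , ([] , (u , false) ∷ [])
  split₂ _  _ = ∅

  good₂ : Good 2 1 1 split₂
  good₂ = record
    { len₁ = len₁ ; len₂ = complement split₂ refl len₁ bag ; bag = bag ; odd = odd ; home₁ = λ { (s≤s ()) } ; home₂ = λ { (s≤s ()) } }
    where
    len₁ : ∀ z h → len h ≡ 2 → len (proj₁ (split₂ z h)) ≡ 1
    len₁ z  ([] , x ∷ y ∷ []) _ = refl
    len₁ z0 (u ∷ [] , []) _ = refl
    len₁ z1 (u ∷ [] , []) _ = refl
    len₁ z2 (u ∷ [] , []) _ = refl
    len₁ z3 (u ∷ [] , []) _ = refl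
    swap : ∀ a b → b + 0 + (a + 0) ≡ a + b + 0 + 0
    swap = solve-∀
    noswap : ∀ a b → a + 0 + (b + 0) ≡ a + b + 0 + 0
    noswap = solve-∀
    noswap′ : ∀ a b → a + 0 + (b + 0) ≡ a + (b + 0)
    noswap′ = solve-∀
    bag : ∀ z h → len h ≡ 2 → ∀ g → W g (proj₁ (split₂ z h)) + W g (proj₂ (split₂ z h)) ≡ W g h
    bag z  ([] , x ∷ y ∷ []) _ g = noswap′ (g x) (g y)
    bag z0 (u ∷ [] , []) _ g = swap (g (u , true)) (g (u , false))
    bag z1 (u ∷ [] , []) _ g = noswap (g (u , true)) (g (u , false))
    bag z2 (u ∷ [] , []) _ g = noswap (g (u , true)) (g (u , false))
    bag z3 (u ∷ [] , []) _ g = noswap (g (u , true)) (g (u , false))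
    even : ∀ a → a + 0 + (a + 0 + (a + 0 + (a + 0))) ≡ a + a + (a + a)
    even = solve-∀
    odd′ : ∀ a b → b + 0 + (a + 0 + (a + 0 + (a + 0))) ≡ a + b + 0 + (a + a)
    odd′ = solve-∀
    odd : ∀ h → len h ≡ 2 → ∀ g → Σ₄ (λ z → W g (proj₁ (split₂ z h))) ≈₂ ∑ (proj₁ h) (pair g)
    odd ([] , x ∷ y ∷ []) _ g = g x + g x , even (g x)
    odd (u ∷ [] , []) _ g = g (u , true) , odd′ (g (u , true)) (g (u , false))

  -- Each member of the unit gets the first part once, the single track gets it twice. The second
  -- part receives both members at `z2` and at `z3`, but they form a unit only at `z2`, since one
  -- home is wanted.
  split₃ : Z4 → Shape → Split
  split₃ z  ([]     , x ∷ y ∷ w ∷ []) = ([] , x ∷ []) , ([] , y ∷ w ∷ [])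
  split₃ z0 (u ∷ [] , x ∷ []) = ([] , (u , true) ∷ [])  , ([] , (u , false) ∷ x ∷ [])
  split₃ z1 (u ∷ [] , x ∷ []) = ([] , (u , false) ∷ []) , ([] , (u , true) ∷ x ∷ [])
  split₃ z2 (u ∷ [] , x ∷ []) = ([] , x ∷ [])           , (u ∷ [] , [])
  split₃ z3 (u ∷ [] , x ∷ []) = ([] , x ∷ [])           , ([] , (u , true) ∷ (u , false) ∷ [])
  split₃ _  _ = ∅

  good₃ : Good 3 1 2 split₃
  good₃ = record
    { len₁ = len₁ ; len₂ = complement split₃ refl len₁ bag ; bag = bag ; odd = odd ; home₁ = λ { (s≤s ()) } ; home₂ = λ _ → home₂ }
    where
    len₁ : ∀ z h → len h ≡ 3 → len (proj₁ (split₃ z h)) ≡ 1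
    len₁ z  ([] , x ∷ y ∷ w ∷ []) _ = refl
    len₁ z0 (u ∷ [] , x ∷ []) _ = refl
    len₁ z1 (u ∷ [] , x ∷ []) _ = refl
    len₁ z2 (u ∷ [] , x ∷ []) _ = refl
    len₁ z3 (u ∷ [] , x ∷ []) _ = refl
    bag₀ : ∀ a b c → a + 0 + (b + (c + 0)) ≡ a + (b + (c + 0))
    bag₀ = solve-∀
    bag₁ : ∀ a b x → a + 0 + (b + (x + 0)) ≡ a + b + 0 + (x + 0)
    bag₁ = solve-∀
    bag₂ : ∀ a b x → b + 0 + (a + (x + 0)) ≡ a + b + 0 + (x + 0)
    bag₂ = solve-∀
    bag₃ : ∀ a b x → x + 0 + (a + b + 0 + 0) ≡ a + b + 0 + (x + 0)
    bag₃ = solve-∀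
    bag₄ : ∀ a b x → x + 0 + (a + (b + 0)) ≡ a + b + 0 + (x + 0)
    bag₄ = solve-∀
    bag : ∀ z h → len h ≡ 3 → ∀ g → W g (proj₁ (split₃ z h)) + W g (proj₂ (split₃ z h)) ≡ W g h
    bag z  ([] , x ∷ y ∷ w ∷ []) _ g = bag₀ (g x) (g y) (g w)
    bag z0 (u ∷ [] , x ∷ []) _ g = bag₁ (g (u , true)) (g (u , false)) (g x)
    bag z1 (u ∷ [] , x ∷ []) _ g = bag₂ (g (u , true)) (g (u , false)) (g x)
    bag z2 (u ∷ [] , x ∷ []) _ g = bag₃ (g (u , true)) (g (u , false)) (g x)
    bag z3 (u ∷ [] , x ∷ []) _ g = bag₄ (g (u , true)) (g (u , false)) (g x)
    even : ∀ a → a + 0 + (a + 0 + (a + 0 + (a + 0))) ≡ a + a + (a + a)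
    even = solve-∀
    odd′ : ∀ a b x → a + 0 + (b + 0 + (x + 0 + (x + 0))) ≡ a + b + 0 + (x + x)
    odd′ = solve-∀
    odd : ∀ h → len h ≡ 3 → ∀ g → Σ₄ (λ z → W g (proj₁ (split₃ z h))) ≈₂ ∑ (proj₁ h) (pair g)
    odd ([] , x ∷ y ∷ w ∷ []) _ g = g x + g x , even (g x)
    odd (u ∷ [] , x ∷ []) _ g = g x , odd′ (g (u , true)) (g (u , false)) (g x)
    home₂ : ∀ h → len h ≡ 3 → ∀ g → Σ₄ (λ z → ∑ (proj₁ (proj₂ (split₃ z h))) g) ≡ ∑ (proj₁ h) g
    home₂ ([] , x ∷ y ∷ w ∷ []) _ g = refl
    home₂ (u ∷ [] , x ∷ []) _ g = +-identityʳ _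

  -- `z0` and `z1` provide the homes in both parts; `z2` and `z3` are alike, so that members of `a`
  -- meet the first part three times and those of `b` once.
  two : Z4 → U → U → Split
  two z0 a b = (a ∷ [] , []) , (b ∷ [] , [])
  two z1 a b = (b ∷ [] , []) , (a ∷ [] , [])
  two _  a b = ([] , (a , true) ∷ (a , false) ∷ []) , ([] , (b , true) ∷ (b , false) ∷ [])

  -- The homes rotate through `z0`, `z1`, `z2`, and each time the third unit is torn apart. With
  -- `z3` the `true` members meet the first part three times, the `false` members once.
  three : Z4 → U → U → U → Split
  three z0 a b c = (a ∷ [] , (b , true) ∷ []) , (c ∷ [] , (b , false) ∷ [])
  three z1 a b c = (b ∷ [] , (c , true) ∷ []) , (a ∷ [] , (c , false) ∷ [])
  three z2 a b c = (c ∷ [] , (a , true) ∷ []) , (b ∷ [] , (a , false) ∷ [])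
  three z3 a b c = ([] , (a , true)  ∷ (b , true)  ∷ (c , true)  ∷ []) ,
                   ([] , (a , false) ∷ (b , false) ∷ (c , false) ∷ [])

  -- A lone unit cannot fill both parts and borrows two single tracks, each of which meets the first
  -- part exactly twice.
  one : Z4 → U → Track → Track → Split
  one z0 u x y = (u ∷ [] , []) , ([] , x ∷ y ∷ [])
  one z1 u x y = ([] , x ∷ y ∷ []) , (u ∷ [] , [])
  one z2 u x y = ([] , x ∷ (u , true) ∷ []) , ([] , y ∷ (u , false) ∷ [])
  one z3 u x y = ([] , y ∷ (u , true) ∷ []) , ([] , x ∷ (u , false) ∷ [])

  -- Every number of units other than one is a sum of twos and at most one three. In each block both
  -- parts receive as many tracks as there are units.
  core : Z4 → List U → Split
  core z (a ∷ b ∷ [])           = two z a b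
  core z (a ∷ b ∷ c ∷ [])       = three z a b c
  core z (a ∷ b ∷ c ∷ d ∷ us)   = two z a b ⊞₂ core z (c ∷ d ∷ us)
  core z _                      = ∅

  NotOne : List U → Set
  NotOne (_ ∷ []) = ⊥
  NotOne _        = ⊤

  two-len₁ : ∀ z a b → len (proj₁ (two z a b)) ≡ 2
  two-len₁ z0 a b = refl
  two-len₁ z1 a b = refl
  two-len₁ z2 a b = refl
  two-len₁ z3 a b = refl

  core-len₁ : ∀ z us → NotOne us → len (proj₁ (core z us)) ≡ length us
  core-len₁ z  [] _ = refl
  core-len₁ z  (a ∷ b ∷ []) _ = two-len₁ z a b
  core-len₁ z0 (a ∷ b ∷ c ∷ []) _ = refl
  core-len₁ z1 (a ∷ b ∷ c ∷ []) _ = refl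
  core-len₁ z2 (a ∷ b ∷ c ∷ []) _ = refl
  core-len₁ z3 (a ∷ b ∷ c ∷ []) _ = refl
  core-len₁ z  (a ∷ b ∷ c ∷ d ∷ us) _ = trans (len-⊞ (proj₁ (two z a b)) _)
    (cong₂ _+_ (two-len₁ z a b) (core-len₁ z (c ∷ d ∷ us) tt))

  two-bag₀ : ∀ a a′ b b′ → a + a′ + 0 + 0 + (b + b′ + 0 + 0) ≡ a + a′ + (b + b′)
  two-bag₀ = solve-∀
  two-bag₁ : ∀ a a′ b b′ → b + b′ + 0 + 0 + (a + a′ + 0 + 0) ≡ a + a′ + (b + b′)
  two-bag₁ = solve-∀
  two-bag₂ : ∀ a a′ b b′ → a + (a′ + 0) + (b + (b′ + 0)) ≡ a + a′ + (b + b′)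
  two-bag₂ = solve-∀

  two-bag : ∀ z a b g → W g (proj₁ (two z a b)) + W g (proj₂ (two z a b)) ≡ pair g a + pair g b
  two-bag z0 a b g = two-bag₀ (g (a , true)) (g (a , false)) (g (b , true)) (g (b , false))
  two-bag z1 a b g = two-bag₁ (g (a , true)) (g (a , false)) (g (b , true)) (g (b , false))
  two-bag z2 a b g = two-bag₂ (g (a , true)) (g (a , false)) (g (b , true)) (g (b , false))
  two-bag z3 a b g = two-bag₂ (g (a , true)) (g (a , false)) (g (b , true)) (g (b , false))

  three-bag₀ : ∀ a a′ b b′ c c′ → a + a′ + 0 + (b + 0) + (c + c′ + 0 + (b′ + 0)) ≡ a + a′ + (b + b′ + (c + c′))
  three-bag₀ = solve-∀
  three-bag₁ : ∀ a a′ b b′ c c′ → b + b′ + 0 + (c + 0) + (a + a′ + 0 + (c′ + 0)) ≡ a + a′ + (b + b′ + (c + c′))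
  three-bag₁ = solve-∀
  three-bag₂ : ∀ a a′ b b′ c c′ → c + c′ + 0 + (a + 0) + (b + b′ + 0 + (a′ + 0)) ≡ a + a′ + (b + b′ + (c + c′))
  three-bag₂ = solve-∀
  three-bag₃ : ∀ a a′ b b′ c c′ → a + (b + (c + 0)) + (a′ + (b′ + (c′ + 0))) ≡ a + a′ + (b + b′ + (c + c′))
  three-bag₃ = solve-∀

  three-bag : ∀ z a b c g → W g (proj₁ (three z a b c)) + W g (proj₂ (three z a b c)) ≡
              pair g a + (pair g b + pair g c)
  three-bag z0 a b c g = three-bag₀ (g (a , true)) (g (a , false)) (g (b , true)) (g (b , false)) (g (c , true)) (g (c , false))
  three-bag z1 a b c g = three-bag₁ (g (a , true)) (g (a , false)) (g (b , true)) (g (b , false)) (g (c , true)) (g (c , false))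
  three-bag z2 a b c g = three-bag₂ (g (a , true)) (g (a , false)) (g (b , true)) (g (b , false)) (g (c , true)) (g (c , false))
  three-bag z3 a b c g = three-bag₃ (g (a , true)) (g (a , false)) (g (b , true)) (g (b , false)) (g (c , true)) (g (c , false))

  one-bag₀ : ∀ a b x y → a + b + 0 + 0 + (x + (y + 0)) ≡ a + b + (x + y)
  one-bag₀ = solve-∀
  one-bag₁ : ∀ a b x y → x + (y + 0) + (a + b + 0 + 0) ≡ a + b + (x + y)
  one-bag₁ = solve-∀
  one-bag₂ : ∀ a b x y → x + (a + 0) + (y + (b + 0)) ≡ a + b + (x + y)
  one-bag₂ = solve-∀
  one-bag₃ : ∀ a b x y → y + (a + 0) + (x + (b + 0)) ≡ a + b + (x + y)
  one-bag₃ = solve-∀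

  one-bag : ∀ z u x y g → W g (proj₁ (one z u x y)) + W g (proj₂ (one z u x y)) ≡ pair g u + (g x + g y)
  one-bag z0 u x y g = one-bag₀ (g (u , true)) (g (u , false)) (g x) (g y)
  one-bag z1 u x y g = one-bag₁ (g (u , true)) (g (u , false)) (g x) (g y)
  one-bag z2 u x y g = one-bag₂ (g (u , true)) (g (u , false)) (g x) (g y)
  one-bag z3 u x y g = one-bag₃ (g (u , true)) (g (u , false)) (g x) (g y)

  W₂-⊞ : ∀ g (p p′ : Split) → W g (proj₁ (p ⊞₂ p′)) + W g (proj₂ (p ⊞₂ p′)) ≡
         (W g (proj₁ p) + W g (proj₂ p)) + (W g (proj₁ p′) + W g (proj₂ p′))
  W₂-⊞ g p p′ = trans (cong₂ _+_ (W-⊞ g (proj₁ p) (proj₁ p′)) (W-⊞ g (proj₂ p) (proj₂ p′)))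
    (+-interchange (W g (proj₁ p)) _ _ _)

  core-bag : ∀ z us → NotOne us → ∀ g → W g (proj₁ (core z us)) + W g (proj₂ (core z us)) ≡ ∑ us (pair g)
  core-bag z [] _ g = refl
  core-bag z (a ∷ b ∷ []) _ g = trans (two-bag z a b g) (cong (pair g a +_) (sym (+-identityʳ _)))
  core-bag z (a ∷ b ∷ c ∷ []) _ g =
    trans (three-bag z a b c g) (cong (λ k → pair g a + (pair g b + k)) (sym (+-identityʳ _)))
  core-bag z (a ∷ b ∷ c ∷ d ∷ us) _ g = trans (W₂-⊞ g (two z a b) (core z (c ∷ d ∷ us)))
    (trans (cong₂ _+_ (two-bag z a b g) (core-bag z (c ∷ d ∷ us) tt g)) (+-assoc (pair g a) _ _))

  two-odd : ∀ a b g → Σ₄ (λ z → W g (proj₁ (two z a b))) ≈₂ pair g a + pair g b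
  two-odd a b g = pair g a , lemma (g (a , true)) (g (a , false)) (g (b , true)) (g (b , false))
    where
    lemma : ∀ a a′ b b′ → a + a′ + 0 + 0 + (b + b′ + 0 + 0 + (a + (a′ + 0) + (a + (a′ + 0)))) ≡
            a + a′ + (b + b′) + (a + a′ + (a + a′))
    lemma = solve-∀

  three-odd : ∀ a b c g → Σ₄ (λ z → W g (proj₁ (three z a b c))) ≈₂ pair g a + (pair g b + pair g c)
  three-odd a b c g = g (a , true) + (g (b , true) + g (c , true)) ,
    lemma (g (a , true)) (g (a , false)) (g (b , true)) (g (b , false)) (g (c , true)) (g (c , false))
    where
    lemma : ∀ a a′ b b′ c c′ →
      a + a′ + 0 + (b + 0) + (b + b′ + 0 + (c + 0) + (c + c′ + 0 + (a + 0) + (a + (b + (c + 0))))) ≡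
      a + a′ + (b + b′ + (c + c′)) + (a + (b + c) + (a + (b + c)))
    lemma = solve-∀

  one-odd : ∀ u x y g → Σ₄ (λ z → W g (proj₁ (one z u x y))) ≈₂ pair g u
  one-odd u x y g = g (u , true) + (g x + g y) , lemma (g (u , true)) (g (u , false)) (g x) (g y)
    where
    lemma : ∀ a b x y → a + b + 0 + 0 + (x + (y + 0) + (x + (a + 0) + (y + (a + 0)))) ≡
            a + b + (a + (x + y) + (a + (x + y)))
    lemma = solve-∀

  Σ₄-W-⊞ : ∀ g (p p′ : Z4 → Split) → Σ₄ (λ z → W g (proj₁ (p z ⊞₂ p′ z))) ≡
           Σ₄ (λ z → W g (proj₁ (p z))) + Σ₄ (λ z → W g (proj₁ (p′ z)))
  Σ₄-W-⊞ g p p′ = trans (Σ₄-cong (λ z → W-⊞ g (proj₁ (p z)) (proj₁ (p′ z))))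
    (Σ₄-+ (λ z → W g (proj₁ (p z))) (λ z → W g (proj₁ (p′ z))))

  core-odd : ∀ us → NotOne us → ∀ g → Σ₄ (λ z → W g (proj₁ (core z us))) ≈₂ ∑ us (pair g)
  core-odd [] _ g = 0 , refl
  core-odd (a ∷ b ∷ []) _ g =
    ≈-substʳ (two-odd a b g) (cong (pair g a +_) (sym (+-identityʳ (pair g b))))
  core-odd (a ∷ b ∷ c ∷ []) _ g =
    ≈-substʳ (three-odd a b c g) (cong (λ k → pair g a + (pair g b + k)) (sym (+-identityʳ (pair g c))))
  core-odd (a ∷ b ∷ c ∷ d ∷ us) _ g = ≈-join
    (Σ₄-W-⊞ g (λ z → two z a b) (λ z → core z (c ∷ d ∷ us)))
    (two-odd a b g) (core-odd (c ∷ d ∷ us) tt g)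
    (+-assoc (pair g a) (pair g b) (∑ (c ∷ d ∷ us) (pair g)))

  two-home₁ : ∀ a b g → Σ₄ (λ z → ∑ (proj₁ (proj₁ (two z a b))) g) ≡ g a + (g b + 0)
  two-home₁ a b g = lemma (g a) (g b)
    where
    lemma : ∀ a b → a + 0 + (b + 0 + (0 + 0)) ≡ a + (b + 0)
    lemma = solve-∀

  assoc₀ : ∀ a b e → a + (b + 0) + e ≡ a + (b + e)
  assoc₀ = solve-∀

  core-home₁ : ∀ us → NotOne us → ∀ g → Σ₄ (λ z → ∑ (proj₁ (proj₁ (core z us))) g) ≡ ∑ us g
  core-home₁ [] _ g = refl
  core-home₁ (a ∷ b ∷ []) _ g = two-home₁ a b g
  core-home₁ (a ∷ b ∷ c ∷ []) _ g = lemma (g a) (g b) (g c)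
    where
    lemma : ∀ a b c → a + 0 + (b + 0 + (c + 0 + 0)) ≡ a + (b + (c + 0))
    lemma = solve-∀
  core-home₁ (a ∷ b ∷ c ∷ d ∷ us) _ g =
    trans (trans (Σ₄-cong (λ z → ∑-++ (proj₁ (proj₁ (two z a b))) (proj₁ (proj₁ (core z (c ∷ d ∷ us)))) g))
        (Σ₄-+ (λ z → ∑ (proj₁ (proj₁ (two z a b))) g) (λ z → ∑ (proj₁ (proj₁ (core z (c ∷ d ∷ us)))) g)))
      (trans (cong₂ _+_ (two-home₁ a b g) (core-home₁ (c ∷ d ∷ us) tt g))
        (assoc₀ (g a) (g b) _))

  two-home₂ : ∀ a b g → Σ₄ (λ z → ∑ (proj₁ (proj₂ (two z a b))) g) ≡ g a + (g b + 0)
  two-home₂ a b g = lemma (g a) (g b)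
    where
    lemma : ∀ a b → b + 0 + (a + 0 + (0 + 0)) ≡ a + (b + 0)
    lemma = solve-∀

  core-home₂ : ∀ us → NotOne us → ∀ g → Σ₄ (λ z → ∑ (proj₁ (proj₂ (core z us))) g) ≡ ∑ us g
  core-home₂ [] _ g = refl
  core-home₂ (a ∷ b ∷ []) _ g = two-home₂ a b g
  core-home₂ (a ∷ b ∷ c ∷ []) _ g = lemma (g a) (g b) (g c)
    where
    lemma : ∀ a b c → c + 0 + (a + 0 + (b + 0 + 0)) ≡ a + (b + (c + 0))
    lemma = solve-∀
  core-home₂ (a ∷ b ∷ c ∷ d ∷ us) _ g =
    trans (trans (Σ₄-cong (λ z → ∑-++ (proj₁ (proj₂ (two z a b))) (proj₁ (proj₂ (core z (c ∷ d ∷ us)))) g))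
        (Σ₄-+ (λ z → ∑ (proj₁ (proj₂ (two z a b))) g) (λ z → ∑ (proj₁ (proj₂ (core z (c ∷ d ∷ us)))) g)))
      (trans (cong₂ _+_ (two-home₂ a b g) (core-home₂ (c ∷ d ∷ us) tt g))
        (assoc₀ (g a) (g b) _))

  -- The remaining single tracks are divided alike at all four vertices, so the uses of the first
  -- part come in fours.
  fill : ℕ → List Track → Split
  fill j rs = ([] , take j rs) , ([] , drop j rs)

  fill-bag : ∀ j rs g → W g (proj₁ (fill j rs)) + W g (proj₂ (fill j rs)) ≡ ∑ rs g
  fill-bag j rs g = trans (sym (∑-++ (take j rs) (drop j rs) g)) (cong (λ l → ∑ l g) (take++drop≡id j rs))

  fill-even : ∀ j rs g → Σ₄ (λ z → W g (proj₁ (fill j rs))) ≈₂ 0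
  fill-even j rs g = W g (proj₁ (fill j rs)) + W g (proj₁ (fill j rs)) , lemma (W g (proj₁ (fill j rs)))
    where
    lemma : ∀ a → a + (a + (a + a)) ≡ a + a + (a + a)
    lemma = solve-∀

  split₄ : ℕ → Z4 → Shape → Split
  split₄ q₁ z (u ∷ [] , x ∷ y ∷ rs) = one z u x y ⊞₂ fill (q₁ ∸ 2) rs
  split₄ q₁ z (u ∷ [] , _)          = ∅
  split₄ q₁ z (us , rs)             = core z us ⊞₂ fill (q₁ ∸ length us) rs

  good₄ : ∀ q₁ q₂ → 2 ≤ q₁ → q₁ ≤ q₂ → q₂ ≤ suc q₁ → Good (q₁ + q₂) q₁ q₂ (split₄ q₁)
  good₄ q₁ q₂ 2≤ le ge = record
    { len₁ = len₁ ; len₂ = complement (split₄ q₁) refl len₁ bag ; bag = bag ; odd = odd ; home₁ = λ _ → home₁ ; home₂ = λ _ → home₂ }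
    where
    2≤₂ : 2 ≤ q₂
    2≤₂ = ≤-trans 2≤ le
    -- The core puts `k` tracks into each part, so `k` must not exceed the smaller part; this is
    -- where the parts have to be nearly equal.
    half : ∀ k ρ → k + k + ρ ≡ q₁ + q₂ → k ≤ q₁
    half k ρ e = ≮⇒≥ λ lt → <-irrefl (sym e) (begin-strict
      q₁ + q₂         ≤⟨ +-monoʳ-≤ q₁ ge ⟩
      q₁ + suc q₁     <⟨ +-monoˡ-< (suc q₁) {q₁} ≤-refl ⟩
      suc q₁ + suc q₁ ≤⟨ +-mono-≤ lt lt ⟩
      k + k           ≤⟨ m≤m+n (k + k) ρ ⟩
      k + k + ρ       ∎)
      where open ≤-Reasoning
    rest : ∀ k ρ → k + k + ρ ≡ q₁ + q₂ → (q₁ ∸ k) + (q₂ ∸ k) ≡ ρ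
    rest k ρ e = +-cancelˡ-≡ (k + k) _ _ (begin
      k + k + ((q₁ ∸ k) + (q₂ ∸ k))   ≡⟨ +-interchange k k _ _ ⟩
      (k + (q₁ ∸ k)) + (k + (q₂ ∸ k)) ≡⟨ cong₂ _+_ (m+[n∸m]≡n (half k ρ e)) (m+[n∸m]≡n (≤-trans (half k ρ e) le)) ⟩
      q₁ + q₂                         ≡⟨ e ⟨
      k + k + ρ                       ∎)
      where open ≡-Reasoning
    fill-len₁ : ∀ k rs → k + k + length rs ≡ q₁ + q₂ → k + length (take (q₁ ∸ k) rs) ≡ q₁
    fill-len₁ k rs e = trans (cong (k +_) (trans (length-take (q₁ ∸ k) rs)
      (m≤n⇒m⊓n≡m (subst (q₁ ∸ k ≤_) (rest k _ e) (m≤m+n _ _))))) (m+[n∸m]≡n (half k _ e))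
    -- Two parts of size at least 2 make four places, so next to a lone unit there are two single
    -- tracks for `one`.
    too-short : ∀ {A : Set} {n} → suc (suc n) ≡ q₁ + q₂ → n ≤ 1 → A
    too-short refl′ n≤1 = ⊥-elim (<-irrefl refl (≤-trans (+-mono-≤ 2≤ 2≤₂) (≤-trans (≤-reflexive (sym refl′)) (s≤s (s≤s n≤1)))))
    len₁′ : ∀ z us rs → NotOne us → len (us , rs) ≡ q₁ + q₂ →
            len (proj₁ (core z us ⊞₂ fill (q₁ ∸ length us) rs)) ≡ q₁
    len₁′ z us rs n e = trans (len-⊞ (proj₁ (core z us)) _)
      (trans (cong (_+ length (take (q₁ ∸ length us) rs)) (core-len₁ z us n))
        (fill-len₁ (length us) rs (trans (sym (len≡ us rs)) e)))
    len₁ : ∀ z h → len h ≡ q₁ + q₂ → len (proj₁ (split₄ q₁ z h)) ≡ q₁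
    len₁ z  ([] , rs) e = len₁′ z [] rs tt e
    len₁ z  (u ∷ [] , []) e = too-short e z≤n
    len₁ z  (u ∷ [] , x ∷ []) e = too-short e (s≤s z≤n)
    len₁ z0 (u ∷ [] , x ∷ y ∷ rs) e = fill-len₁ 2 rs e
    len₁ z1 (u ∷ [] , x ∷ y ∷ rs) e = fill-len₁ 2 rs e
    len₁ z2 (u ∷ [] , x ∷ y ∷ rs) e = fill-len₁ 2 rs e
    len₁ z3 (u ∷ [] , x ∷ y ∷ rs) e = fill-len₁ 2 rs e
    len₁ z  (a ∷ b ∷ us , rs) e = len₁′ z (a ∷ b ∷ us) rs tt e
    bag′ : ∀ z us rs → NotOne us → ∀ g → let p = core z us ⊞₂ fill (q₁ ∸ length us) rs in
           W g (proj₁ p) + W g (proj₂ p) ≡ W g (us , rs)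
    bag′ z us rs n g = trans (W₂-⊞ g (core z us) (fill _ rs))
      (cong₂ _+_ (core-bag z us n g) (fill-bag (q₁ ∸ length us) rs g))
    bag : ∀ z h → len h ≡ q₁ + q₂ → ∀ g → W g (proj₁ (split₄ q₁ z h)) + W g (proj₂ (split₄ q₁ z h)) ≡ W g h
    bag z ([] , rs) e g = bag′ z [] rs tt g
    bag z (u ∷ [] , []) e g = too-short e z≤n
    bag z (u ∷ [] , x ∷ []) e g = too-short e (s≤s z≤n)
    bag z (u ∷ [] , x ∷ y ∷ rs) e g = trans (W₂-⊞ g (one z u x y) (fill _ rs))
      (trans (cong₂ _+_ (one-bag z u x y g) (fill-bag (q₁ ∸ 2) rs g)) (lemma (pair g u) (g x) (g y) _))
      where
      lemma : ∀ u x y r → u + (x + y) + r ≡ u + 0 + (x + (y + r))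
      lemma = solve-∀
    bag z (a ∷ b ∷ us , rs) e g = bag′ z (a ∷ b ∷ us) rs tt g
    odd′ : ∀ us rs → NotOne us → ∀ g →
           Σ₄ (λ z → W g (proj₁ (core z us ⊞₂ fill (q₁ ∸ length us) rs))) ≈₂ ∑ us (pair g)
    odd′ us rs n g = ≈-trans (≈-reflexive (Σ₄-W-⊞ g (λ z → core z us) (λ z → fill (q₁ ∸ length us) rs)))
      (≈-trans (≈-+ (core-odd us n g) (fill-even (q₁ ∸ length us) rs g)) (≈-reflexive (+-identityʳ _)))
    odd : ∀ h → len h ≡ q₁ + q₂ → ∀ g → Σ₄ (λ z → W g (proj₁ (split₄ q₁ z h))) ≈₂ ∑ (proj₁ h) (pair g)
    odd ([] , rs) e g = odd′ [] rs tt g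
    odd (u ∷ [] , []) e g = too-short e z≤n
    odd (u ∷ [] , x ∷ []) e g = too-short e (s≤s z≤n)
    odd (u ∷ [] , x ∷ y ∷ rs) e g =
      ≈-trans (≈-reflexive (Σ₄-W-⊞ g (λ z → one z u x y) (λ z → fill (q₁ ∸ 2) rs)))
        (≈-+ (one-odd u x y g) (fill-even (q₁ ∸ 2) rs g))
    odd (a ∷ b ∷ us , rs) e g = odd′ (a ∷ b ∷ us) rs tt g
    drop-[] : (p : Z4 → List U) (g : U → ℕ) → Σ₄ (λ z → ∑ (p z ++ []) g) ≡ Σ₄ (λ z → ∑ (p z) g)
    drop-[] p g = Σ₄-cong (λ z → trans (∑-++ (p z) [] g) (+-identityʳ _))
    one-home : ∀ a → a + 0 + 0 ≡ a + 0
    one-home = solve-∀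
    home₁ : ∀ h → len h ≡ q₁ + q₂ → ∀ g → Σ₄ (λ z → ∑ (proj₁ (proj₁ (split₄ q₁ z h))) g) ≡ ∑ (proj₁ h) g
    home₁ ([] , rs) e g = refl
    home₁ (u ∷ [] , []) e g = too-short e z≤n
    home₁ (u ∷ [] , x ∷ []) e g = too-short e (s≤s z≤n)
    home₁ (u ∷ [] , x ∷ y ∷ rs) e g = one-home (g u)
    home₁ (a ∷ b ∷ us , rs) e g = trans (drop-[] (λ z → proj₁ (proj₁ (core z (a ∷ b ∷ us)))) g) (core-home₁ (a ∷ b ∷ us) tt g)
    home₂ : ∀ h → len h ≡ q₁ + q₂ → ∀ g → Σ₄ (λ z → ∑ (proj₁ (proj₂ (split₄ q₁ z h))) g) ≡ ∑ (proj₁ h) g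
    home₂ ([] , rs) e g = refl
    home₂ (u ∷ [] , []) e g = too-short e z≤n
    home₂ (u ∷ [] , x ∷ []) e g = too-short e (s≤s z≤n)
    home₂ (u ∷ [] , x ∷ y ∷ rs) e g = one-home (g u)
    home₂ (a ∷ b ∷ us , rs) e g = trans (drop-[] (λ z → proj₁ (proj₂ (core z (a ∷ b ∷ us)))) g) (core-home₂ (a ∷ b ∷ us) tt g)

  record Halving (p : ℕ) : Set where
    field
      p₁ p₂ : ℕ
      p-sum : p₁ + p₂ ≡ p
      sp    : Z4 → Shape → Split
      good  : Good (suc (suc p)) (suc p₁) (suc p₂) sp

  -- Sizes are stored as predecessors, so that no part is empty. Classes of two or three generators
  -- have no division into two parts of size at least 2 and need patterns of their own.
  halving : ∀ p → Halving p
  halving 0 = record { p₁ = 0 ; p₂ = 0 ; p-sum = refl ; sp = split₂ ; good = good₂ }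
  halving 1 = record { p₁ = 0 ; p₂ = 1 ; p-sum = refl ; sp = split₃ ; good = good₃ }
  halving (suc (suc j)) = record { p₁ = suc a ; p₂ = suc b ; p-sum = cong suc eq ; sp = split₄ (2 + a)
                      ; good = subst (λ q → Good q (2 + a) (2 + b) (split₄ (2 + a))) (cong (2 +_) (trans (+-suc a (suc b)) (cong suc eq)))
                          (good₄ (2 + a) (2 + b) (s≤s (s≤s z≤n)) (s≤s (s≤s (⌊n/2⌋≤⌈n/2⌉ j)))
                            (s≤s (s≤s (⌈/2⌉≤ j)))) }
    where
    a b : ℕ
    a = ⌊ j /2⌋
    b = ⌈ j /2⌉
    ⌈/2⌉≤ : ∀ j → ⌈ j /2⌉ ≤ suc ⌊ j /2⌋
    ⌈/2⌉≤ 0 = z≤n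
    ⌈/2⌉≤ 1 = ≤-refl
    ⌈/2⌉≤ (suc (suc j)) = s≤s (⌈/2⌉≤ j)
    eq : a + suc b ≡ suc j
    eq = trans (+-suc a b) (cong suc (⌊n/2⌋+⌈n/2⌉≡n j))

-- Separating the generators

fins : ∀ c → List (Fin c)
fins zero    = []
fins (suc c) = Fin.zero ∷ map Fin.suc (fins c)

∑-fins : ∀ c (i : Fin c) (h : Fin c → ℕ) → (∀ j → j ≢ i → h j ≡ 0) → ∑ (fins c) h ≡ h i
∑-fins (suc c) Fin.zero    h e = trans (cong (h Fin.zero +_) (trans (∑-map Fin.suc (fins c) h)
  (trans (∑-cong (fins c) (λ j → e (Fin.suc j) λ ())) (∑-0 (fins c))))) (+-identityʳ _)
∑-fins (suc c) (Fin.suc i) h e = trans (cong (_+ ∑ (map Fin.suc (fins c)) h) (e Fin.zero λ ()))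
  (trans (∑-map Fin.suc (fins c) h) (∑-fins c i (λ j → h (Fin.suc j)) (λ j n → e (Fin.suc j) λ { refl → n refl })))

length-fins : ∀ c → length (fins c) ≡ c
length-fins zero    = refl
length-fins (suc c) = cong suc (trans (length-map Fin.suc (fins c)) (length-fins c))

ΣV : ∀ k → (Vec Z4 k → ℕ) → ℕ
ΣV zero    f = f []
ΣV (suc k) f = Σ₄ λ z → ΣV k λ x → f (z ∷ x)

ΣV-cong : ∀ k {f g : Vec Z4 k → ℕ} → (∀ x → f x ≡ g x) → ΣV k f ≡ ΣV k g
ΣV-cong zero    e = e []
ΣV-cong (suc k) e = Σ₄-cong λ z → ΣV-cong k λ x → e (z ∷ x)

ΣV-+ : ∀ k (f g : Vec Z4 k → ℕ) → ΣV k (λ x → f x + g x) ≡ ΣV k f + ΣV k g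
ΣV-+ zero    f g = refl
ΣV-+ (suc k) f g = trans (Σ₄-cong λ z → ΣV-+ k (λ x → f (z ∷ x)) (λ x → g (z ∷ x)))
  (Σ₄-+ (λ z → ΣV k λ x → f (z ∷ x)) (λ z → ΣV k λ x → g (z ∷ x)))

ΣV-Σ₄ : ∀ k (f : Z4 → Vec Z4 k → ℕ) → ΣV k (λ x → Σ₄ λ z → f z x) ≡ Σ₄ λ z → ΣV k (f z)
ΣV-Σ₄ k f = trans (ΣV-+ k (f z0) _) (cong (ΣV k (f z0) +_)
  (trans (ΣV-+ k (f z1) _) (cong (ΣV k (f z1) +_) (ΣV-+ k (f z2) (f z3)))))

≈-∑ : ∀ {A : Set} {P : A → Set} {l : List A} {f g : A → ℕ} →
      All P l → (∀ x → P x → f x ≈₂ g x) → ∑ l f ≈₂ ∑ l g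
≈-∑ []       e = 0 , refl
≈-∑ (p ∷ ps) e = ≈-+ (e _ p) (≈-∑ ps e)

module Tower (c : ℕ) where

  open Pattern (Fin c)

  _≟ᵗ_ : (t t′ : Track) → Dec (t ≡ t′)
  _≟ᵗ_ = ×-≡-dec _≟ᶠ_ _≟ᵇ_

  δ : Track → Track → ℕ
  δ t x = boolToℕ (does (t ≟ᵗ x))

  δ-≡ : ∀ t → δ t t ≡ 1
  δ-≡ t with t ≟ᵗ t
  ... | yes _ = refl
  ... | no n  = ⊥-elim (n refl)

  δ-≢ : ∀ t x → t ≢ x → δ t x ≡ 0
  δ-≢ t x n with t ≟ᵗ x
  ... | yes e = ⊥-elim (n e)
  ... | no _  = refl

  units : List (Fin c)
  units = fins c

  ∑ᵗ : (Track → ℕ) → ℕ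
  ∑ᵗ g = ∑ units (pair g)

  ∑ᵗ-δ : ∀ t → ∑ᵗ (δ t) ≡ 1
  ∑ᵗ-δ (u , b) = trans (∑-fins c u (pair (δ (u , b))) zeros) (ones b)
    where
    zeros : ∀ j → j ≢ u → pair (δ (u , b)) j ≡ 0
    zeros j n = cong₂ _+_ (δ-≢ (u , b) (j , true) λ { refl → n refl }) (δ-≢ (u , b) (j , false) λ { refl → n refl })
    ones : ∀ b → pair (δ (u , b)) u ≡ 1
    ones true  = cong₂ _+_ (δ-≡ (u , true)) (δ-≢ (u , true) (u , false) λ ())
    ones false = cong₂ _+_ (δ-≢ (u , false) (u , true) λ ()) (δ-≡ (u , false))

  flat : List (Fin c) → List Track
  flat []       = []
  flat (u ∷ us) = (u , true) ∷ (u , false) ∷ flat us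

  -- For copies of a vertex that must not offer its units further homes.
  homeless : Shape → Shape
  homeless (us , rs) = [] , flat us ++ rs

  W-homeless : ∀ g h → W g (homeless h) ≡ W g h
  W-homeless g ([]     , rs) = refl
  W-homeless g (u ∷ us , rs) = trans (cong (λ k → g (u , true) + (g (u , false) + k)) (W-homeless g (us , rs)))
    (lemma (g (u , true)) (g (u , false)) (∑ us (pair g)) (∑ rs g))
    where
    lemma : ∀ a b c d → a + (b + (c + d)) ≡ a + b + c + d
    lemma = solve-∀

  len-homeless : ∀ h → len (homeless h) ≡ len h
  len-homeless ([]     , rs) = refl
  len-homeless (u ∷ us , rs) = cong (2 +_) (len-homeless (us , rs))

  -- A class of suc p parallel generators with joint coordinate X: sh v lists the tracks using it at v, zz v is the
  -- position of v in its quad, and hs lists the shapes of the quads.  Vertices outside of all quads are harmless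
  -- when they come in pairs, which is why inv₁ and inv₂ only hold up to an even excess.
  record Class {V : Set} (D : Dyn Track V) : Set where
    open Dyn D
    field
      p      : ℕ
      sh     : V → Shape
      zz     : V → Z4
      X      : V → Z4
      len-sh : ∀ v → len (sh v) ≡ suc p
      law    : ∀ t v → X (F t v) ≡ X v ⊕ W (δ t) (sh v)
      hs     : List Shape
      len-hs : All (λ h → len h ≡ suc p) hs
      inv₁   : 1 ≤ p → (f : Z4 → Shape → ℕ) → ∑ all (λ v → f (zz v) (sh v)) ≈₂ ∑ hs (λ h → Σ₄ λ z → f z h)
      inv₂   : 1 ≤ p → (g : Fin c → ℕ) → ∑ hs (λ h → ∑ (proj₁ h) g) ≈₂ ∑ units g

  module Pull {V : Set} (D : Dyn Track V) (κ : Track → V → ℕ) (odd : ∀ t → Odd (∑ (Dyn.all D) (κ t))) where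
    open Dyn D
    D₄ : Dyn Track (V × Z4)
    D₄ = Extend.extend D κ odd

    module _ (C : Class D) where
      open Class C
      sh₄ : V × Z4 → Shape
      sh₄ (v , z0) = sh v
      sh₄ (v , z1) = homeless (sh v)
      sh₄ (v , z2) = homeless (sh v)
      sh₄ (v , z3) = homeless (sh v)

      zz₄ : V × Z4 → Z4
      zz₄ (v , z0) = zz v
      zz₄ (v , z1) = z0
      zz₄ (v , z2) = z0
      zz₄ (v , z3) = z0

      W-sh₄ : ∀ g v z → W g (sh₄ (v , z)) ≡ W g (sh v)
      W-sh₄ g v z0 = refl
      W-sh₄ g v z1 = W-homeless g (sh v)
      W-sh₄ g v z2 = W-homeless g (sh v)
      W-sh₄ g v z3 = W-homeless g (sh v)

      len-sh₄ : ∀ v → len (sh₄ v) ≡ suc p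
      len-sh₄ (v , z0) = len-sh v
      len-sh₄ (v , z1) = trans (len-homeless (sh v)) (len-sh v)
      len-sh₄ (v , z2) = trans (len-homeless (sh v)) (len-sh v)
      len-sh₄ (v , z3) = trans (len-homeless (sh v)) (len-sh v)

      -- When another class is divided, only the layer at height `z0` inherits the quads. Each of
      -- the other three layers contributes an even number: its term ignores the position in the
      -- quad, so by the old `inv₁` it is, up to an even excess, four equal terms for each quad.
      inv : 1 ≤ p → (f : Z4 → Shape → ℕ) →
            ∑ (all₄ all) (λ v → f (zz₄ v) (sh₄ v)) ≈₂ ∑ hs (λ h → Σ₄ λ z → f z h)
      inv 1≤p f = ≈-join
        (trans (∑-all₄ all (λ v → f (zz₄ v) (sh₄ v))) (∑-+ all (λ v → f (zz v) (sh v)) (λ v → b v + (b v + b v))))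
        (inv₁ 1≤p f)
        (≈-join (∑-+ all b (λ v → b v + b v)) ev (≈-join (∑-+ all b b) ev ev refl) refl)
        (+-identityʳ _)
        where
        b : V → ℕ
        b v = f z0 (homeless (sh v))
        quadruple : ∀ a → a + (a + (a + a)) ≡ 0 + ((a + a) + (a + a))
        quadruple = solve-∀
        ev : ∑ all b ≈₂ 0
        ev = ≈-trans (inv₁ 1≤p (λ _ h → f z0 (homeless h)))
          (≈-substʳ (≈-∑ {g = λ _ → 0} len-hs (λ h _ → f z0 (homeless h) + f z0 (homeless h) , quadruple (f z0 (homeless h)))) (∑-0 hs))

      pull : Class D₄
      pull = record
        { p = p ; sh = sh₄ ; zz = zz₄ ; X = λ (v , _) → X v ; len-sh = len-sh₄
        ; law = λ { t (v , z) → trans (law t v) (cong (X v ⊕_) (sym (W-sh₄ (δ t) v z))) }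
        ; hs = hs ; len-hs = len-hs ; inv₁ = inv ; inv₂ = inv₂ }

  module SplitClass {V : Set} (D : Dyn Track V) (C : Class D) (r : ℕ) (p≡ : Class.p C ≡ suc r) where
    open Dyn D
    open Class C
    open Halving (halving r)
    open Good good

    lenr : ∀ h → len h ≡ suc p → len h ≡ suc (suc r)
    lenr h e = trans e (cong suc p≡)

    1≤p : 1 ≤ p
    1≤p = subst (1 ≤_) (sym p≡) (s≤s z≤n)

    sh₁ sh₂ : V → Shape
    sh₁ v = proj₁ (sp (zz v) (sh v))
    sh₂ v = proj₂ (sp (zz v) (sh v))

    κ : Track → V → ℕ
    κ t v = W (δ t) (sh₁ v)

    -- Up to an even number, a quad contributes the number of homes that it offers to the unit of
    -- `t`; by `inv₂` each unit has an odd number of homes altogether.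
    κ-odd : ∀ t → Odd (∑ all (κ t))
    κ-odd t = let (k , e) = total in k , e
      where
      total : ∑ all (κ t) ≈₂ 1
      total = ≈-trans (inv₁ 1≤p (λ z h → W (δ t) (proj₁ (sp z h))))
        (≈-trans (≈-∑ len-hs (λ h e → odd h (lenr h e) (δ t)))
          (≈-substʳ (inv₂ 1≤p (pair (δ t))) (∑ᵗ-δ t)))

    open Pull D κ κ-odd public

    bag-sh : ∀ g v → W g (sh₁ v) + W g (sh₂ v) ≡ W g (sh v)
    bag-sh g v = bag (zz v) (sh v) (lenr (sh v) (len-sh v)) g

    -- Every old vertex becomes a quad, because the part chosen at `v` does not depend on the new
    -- height. The homes needed for the next division are those provided by `home₁`.
    left : Class D₄
    left = record
      { p = p₁ ; sh = λ (v , _) → sh₁ v ; zz = proj₂ ; X = proj₂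
      ; len-sh = λ (v , _) → len₁ (zz v) (sh v) (lenr (sh v) (len-sh v))
      ; law = λ t v → refl
      ; hs = map sh₁ all ; len-hs = lens all
      ; inv₁ = λ _ f → ≈-reflexive (trans (∑-all₄ all (λ (v , z) → f z (sh₁ v)))
                         (sym (∑-map sh₁ all (λ h → Σ₄ λ z → f z h))))
      ; inv₂ = λ 1≤p₁ g → ≈-trans (≈-reflexive (∑-map sh₁ all (λ h → ∑ (proj₁ h) g)))
          (≈-trans (inv₁ 1≤p (λ z h → ∑ (proj₁ (proj₁ (sp z h))) g))
            (≈-trans (≈-∑ len-hs (λ h e → ≈-reflexive (home₁ (s≤s 1≤p₁) h (lenr h e) g))) (inv₂ 1≤p g))) }
      where
      lens : ∀ l → All (λ h → len h ≡ suc p₁) (map sh₁ l)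
      lens []      = []
      lens (v ∷ l) = len₁ (zz v) (sh v) (lenr (sh v) (len-sh v)) ∷ lens l

    -- The old joint coordinate is the sum of the coordinates of the two parts, so the second part
    -- is tracked by the difference.
    right : Class D₄
    right = record
      { p = p₂ ; sh = λ (v , _) → sh₂ v ; zz = proj₂ ; X = λ (v , z) → X v ⊖ z
      ; len-sh = λ (v , _) → len₂ (zz v) (sh v) (lenr (sh v) (len-sh v))
      ; law = λ { t (v , z) → trans (cong (_⊖ (z ⊕ κ t v)) (trans (law t v) (cong (X v ⊕_) (sym (bag-sh (δ t) v)))))
                  (⊕-⊖-⊕ (X v) (κ t v) (W (δ t) (sh₂ v)) z) }
      ; hs = map sh₂ all ; len-hs = lens all
      ; inv₁ = λ _ f → ≈-reflexive (trans (∑-all₄ all (λ (v , z) → f z (sh₂ v)))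
                         (sym (∑-map sh₂ all (λ h → Σ₄ λ z → f z h))))
      ; inv₂ = λ 1≤p₂ g → ≈-trans (≈-reflexive (∑-map sh₂ all (λ h → ∑ (proj₁ h) g)))
          (≈-trans (inv₁ 1≤p (λ z h → ∑ (proj₁ (proj₂ (sp z h))) g))
            (≈-trans (≈-∑ len-hs (λ h e → ≈-reflexive (home₂ (s≤s 1≤p₂) h (lenr h e) g))) (inv₂ 1≤p g))) }
      where
      lens : ∀ l → All (λ h → len h ≡ suc p₂) (map sh₂ l)
      lens []      = []
      lens (v ∷ l) = len₂ (zz v) (sh v) (lenr (sh v) (len-sh v)) ∷ lens l

  module _ {V : Set} {D : Dyn Track V} where

    coords : ∀ {k} → Vec (Class D) k → V → Vec Z4 k
    coords []       v = []
    coords (C ∷ Cs) v = Class.X C v ∷ coords Cs v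

    weight : ∀ {k} → Vec (Class D) k → (Track → ℕ) → V → ℕ
    weight []       g v = 0
    weight (C ∷ Cs) g v = W g (Class.sh C v) + weight Cs g v

    data Single : ∀ {k} → Vec (Class D) k → Set where
      []  : Single []
      _∷_ : ∀ {k C} {Cs : Vec (Class D) k} → Class.p C ≡ 0 → Single Cs → Single (C ∷ Cs)

    -- Twice the number of generators minus one for each class: setting aside a single generator and
    -- dividing a class both lower it by exactly one.
    measure : ∀ {k} → Vec (Class D) k → ℕ
    measure []       = 0
    measure (C ∷ Cs) = suc (Class.p C + Class.p C) + measure Cs

  -- By `tracks`, the places at each vertex are shared out among all tracks, once each; by
  -- `product`, the coordinates identify the vertex set with the full product of the factors Z4.
  record Stage : Set₁ where
    field
      {V}     : Set
      D       : Dyn Track V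
      {d k}   : ℕ
      done    : Vec (Class D) d
      todo    : Vec (Class D) k
      single  : Single done
      tracks  : ∀ v g → weight done g v + weight todo g v ≡ ∑ᵗ g
      product : (f : Vec Z4 d → Vec Z4 k → ℕ) →
                ∑ (Dyn.all D) (λ v → f (coords done v) (coords todo v)) ≡ ΣV d λ x → ΣV k λ y → f x y

  module Pulls {V : Set} (D : Dyn Track V) (κ : Track → V → ℕ) (odd : ∀ t → Odd (∑ (Dyn.all D) (κ t))) where
    open Pull D κ odd

    pulls : ∀ {k} → Vec (Class D) k → Vec (Class D₄) k
    pulls []       = []
    pulls (C ∷ Cs) = pull C ∷ pulls Cs

    coords-pulls : ∀ {k} (Cs : Vec (Class D) k) v z → coords (pulls Cs) (v , z) ≡ coords Cs v
    coords-pulls []       v z = refl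
    coords-pulls (C ∷ Cs) v z = cong (Class.X C v ∷_) (coords-pulls Cs v z)

    weight-pulls : ∀ {k} (Cs : Vec (Class D) k) g v z → weight (pulls Cs) g (v , z) ≡ weight Cs g v
    weight-pulls []       g v z = refl
    weight-pulls (C ∷ Cs) g v z = cong₂ _+_ (W-sh₄ C g v z) (weight-pulls Cs g v z)

    measure-pulls : ∀ {k} (Cs : Vec (Class D) k) → measure (pulls Cs) ≡ measure Cs
    measure-pulls []       = refl
    measure-pulls (C ∷ Cs) = cong (suc (Class.p C + Class.p C) +_) (measure-pulls Cs)

    single-pulls : ∀ {k} {Cs : Vec (Class D) k} → Single Cs → Single (pulls Cs)
    single-pulls []       = []
    single-pulls (e ∷ es) = e ∷ single-pulls es

  record Final : Set₁ where
    field
      {V}     : Set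
      D       : Dyn Track V
      {d}     : ℕ
      done    : Vec (Class D) d
      single  : Single done
      tracks  : ∀ v g → weight done g v ≡ ∑ᵗ g
      product : (f : Vec Z4 d → ℕ) → ∑ (Dyn.all D) (λ v → f (coords done v)) ≡ ΣV d f

  run : ∀ n (S : Stage) → measure (Stage.todo S) ≤ n → Final
  run n record { D = D ; done = done ; todo = [] ; single = single ; tracks = tracks ; product = product } _ =
    record { D = D ; done = done ; single = single
           ; tracks = λ v g → trans (sym (+-identityʳ _)) (tracks v g)
           ; product = λ f → product (λ x _ → f x) }
  run (suc n) record { D = D ; d = d ; k = suc k ; done = done ; todo = C ∷ Cs ; single = single ; tracks = tracks ; product = product } (s≤s m)
    with Class.p C in p≡
  ... | zero = run n (record { D = D ; done = C ∷ done ; todo = Cs ; single = p≡ ∷ single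
                 ; tracks = λ v g → trans (lemma (W g (Class.sh C v)) (weight done g v) (weight Cs g v)) (tracks v g)
                 ; product = λ f → trans (product (λ { x (z ∷ y) → f (z ∷ x) y }))
                     (ΣV-Σ₄ d (λ z x → ΣV k λ y → f (z ∷ x) y)) }) m
    where
    lemma : ∀ a b c → a + b + c ≡ b + (a + c)
    lemma = solve-∀
  ... | suc r = run n (record { D = D₄ ; done = pulls done ; todo = left ∷ right ∷ pulls Cs
                 ; single = single-pulls single ; tracks = tracks′ ; product = product′ }) m′
    where
    open SplitClass D C r p≡
    open Pulls D κ κ-odd
    open Dyn D
    open Halving (halving r) using (p₁; p₂; p-sum)
    m′ : suc (p₁ + p₁) + (suc (p₂ + p₂) + measure (pulls Cs)) ≤ n
    m′ = ≤-trans (≤-reflexive (trans (cong (λ k → suc (p₁ + p₁) + (suc (p₂ + p₂) + k)) (measure-pulls Cs))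
           (trans (lemma p₁ p₂ (measure Cs)) (cong (λ s → suc s + suc s + measure Cs) p-sum)))) m
      where
      lemma : ∀ a b c → suc (a + a) + (suc (b + b) + c) ≡ suc (a + b) + suc (a + b) + c
      lemma = solve-∀
    tracks′ : ∀ v g → weight (pulls done) g v + (W g (sh₁ (proj₁ v)) + (W g (sh₂ (proj₁ v)) + weight (pulls Cs) g v)) ≡ ∑ᵗ g
    tracks′ (v , z) g = begin
      weight (pulls done) g (v , z) + (W g (sh₁ v) + (W g (sh₂ v) + weight (pulls Cs) g (v , z)))
        ≡⟨ cong₂ (λ a b → a + (W g (sh₁ v) + (W g (sh₂ v) + b))) (weight-pulls done g v z) (weight-pulls Cs g v z) ⟩
      weight done g v + (W g (sh₁ v) + (W g (sh₂ v) + weight Cs g v))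
        ≡⟨ cong (weight done g v +_) (trans (sym (+-assoc (W g (sh₁ v)) _ _)) (cong (_+ weight Cs g v) (bag-sh g v))) ⟩
      weight done g v + (W g (Class.sh C v) + weight Cs g v) ≡⟨ tracks v g ⟩
      ∑ᵗ g ∎
      where open ≡-Reasoning
    product′ : (f : Vec Z4 d → Vec Z4 (suc (suc k)) → ℕ) →
               ∑ (all₄ all) (λ v → f (coords (pulls done) v) (coords (left ∷ right ∷ pulls Cs) v)) ≡
               ΣV d λ x → ΣV (suc (suc k)) λ y → f x y
    product′ f = begin
      ∑ (all₄ all) (λ v → f (coords (pulls done) v) (coords (left ∷ right ∷ pulls Cs) v))
        ≡⟨ ∑-all₄ all _ ⟩
      ∑ all (λ v → Σ₄ λ z → f (coords (pulls done) (v , z)) (z ∷ (Class.X C v ⊖ z) ∷ coords (pulls Cs) (v , z)))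
        ≡⟨ ∑-cong all (λ v → Σ₄-cong λ z → cong₂ (λ x y → f x (z ∷ (Class.X C v ⊖ z) ∷ y))
             (coords-pulls done v z) (coords-pulls Cs v z)) ⟩
      ∑ all (λ v → Σ₄ λ z → f (coords done v) (z ∷ (Class.X C v ⊖ z) ∷ coords Cs v))
        ≡⟨ product (λ { x (y ∷ ys) → Σ₄ λ z → f x (z ∷ (y ⊖ z) ∷ ys) }) ⟩
      ΣV d (λ x → Σ₄ λ y → ΣV k λ ys → Σ₄ λ z → f x (z ∷ (y ⊖ z) ∷ ys))
        ≡⟨ ΣV-cong d (λ x → trans (Σ₄-cong λ y → ΣV-Σ₄ k (λ z ys → f x (z ∷ (y ⊖ z) ∷ ys)))
             (Σ₄-⊖ (λ a b → ΣV k λ ys → f x (a ∷ b ∷ ys)))) ⟩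
      ΣV d (λ x → Σ₄ λ a → Σ₄ λ b → ΣV k λ ys → f x (a ∷ b ∷ ys)) ∎
      where open ≡-Reasoning

  start : ∀ p → c + c ≡ suc p → Stage
  start p eq = record
    { D = D ; done = [] ; todo = C ∷ [] ; single = []
    ; tracks = λ v g → lemma (∑ᵗ g)
    ; product = λ f → trans (cong (λ k → f [] (z0 ∷ []) + (f [] (z1 ∷ []) + (f [] (z2 ∷ []) + k)))
        (+-identityʳ _)) refl }
    where
    lemma : ∀ a → a + 0 + 0 ≡ a
    lemma = solve-∀
    D : Dyn Track Z4
    D = record
      { all = z0 ∷ z1 ∷ z2 ∷ z3 ∷ [] ; F = λ _ → s ; v₀ = z0 ; N = 4
      ; orb = λ t f → refl ; ret = λ t → refl }
    len-units : ∀ us → len (us , []) ≡ length us + length us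
    len-units []       = refl
    len-units (u ∷ us) = trans (cong (2 +_) (len-units us)) (cong suc (sym (+-suc _ _)))
    ln : len (units , []) ≡ suc p
    ln = trans (len-units units) (trans (cong (λ k → k + k) (length-fins c)) eq)
    C : Class D
    C = record
      { p = p ; sh = λ _ → units , [] ; zz = λ z → z ; X = λ z → z ; len-sh = λ _ → ln
      ; law = λ t v → cong (v ⊕_) (sym (trans (+-identityʳ _) (∑ᵗ-δ t)))
      -- The four vertices form the only quad, and it is the home of every unit.
      ; hs = (units , []) ∷ [] ; len-hs = ln ∷ []
      ; inv₁ = λ _ f → ≈-reflexive (assoc (f z0 (units , [])) (f z1 (units , [])) (f z2 (units , [])) (f z3 (units , [])))
      ; inv₂ = λ _ g → ≈-reflexive (+-identityʳ _) }
      where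
      assoc : ∀ a b c d → a + (b + (c + (d + 0))) ≡ a + (b + (c + d)) + 0
      assoc = solve-∀

  final : 1 ≤ c → Final
  final (s≤s {n = c′} _) = run (measure (Stage.todo st)) st ≤-refl
    where
    st : Stage
    st = start (c′ + suc c′) refl

-- Hamiltonian decompositions in even dimension of the Z4 cube

Sym : (A → A → ℕ) → Set
Sym w = ∀ u v → w u v ≡ w v u

record Cycle (A : Set) : Set where
  field
    root   : A
    steps  : List A
    closed : end root steps ≡ root
open Cycle public

cw : (A → A → ℕ) → Cycle A → ℕ
cw w C = wt w (root C) (steps C)

-- Total weight of the arcs from x to x + e_j in the cube of dimension 2m = Z4^m.
E : ∀ m → (Vec Z4 m → Vec Z4 m → ℕ) → ℕ
E zero    w = 0
E (suc m) w = Σ₄ (λ z → ΣV m λ x → w (z ∷ x) (s z ∷ x)) + Σ₄ (λ z → E m λ x y → w (z ∷ x) (z ∷ y))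

E-cong : ∀ m {w w′ : Vec Z4 m → Vec Z4 m → ℕ} → (∀ x y → w x y ≡ w′ x y) → E m w ≡ E m w′
E-cong zero    e = refl
E-cong (suc m) e = cong₂ _+_ (Σ₄-cong λ z → ΣV-cong m λ x → e (z ∷ x) (s z ∷ x))
  (Σ₄-cong λ z → E-cong m λ x y → e (z ∷ x) (z ∷ y))

-- The sum of `G` over the out-neighbours x + e_j of x.
bumps : ∀ {m} → (Vec Z4 m → ℕ) → Vec Z4 m → ℕ
bumps G []      = 0
bumps G (z ∷ x) = G (s z ∷ x) + bumps (λ y → G (z ∷ y)) x

E-bumps : ∀ m (w : Vec Z4 m → Vec Z4 m → ℕ) → ΣV m (λ x → bumps (w x) x) ≡ E m w
E-bumps zero    w = refl
E-bumps (suc m) w = trans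
  (Σ₄-cong λ z → trans (ΣV-+ m (λ x → w (z ∷ x) (s z ∷ x)) (λ x → bumps (λ y → w (z ∷ x) (z ∷ y)) x))
    (cong (ΣV m (λ x → w (z ∷ x) (s z ∷ x)) +_) (E-bumps m (λ x y → w (z ∷ x) (z ∷ y)))))
  (Σ₄-+ (λ z → ΣV m λ x → w (z ∷ x) (s z ∷ x)) (λ z → E m λ x y → w (z ∷ x) (z ∷ y)))

Ham : ∀ {m} → Cycle (Vec Z4 m) → Set
Ham {m} C = ∀ f → ∑ (steps C) f ≡ ΣV m f

record HamDec (m : ℕ) : Set where
  field
    cycles : List (Cycle (Vec Z4 m))
    count  : length cycles ≡ m
    ham    : All Ham cycles
    total  : ∀ w → ∑ cycles (cw w) ≡ E m w

orbit : (A → A) → A → ℕ → List A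
orbit F v zero    = []
orbit F v (suc n) = F v ∷ orbit F (F v) n

module _ {V : Set} (F : V → V) where

  end-orbit : ∀ v n → end v (orbit F v n) ≡ pow F v n
  end-orbit v zero    = refl
  end-orbit v (suc n) = end-orbit (F v) n

  wt-orbit : (w : V → V → ℕ) → ∀ v n → wt w v (orbit F v n) ≡ osum F (λ u → w u (F u)) v n
  wt-orbit w v zero    = refl
  wt-orbit w v (suc n) = cong (w v (F v) +_) (wt-orbit w (F v) n)

  ∑-orbit : (f : V → ℕ) → ∀ v n → f v + ∑ (orbit F v n) f ≡ osum F f v n + f (pow F v n)
  ∑-orbit f v zero    = +-identityʳ _
  ∑-orbit f v (suc n) = trans (cong (f v +_) (∑-orbit f (F v) n)) (sym (+-assoc (f v) _ _))

module FromTower (c : ℕ) (1≤c : 1 ≤ c) where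
  open Pattern (Fin c)
  open Tower c
  open Final (final 1≤c)
  open Dyn D

  x : V → Vec Z4 d
  x = coords done

  cycle : Track → Cycle (Vec Z4 d)
  cycle t = record
    { root = x v₀ ; steps = map x (orbit (F t) v₀ N)
    ; closed = trans (end-map x v₀ (orbit (F t) v₀ N)) (cong x (trans (end-orbit (F t) v₀ N) (ret t))) }

  ham-cycle : ∀ t → Ham (cycle t)
  ham-cycle t f = trans (∑-map x (orbit (F t) v₀ N) f) (trans
    (+-cancelˡ-≡ (f (x v₀)) _ _ (trans (∑-orbit (F t) (λ v → f (x v)) v₀ N)
      (trans (cong (λ v → osum (F t) (λ v → f (x v)) v₀ N + f (x v)) (ret t)) (+-comm _ (f (x v₀))))))
    (trans (orb t (λ v → f (x v))) (product f)))

  vsum : ∀ {k} → Vec Track k → (Track → ℕ) → ℕ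
  vsum []       g = 0
  vsum (t ∷ ts) g = g t + vsum ts g

  move : ∀ {k} → Vec Track k → Track → Vec Z4 k → Vec Z4 k
  move []       t []      = []
  move (u ∷ ts) t (z ∷ y) = (z ⊕ δ t u) ∷ move ts t y

  the-track : (h : Shape) → len h ≡ 1 → ∃ λ t → h ≡ ([] , t ∷ [])
  the-track ([]    , t ∷ []) _ = t , refl
  the-track (_ ∷ us , rs)    ()

  -- A class of one generator is used at each vertex by exactly one track; entry j of `ts` is the
  -- track that leaves `v` in direction e_j.
  leaf-tracks : ∀ {k} (Cs : Vec (Class D) k) → Single Cs → ∀ v →
                ∃ λ ts → (∀ g → weight Cs g v ≡ vsum ts g) × (∀ t → coords Cs (F t v) ≡ move ts t (coords Cs v))
  leaf-tracks []       []        v = [] , (λ g → refl) , (λ t → refl)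
  leaf-tracks (C ∷ Cs) (p≡ ∷ ss) v
    with leaf-tracks Cs ss v | the-track (Class.sh C v) (trans (Class.len-sh C v) (cong suc p≡))
  ... | ts , e , e′ | u , eq = u ∷ ts , (λ g → cong₂ _+_ (W-eq g) (e g)) ,
        (λ t → cong₂ _∷_ (trans (Class.law C t v) (cong (Class.X C v ⊕_) (W-eq (δ t)))) (e′ t))
    where
    W-eq : ∀ g → W g (Class.sh C v) ≡ g u
    W-eq g rewrite eq = +-identityʳ _

  vsum-0 : ∀ {k} (ts : Vec Track k) {t} → vsum ts (δ t) ≡ 0 → ∀ y → move ts t y ≡ y
  vsum-0 []       e []      = refl
  vsum-0 (u ∷ ts) {t} e (z ∷ y) with m+n≡0⇒m≡0 (δ t u) e
  ... | e₀ rewrite e₀ = cong (z ∷_) (vsum-0 ts e y)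

  vsum-cong : ∀ {k} (ts : Vec Track k) {g g′ : Track → ℕ} {u} → vsum ts (δ u) ≡ 0 →
              (∀ t → u ≢ t → g t ≡ g′ t) → vsum ts g ≡ vsum ts g′
  vsum-cong []       e h = refl
  vsum-cong (t ∷ ts) {u = u} e h = cong₂ _+_ (h t ne) (vsum-cong ts (m+n≡0⇒n≡0 (δ u t) e) h)
    where
    ne : u ≢ t
    ne refl with trans (sym (m+n≡0⇒m≡0 (δ u t) e)) (δ-≡ u)
    ... | ()

  -- No track is listed twice, so the one listed at coordinate j moves this coordinate by one and no
  -- other.
  vsum-move : ∀ {k} (ts : Vec Track k) → (∀ t → vsum ts (δ t) ≤ 1) → (G : Vec Z4 k → ℕ) → ∀ y →
              vsum ts (λ t → G (move ts t y)) ≡ bumps G y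
  vsum-move []       h G []      = refl
  vsum-move (u ∷ ts) h G (z ∷ y) = cong₂ _+_
    (cong G (cong₂ _∷_ (cong (z ⊕_) (δ-≡ u)) (vsum-0 ts absent y)))
    (trans (vsum-cong ts absent (λ t n → cong (λ k → G ((z ⊕ k) ∷ move ts t y)) (δ-≢ t u (λ e → n (sym e)))))
      (vsum-move ts (λ t → ≤-trans (m≤n+m _ (δ t u)) (h t)) (λ x → G (z ∷ x)) y))
    where
    absent : vsum ts (δ u) ≡ 0
    absent = n≤0⇒n≡0 (+-cancelˡ-≤ 1 _ _ (subst (λ k → k + vsum ts (δ u) ≤ 1) (δ-≡ u) (h u)))

  step-bumps : ∀ v (G : Vec Z4 d → ℕ) → ∑ᵗ (λ t → G (x (F t v))) ≡ bumps G (x v)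
  step-bumps v G with leaf-tracks done single v
  ... | ts , e , e′ = begin
    ∑ᵗ (λ t → G (x (F t v)))               ≡⟨ tracks v _ ⟨
    weight done (λ t → G (x (F t v))) v    ≡⟨ e _ ⟩
    vsum ts (λ t → G (x (F t v)))          ≡⟨ vs-cong ts (λ t → cong G (e′ t)) ⟩
    vsum ts (λ t → G (move ts t (x v)))    ≡⟨ vsum-move ts (λ t → ≤-reflexive (trans (sym (e (δ t)))
                                                (trans (tracks v (δ t)) (∑ᵗ-δ t)))) G (x v) ⟩
    bumps G (x v) ∎
    where
    open ≡-Reasoning
    vs-cong : ∀ {k} (ts : Vec Track k) {g g′ : Track → ℕ} → (∀ t → g t ≡ g′ t) → vsum ts g ≡ vsum ts g′
    vs-cong []       h = refl
    vs-cong (t ∷ ts) h = cong₂ _+_ (h t) (vs-cong ts h)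

  trackList : List Track
  trackList = flat units

  ∑-flat : ∀ us g → ∑ (flat us) g ≡ ∑ us (pair g)
  ∑-flat []       g = refl
  ∑-flat (u ∷ us) g = trans (cong (λ k → g (u , true) + (g (u , false) + k)) (∑-flat us g)) (sym (+-assoc (g (u , true)) _ _))

  total-weight : ∀ w → ∑ (map cycle trackList) (cw w) ≡ E d w
  total-weight w = begin
    ∑ (map cycle trackList) (cw w)   ≡⟨ trans (∑-map cycle trackList (cw w)) (∑-flat units _) ⟩
    ∑ᵗ (λ t → cw w (cycle t))        ≡⟨ ∑-cong units (λ u → cong₂ _+_ (each (u , true)) (each (u , false))) ⟩
    ∑ᵗ (λ t → ∑ all (λ v → w (x v) (x (F t v))))
      ≡⟨ ∑-cong units (λ u → sym (∑-+ all (λ v → w (x v) (x (F (u , true) v))) (λ v → w (x v) (x (F (u , false) v))))) ⟩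
    ∑ units (λ u → ∑ all (λ v → pair (λ t → w (x v) (x (F t v))) u)) ≡⟨ ∑-swap units all _ ⟩
    ∑ all (λ v → ∑ᵗ (λ t → w (x v) (x (F t v))))  ≡⟨ ∑-cong all (λ v → step-bumps v (w (x v))) ⟩
    ∑ all (λ v → bumps (w (x v)) (x v))           ≡⟨ product (λ y → bumps (w y) y) ⟩
    ΣV d (λ y → bumps (w y) y)                    ≡⟨ E-bumps d w ⟩
    E d w ∎
    where
    open ≡-Reasoning
    each : ∀ t → cw w (cycle t) ≡ ∑ all (λ v → w (x v) (x (F t v)))
    each t = trans (wt-map x w v₀ (orbit (F t) v₀ N))
      (trans (wt-orbit (F t) (λ u v → w (x u) (x v)) v₀ N) (orb t (λ v → w (x v) (x (F t v)))))

  weight-1 : ∀ {k} (Cs : Vec (Class D) k) → Single Cs → ∀ v → weight Cs (λ _ → 1) v ≡ k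
  weight-1 []       []        v = refl
  weight-1 (C ∷ Cs) (p≡ ∷ ss) v = cong₂ _+_ (trans (W-1 (Class.sh C v)) (trans (Class.len-sh C v) (cong suc p≡)))
    (weight-1 Cs ss v)

  d≡ : ∑ᵗ (λ _ → 1) ≡ d
  d≡ = trans (sym (tracks v₀ (λ _ → 1))) (weight-1 done single v₀)

  hamDec : HamDec d
  hamDec = record
    { cycles = map cycle trackList
    ; count = trans (length-map cycle trackList) (trans (sym (trans (∑-const trackList 1) (*-identityʳ _)))
                (trans (∑-flat units (λ _ → 1)) d≡))
    ; ham = Allₚ.map⁺ (All.universal ham-cycle trackList)
    ; total = total-weight }

  d-even : d ≡ c * 2
  d-even = trans (sym d≡) (trans (∑-const units 2) (cong (_* 2) (length-fins c)))

even-hamDec : ∀ c → 1 ≤ c → HamDec (c * 2)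
even-hamDec c 1≤c = subst HamDec (FromTower.d-even c 1≤c) (FromTower.hamDec c 1≤c)

z4-hamDec : HamDec 1
z4-hamDec = record
  { cycles = record { root = z0 ∷ [] ; steps = (z1 ∷ []) ∷ (z2 ∷ []) ∷ (z3 ∷ []) ∷ (z0 ∷ []) ∷ [] ; closed = refl } ∷ []
  ; count = refl
  ; ham = (λ f → rot (f (z0 ∷ [])) (f (z1 ∷ [])) (f (z2 ∷ [])) (f (z3 ∷ []))) ∷ []
  ; total = λ w → lemma (w (z0 ∷ []) (z1 ∷ [])) (w (z1 ∷ []) (z2 ∷ [])) (w (z2 ∷ []) (z3 ∷ [])) (w (z3 ∷ []) (z0 ∷ [])) }
  where
  rot : ∀ a b c d → b + (c + (d + (a + 0))) ≡ a + (b + (c + d))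
  rot = solve-∀
  lemma : ∀ a b c d → a + (b + (c + (d + 0))) + 0 ≡ a + (b + (c + d)) + 0
  lemma = solve-∀

-- Edges of the hypercube

infixr 5 _◂_

-- The Gray code 00, 10, 11, 01, which identifies the 4-cycle with Q_2.
_◂_ : ∀ {n} → Z4 → Vertex n → Vertex (suc (suc n))
z0 ◂ v = false ∷ false ∷ v
z1 ◂ v = true  ∷ false ∷ v
z2 ◂ v = true  ∷ true  ∷ v
z3 ◂ v = false ∷ true  ∷ v

vertex : ∀ {m} → Vec Z4 m → Vertex (m * 2)
vertex []      = []
vertex (z ∷ x) = z ◂ vertex x

◂-injective : ∀ {n} z z′ {v v′ : Vertex n} → z ◂ v ≡ z′ ◂ v′ → z ≡ z′ × v ≡ v′
◂-injective z0 z0 refl = refl , refl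
◂-injective z1 z1 refl = refl , refl
◂-injective z2 z2 refl = refl , refl
◂-injective z3 z3 refl = refl , refl

vertex-injective : ∀ {m} (x y : Vec Z4 m) → vertex x ≡ vertex y → x ≡ y
vertex-injective []      []       e = refl
vertex-injective (z ∷ x) (z′ ∷ y) e with ◂-injective z z′ e
... | refl , e′ = cong (z ∷_) (vertex-injective x y e′)

vertex-surjective : ∀ m (v : Vertex (m * 2)) → ∃ λ x → vertex {m} x ≡ v
vertex-surjective zero    []          = [] , refl
vertex-surjective (suc m) (a ∷ b ∷ v) with vertex-surjective m v
vertex-surjective (suc m) (false ∷ false ∷ _) | x , refl = z0 ∷ x , refl
vertex-surjective (suc m) (true  ∷ false ∷ _) | x , refl = z1 ∷ x , refl
vertex-surjective (suc m) (true  ∷ true  ∷ _) | x , refl = z2 ∷ x , refl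
vertex-surjective (suc m) (false ∷ true  ∷ _) | x , refl = z3 ∷ x , refl

data Nb : ∀ {m} → Vec Z4 m → Vec Z4 m → Set where
  up    : ∀ {m} z {x : Vec Z4 m} → Nb (z ∷ x) (s z ∷ x)
  down  : ∀ {m} z {x : Vec Z4 m} → Nb (s z ∷ x) (z ∷ x)
  there : ∀ {m} z {x y : Vec Z4 m} → Nb x y → Nb (z ∷ x) (z ∷ y)

adjacent-sym : ∀ {n} (u v : Vertex n) → Adjacent u v → Adjacent v u
adjacent-sym u v (i , n , e) = i , (λ e′ → n (sym e′)) , λ j ne → sym (e j ne)

adjacent-first : ∀ {n} {a b} {v : Vertex n} → a ≢ b → Adjacent (a ∷ v) (b ∷ v)
adjacent-first n = Fin.zero , n , λ { Fin.zero ne → ⊥-elim (ne refl) ; (Fin.suc j) ne → refl }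

adjacent-∷ : ∀ {n} a {u v : Vertex n} → Adjacent u v → Adjacent (a ∷ u) (a ∷ v)
adjacent-∷ a (i , n , e) = Fin.suc i , n , λ { Fin.zero ne → refl ; (Fin.suc j) ne → e j (λ { refl → ne refl }) }

adjacent-s : ∀ {n} z (v : Vertex n) → Adjacent (z ◂ v) (s z ◂ v)
adjacent-s z0 v = adjacent-first λ ()
adjacent-s z1 v = adjacent-∷ true (adjacent-first λ ())
adjacent-s z2 v = adjacent-first λ ()
adjacent-s z3 v = adjacent-∷ false (adjacent-first λ ())

adjacent-◂ : ∀ {n} z {u v : Vertex n} → Adjacent u v → Adjacent (z ◂ u) (z ◂ v)
adjacent-◂ z0 a = adjacent-∷ _ (adjacent-∷ _ a)
adjacent-◂ z1 a = adjacent-∷ _ (adjacent-∷ _ a)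
adjacent-◂ z2 a = adjacent-∷ _ (adjacent-∷ _ a)
adjacent-◂ z3 a = adjacent-∷ _ (adjacent-∷ _ a)

nb-adjacent : ∀ {m} {x y : Vec Z4 m} → Nb x y → Adjacent (vertex x) (vertex y)
nb-adjacent (up z)      = adjacent-s z _
nb-adjacent (down z)    = adjacent-sym (z ◂ _) (s z ◂ _) (adjacent-s z _)
nb-adjacent (there z n) = adjacent-◂ z (nb-adjacent n)

lookup-ext : ∀ {n} (u v : Vertex n) → (∀ j → lookup u j ≡ lookup v j) → u ≡ v
lookup-ext []      []      e = refl
lookup-ext (a ∷ u) (b ∷ v) e = cong₂ _∷_ (e Fin.zero) (lookup-ext u v λ j → e (Fin.suc j))

adjacent-nb : ∀ {m} (x y : Vec Z4 m) → Adjacent (vertex x) (vertex y) → Nb x y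
adjacent-nb []      []      (() , _)
adjacent-nb (z ∷ x) (z′ ∷ y) (i , n , e) = go z z′ i n e
  where
  same : ∀ z z′ → (∀ j → lookup (z ◂ vertex x) (Fin.suc (Fin.suc j)) ≡ lookup (z′ ◂ vertex y) (Fin.suc (Fin.suc j))) → x ≡ y
  same z z′ h = vertex-injective x y (lookup-ext _ _ (λ j → trans (sym (tail z (vertex x) j)) (trans (h j) (tail z′ (vertex y) j))))
    where
    tail : ∀ {n} z (v : Vertex n) j → lookup (z ◂ v) (Fin.suc (Fin.suc j)) ≡ lookup v j
    tail z0 v j = refl
    tail z1 v j = refl
    tail z2 v j = refl
    tail z3 v j = refl
  one-step : ∀ z z′ → x ≡ y → (z′ ≡ s z) ⊎ (z ≡ s z′) → Nb (z ∷ x) (z′ ∷ y)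
  one-step z z′ refl (inj₁ refl) = up z
  one-step z z′ refl (inj₂ refl) = down z′
  go : ∀ z z′ i → lookup (z ◂ vertex x) i ≢ lookup (z′ ◂ vertex y) i →
       (∀ j → j ≢ i → lookup (z ◂ vertex x) j ≡ lookup (z′ ◂ vertex y) j) → Nb (z ∷ x) (z′ ∷ y)
  go z z′ Fin.zero n e = one-step z z′ (same z z′ λ j → e _ λ ()) (bits z z′ n (e (Fin.suc Fin.zero) λ ()))
    where
    bits : ∀ z z′ → lookup (z ◂ vertex x) Fin.zero ≢ lookup (z′ ◂ vertex y) Fin.zero →
           lookup (z ◂ vertex x) (Fin.suc Fin.zero) ≡ lookup (z′ ◂ vertex y) (Fin.suc Fin.zero) →
           (z′ ≡ s z) ⊎ (z ≡ s z′)
    bits z0 z0 n e = ⊥-elim (n refl)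
    bits z0 z1 n e = inj₁ refl
    bits z1 z0 n e = inj₂ refl
    bits z1 z1 n e = ⊥-elim (n refl)
    bits z2 z2 n e = ⊥-elim (n refl)
    bits z2 z3 n e = inj₁ refl
    bits z3 z2 n e = inj₂ refl
    bits z3 z3 n e = ⊥-elim (n refl)
  go z z′ (Fin.suc Fin.zero) n e = one-step z z′ (same z z′ λ j → e _ λ ()) (bits z z′ n (e Fin.zero λ ()))
    where
    bits : ∀ z z′ → lookup (z ◂ vertex x) (Fin.suc Fin.zero) ≢ lookup (z′ ◂ vertex y) (Fin.suc Fin.zero) →
           lookup (z ◂ vertex x) Fin.zero ≡ lookup (z′ ◂ vertex y) Fin.zero →
           (z′ ≡ s z) ⊎ (z ≡ s z′)
    bits z0 z0 n e = ⊥-elim (n refl)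
    bits z0 z3 n e = inj₂ refl
    bits z1 z1 n e = ⊥-elim (n refl)
    bits z1 z2 n e = inj₁ refl
    bits z2 z1 n e = inj₂ refl
    bits z2 z2 n e = ⊥-elim (n refl)
    bits z3 z0 n e = inj₁ refl
    bits z3 z3 n e = ⊥-elim (n refl)
  go z z′ (Fin.suc (Fin.suc i)) n e = deep z z′ n e
    where
    adj : ∀ z z′ → lookup (z ◂ vertex x) (Fin.suc (Fin.suc i)) ≢ lookup (z′ ◂ vertex y) (Fin.suc (Fin.suc i)) →
          (∀ j → j ≢ Fin.suc (Fin.suc i) → lookup (z ◂ vertex x) j ≡ lookup (z′ ◂ vertex y) j) →
          z ≡ z′ → Nb (z ∷ x) (z′ ∷ y)
    adj z0 _ n e refl = there z0 (adjacent-nb x y (i , n , λ j ne → e (Fin.suc (Fin.suc j)) λ { refl → ne refl }))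
    adj z1 _ n e refl = there z1 (adjacent-nb x y (i , n , λ j ne → e (Fin.suc (Fin.suc j)) λ { refl → ne refl }))
    adj z2 _ n e refl = there z2 (adjacent-nb x y (i , n , λ j ne → e (Fin.suc (Fin.suc j)) λ { refl → ne refl }))
    adj z3 _ n e refl = there z3 (adjacent-nb x y (i , n , λ j ne → e (Fin.suc (Fin.suc j)) λ { refl → ne refl }))
    eq : ∀ z z′ → lookup (z ◂ vertex x) Fin.zero ≡ lookup (z′ ◂ vertex y) Fin.zero →
         lookup (z ◂ vertex x) (Fin.suc Fin.zero) ≡ lookup (z′ ◂ vertex y) (Fin.suc Fin.zero) → z ≡ z′
    eq z0 z0 _ _ = refl
    eq z1 z1 _ _ = refl
    eq z2 z2 _ _ = refl
    eq z3 z3 _ _ = refl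
    deep : ∀ z z′ → lookup (z ◂ vertex x) (Fin.suc (Fin.suc i)) ≢ lookup (z′ ◂ vertex y) (Fin.suc (Fin.suc i)) →
          (∀ j → j ≢ Fin.suc (Fin.suc i) → lookup (z ◂ vertex x) j ≡ lookup (z′ ◂ vertex y) j) → Nb (z ∷ x) (z′ ∷ y)
    deep z z′ n e = adj z z′ n e (eq z z′ (e Fin.zero λ ()) (e (Fin.suc Fin.zero) λ ()))

SameEdge : ∀ {A : Set} → A → A → A → A → Set
SameEdge a b u v = (a ≡ u × b ≡ v) ⊎ (a ≡ v × b ≡ u)

yes-1 : {P : Set} (d : Dec P) → P → boolToℕ ⌊ d ⌋ ≡ 1
yes-1 (yes _) p = refl
yes-1 (no n)  p = ⊥-elim (n p)

no-0 : {P : Set} (d : Dec P) → ¬ P → boolToℕ ⌊ d ⌋ ≡ 0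
no-0 (yes p) n = ⊥-elim (n p)
no-0 (no _)  n = refl

sameEdge? : ∀ {n} (a b u v : Vertex n) → Dec (SameEdge a b u v)
sameEdge? a b u v = ((a ≟ᵛ u) ×-dec (b ≟ᵛ v)) ⊎-dec ((a ≟ᵛ v) ×-dec (b ≟ᵛ u))

ind-yes : ∀ {n} {a b u v : Vertex n} → SameEdge a b u v → ind a b u v ≡ 1
ind-yes {a = a} {b} {u} {v} = yes-1 (sameEdge? a b u v)

ind-no : ∀ {n} {a b u v : Vertex n} → ¬ SameEdge a b u v → ind a b u v ≡ 0
ind-no {a = a} {b} {u} {v} = no-0 (sameEdge? a b u v)

ind-≡ : ∀ {n} {a b u v : Vertex n} {k} {a′ b′ u′ v′ : Vertex k} →
        (SameEdge a b u v → SameEdge a′ b′ u′ v′) → (SameEdge a′ b′ u′ v′ → SameEdge a b u v) →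
        ind a b u v ≡ ind a′ b′ u′ v′
ind-≡ {a = a} {b} {u} {v} {a′ = a′} {b′} {u′} {v′} f g = by (sameEdge? a b u v)
  where
  by : Dec (SameEdge a b u v) → ind a b u v ≡ ind a′ b′ u′ v′
  by (yes e) = trans (ind-yes e) (sym (ind-yes (f e)))
  by (no n)  = trans (ind-no n) (sym (ind-no λ e → n (g e)))

I : ∀ {m} → Vec Z4 m → Vec Z4 m → Vec Z4 m → Vec Z4 m → ℕ
I a b u v = ind (vertex a) (vertex b) (vertex u) (vertex v)

module _ {m} {a b u v : Vec Z4 m} where

  lower : SameEdge (vertex a) (vertex b) (vertex u) (vertex v) → SameEdge a b u v
  lower (inj₁ (e , e′)) = inj₁ (vertex-injective _ _ e , vertex-injective _ _ e′)
  lower (inj₂ (e , e′)) = inj₂ (vertex-injective _ _ e , vertex-injective _ _ e′)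

  raise : SameEdge a b u v → SameEdge (vertex a) (vertex b) (vertex u) (vertex v)
  raise (inj₁ (e , e′)) = inj₁ (cong vertex e , cong vertex e′)
  raise (inj₂ (e , e′)) = inj₂ (cong vertex e , cong vertex e′)

  I-yes : SameEdge a b u v → I a b u v ≡ 1
  I-yes e = ind-yes (raise e)

  I-no : ¬ SameEdge a b u v → I a b u v ≡ 0
  I-no n = ind-no λ e → n (lower e)

I-sym : ∀ {m} (a b : Vec Z4 m) → Sym (I a b)
I-sym a b u v = ind-≡ {a = vertex a} flip flip
  where
  flip : ∀ {A : Set} {a b u v : A} → SameEdge a b u v → SameEdge a b v u
  flip (inj₁ p) = inj₂ p
  flip (inj₂ p) = inj₁ p

I-swap : ∀ {m} (a b u v : Vec Z4 m) → I a b u v ≡ I b a u v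
I-swap a b u v = ind-≡ {a = vertex a} flip flip
  where
  flip : ∀ {A : Set} {a b u v : A} → SameEdge a b u v → SameEdge b a u v
  flip (inj₁ (p , q)) = inj₂ (q , p)
  flip (inj₂ (p , q)) = inj₁ (q , p)

I-there : ∀ {m} z (x y u v : Vec Z4 m) → I (z ∷ x) (z ∷ y) (z ∷ u) (z ∷ v) ≡ I x y u v
I-there z x y u v = ind-≡ {a = vertex (z ∷ x)} {vertex (z ∷ y)} {vertex (z ∷ u)} {vertex (z ∷ v)}
    {a′ = vertex x} {vertex y} {vertex u} {vertex v}
    (λ e → raise {a = x} {y} {u} {v} (strip (lower {a = z ∷ x} {z ∷ y} {z ∷ u} {z ∷ v} e)))
    (λ e → raise {a = z ∷ x} {z ∷ y} {z ∷ u} {z ∷ v} (add (lower {a = x} {y} {u} {v} e)))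
  where
  strip : SameEdge (z ∷ x) (z ∷ y) (z ∷ u) (z ∷ v) → SameEdge x y u v
  strip (inj₁ (refl , refl)) = inj₁ (refl , refl)
  strip (inj₂ (refl , refl)) = inj₂ (refl , refl)
  add : SameEdge x y u v → SameEdge (z ∷ x) (z ∷ y) (z ∷ u) (z ∷ v)
  add (inj₁ (refl , refl)) = inj₁ (refl , refl)
  add (inj₂ (refl , refl)) = inj₂ (refl , refl)

s-≢ : ∀ {z} → z ≢ s z
s-≢ {z0} ()
s-≢ {z1} ()
s-≢ {z2} ()
s-≢ {z3} ()

ss-≢ : ∀ {z} → z ≢ s (s z)
ss-≢ {z0} ()
ss-≢ {z1} ()
ss-≢ {z2} ()
ss-≢ {z3} ()

_≟⁴_ : (y z : Z4) → Dec (y ≡ z)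
z0 ≟⁴ z0 = yes refl
z0 ≟⁴ z1 = no λ ()
z0 ≟⁴ z2 = no λ ()
z0 ≟⁴ z3 = no λ ()
z1 ≟⁴ z0 = no λ ()
z1 ≟⁴ z1 = yes refl
z1 ≟⁴ z2 = no λ ()
z1 ≟⁴ z3 = no λ ()
z2 ≟⁴ z0 = no λ ()
z2 ≟⁴ z1 = no λ ()
z2 ≟⁴ z2 = yes refl
z2 ≟⁴ z3 = no λ ()
z3 ≟⁴ z0 = no λ ()
z3 ≟⁴ z1 = no λ ()
z3 ≟⁴ z2 = no λ ()
z3 ≟⁴ z3 = yes refl

Σ₄-0 : ∀ {f : Z4 → ℕ} → (∀ z → f z ≡ 0) → Σ₄ f ≡ 0
Σ₄-0 {f} e rewrite e z0 | e z1 | e z2 | e z3 = refl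

Σ₄-single : ∀ z {f : Z4 → ℕ} → (∀ y → y ≢ z → f y ≡ 0) → Σ₄ f ≡ f z
Σ₄-single z0 {f} e rewrite e z1 (λ ()) | e z2 (λ ()) | e z3 (λ ()) = +-identityʳ _
Σ₄-single z1 {f} e rewrite e z0 (λ ()) | e z2 (λ ()) | e z3 (λ ()) = +-identityʳ _
Σ₄-single z2 {f} e rewrite e z0 (λ ()) | e z1 (λ ()) | e z3 (λ ()) = +-identityʳ _
Σ₄-single z3 {f} e rewrite e z0 (λ ()) | e z1 (λ ()) | e z2 (λ ()) = refl

ΣV-0 : ∀ m {f : Vec Z4 m → ℕ} → (∀ x → f x ≡ 0) → ΣV m f ≡ 0
ΣV-0 zero    e = e []
ΣV-0 (suc m) e = Σ₄-0 λ z → ΣV-0 m λ x → e (z ∷ x)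

ΣV-single : ∀ m (x : Vec Z4 m) {f : Vec Z4 m → ℕ} → (∀ y → y ≢ x → f y ≡ 0) → ΣV m f ≡ f x
ΣV-single zero    []      e = refl
ΣV-single (suc m) (z ∷ x) e = trans
  (Σ₄-single z λ y ne → ΣV-0 m λ x′ → e (y ∷ x′) λ { refl → ne refl })
  (ΣV-single m x λ y ne → e (z ∷ y) λ { refl → ne refl })

E-0 : ∀ m {w : Vec Z4 m → Vec Z4 m → ℕ} → (∀ x y → Nb x y → w x y ≡ 0) → E m w ≡ 0
E-0 zero    e = refl
E-0 (suc m) e = cong₂ _+_ (Σ₄-0 λ z → ΣV-0 m λ x → e (z ∷ x) (s z ∷ x) (up z))
  (Σ₄-0 λ z → E-0 m λ x y n → e (z ∷ x) (z ∷ y) (there z n))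

-- An edge is an arc from x to x + e_j in only one of its two directions, because `s (s z)` differs
-- from `z`.
E-I : ∀ m {a b : Vec Z4 m} → Nb a b → E m (I a b) ≡ 1
E-I-up : ∀ m z (x : Vec Z4 m) → E (suc m) (I (z ∷ x) (s z ∷ x)) ≡ 1

E-I-up m z x = cong₂ _+_
  (trans (ΣV-single (suc m) (z ∷ x) {λ { (z′ ∷ x′) → I (z ∷ x) (s z ∷ x) (z′ ∷ x′) (s z′ ∷ x′) }}
           (λ { (z′ ∷ x′) ne → I-no {a = z ∷ x} {s z ∷ x} {z′ ∷ x′} {s z′ ∷ x′} λ { (inj₁ (e , _)) → ne (sym e) ; (inj₂ (e , e′)) → turn z z′ (∷-injectiveˡ e) (∷-injectiveˡ e′) } }))
         (I-yes {a = z ∷ x} {s z ∷ x} {z ∷ x} {s z ∷ x} (inj₁ (refl , refl))))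
  (Σ₄-0 λ y → E-0 m λ u v _ → I-no {a = z ∷ x} {s z ∷ x} {y ∷ u} {y ∷ v} λ
    { (inj₁ (e , e′)) → s-≢ (trans (∷-injectiveˡ e) (sym (∷-injectiveˡ e′)))
    ; (inj₂ (e , e′)) → s-≢ (trans (∷-injectiveˡ e) (sym (∷-injectiveˡ e′))) })
  where
  turn : ∀ z z′ → z ≡ s z′ → s z ≡ z′ → ⊥
  turn z z′ refl e = ss-≢ {z′} (sym e)

E-I (suc m) (up z {x})   = E-I-up m z x
E-I (suc m) (down z {x}) = trans (E-cong (suc m) (I-swap (s z ∷ x) (z ∷ x))) (E-I-up m z x)
E-I (suc m) (there z {x} {y} n) = cong₂ _+_
  (Σ₄-0 λ z′ → ΣV-0 m λ u → I-no {a = z ∷ x} {z ∷ y} {z′ ∷ u} {s z′ ∷ u} λ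
    { (inj₁ (e , e′)) → s-≢ (trans (sym (∷-injectiveˡ e)) (∷-injectiveˡ e′))
    ; (inj₂ (e , e′)) → s-≢ (trans (sym (∷-injectiveˡ e′)) (∷-injectiveˡ e)) })
  (trans (Σ₄-single z (λ z′ ne → E-0 m λ u v _ → I-no {a = z ∷ x} {z ∷ y} {z′ ∷ u} {z′ ∷ v} λ { (inj₁ (refl , _)) → ne refl ; (inj₂ (refl , _)) → ne refl }))
    (trans (E-cong m (I-there z x y)) (E-I m n)))

-- From weighted cycles to path decompositions

adjacent? : ∀ {n} (u v : Vertex n) → Dec (Adjacent u v)
adjacent? u v = any? λ i → ¬? (lookup u i ≟ᵇ lookup v i) ×-dec
  all? λ j → ¬? (j ≟ᶠ i) →-dec (lookup u j ≟ᵇ lookup v j)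

-- Lets a weight detect non-edges: a walk of ν-weight 0 is a walk in the hypercube.
ν : ∀ {m} → Vec Z4 m → Vec Z4 m → ℕ
ν x y = boolToℕ ⌊ ¬? (adjacent? (vertex x) (vertex y)) ⌋

ν-yes : ∀ {m} {x y : Vec Z4 m} → Adjacent (vertex x) (vertex y) → ν x y ≡ 0
ν-yes {x = x} {y} a = no-0 (¬? (adjacent? (vertex x) (vertex y))) (λ n → n a)

ν-no : ∀ {m} {x y : Vec Z4 m} → ¬ Adjacent (vertex x) (vertex y) → ν x y ≡ 1
ν-no {x = x} {y} = yes-1 (¬? (adjacent? (vertex x) (vertex y)))

ν-sym : ∀ {m} → Sym (ν {m})
ν-sym x y = by (adjacent? (vertex x) (vertex y))
  where
  by : Dec (Adjacent (vertex x) (vertex y)) → ν x y ≡ ν y x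
  by (yes a) = trans (ν-yes {x = x} {y} a) (sym (ν-yes {x = y} {x} (adjacent-sym (vertex x) (vertex y) a)))
  by (no n)  = trans (ν-no {x = x} {y} n) (sym (ν-no {x = y} {x} λ a → n (adjacent-sym (vertex y) (vertex x) a)))

ν-chain : ∀ {m} (x : Vec Z4 m) ys → wt ν x ys ≡ 0 → Chain Adjacent (vertex x) (map vertex ys)
ν-chain x []       e = tt
ν-chain x (y ∷ ys) e = by (adjacent? (vertex x) (vertex y)) , ν-chain y ys (m+n≡0⇒n≡0 (ν x y) e)
  where
  by : Dec (Adjacent (vertex x) (vertex y)) → Adjacent (vertex x) (vertex y)
  by (yes a) = a
  by (no n) with trans (sym (ν-no {x = x} {y} n)) (m+n≡0⇒m≡0 (ν x y) e)
  ... | ()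

LD-map : ∀ {A B : Set} (h : A → B) → (∀ x y → h x ≡ h y → x ≡ y) → ∀ ℓ xs → LD ℓ xs → LD ℓ (map h xs)
LD-map h inj ℓ []       _       = tt
LD-map h inj ℓ (x ∷ xs) (a , d) = subst (All (h x ≢_)) (sym (take-map ℓ xs))
  (Allₚ.map⁺ (All.map (λ n e → n (inj _ _ e)) a)) , LD-map h inj ℓ xs d

Sliceable : ∀ {m} → ℕ → Cycle (Vec Z4 m) → Set
Sliceable ℓ C = LD ℓ (root C ∷ steps C) × ∃ λ r → length (steps C) ≡ r * ℓ

-- The one identity `total` serves twice: at `ν` it shows that all steps are edges, at the indicator
-- of an edge that this edge is used once. Both weights are symmetric, so cycles may run through
-- arcs backwards.
assemble : ∀ m ℓ (Cs : List (Cycle (Vec Z4 m))) → All (Sliceable ℓ) Cs →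
           (∀ w → Sym w → ∑ Cs (cw w) ≡ E m w) → PathDecomposition (m * 2) ℓ
assemble m ℓ Cs sl total with slices Cs sl (trans (total ν ν-sym) (E-0 m λ x y n → ν-yes {x = x} {y} (nb-adjacent n)))
  where
  slices : (Cs : List (Cycle (Vec Z4 m))) → All (Sliceable ℓ) Cs → ∑ Cs (cw ν) ≡ 0 →
           ∃ λ ps → ∀ a b → sum (map (edgeCount a b) ps) ≡ ∑ Cs (λ C → wt (ind a b) (vertex (root C)) (map vertex (steps C)))
  slices []       []             e = [] , λ a b → refl
  slices (C ∷ Cs) ((d , r , l) ∷ sl) e
    with slices Cs sl (m+n≡0⇒n≡0 (cw ν C) e)
       | Cut.cut ℓ r (vertex (root C)) (map vertex (steps C)) (trans (length-map vertex (steps C)) l)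
           (ν-chain (root C) (steps C) (m+n≡0⇒m≡0 (cw ν C) e)) (LD-map vertex vertex-injective ℓ (root C ∷ steps C) d)
  ... | qs , h | ps , h′ = ps ++ qs , λ a b → trans (cong sum (map-++ (edgeCount a b) ps qs))
          (trans (sum-++ (map (edgeCount a b) ps) _) (cong₂ _+_ (h′ a b) (h a b)))
... | ps , h = ps , count
  where
  count : ∀ a b → Adjacent a b → sum (map (edgeCount a b) ps) ≡ 1
  count a b adj with vertex-surjective m a | vertex-surjective m b
  ... | x , refl | y , refl = trans (h (vertex x) (vertex y)) (trans
    (∑-cong Cs (λ C → wt-map vertex (ind (vertex x) (vertex y)) (root C) (steps C)))
    (trans (total (I x y) (I-sym x y)) (E-I m (adjacent-nb x y adj))))

-- Linking cycles of the four copies of a graph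

unique-snoc : {A : Set} {xs : List A} {x : A} → Unique xs → All (_≢ x) xs → Unique (xs ++ x ∷ [])
unique-snoc []       []       = [] ∷ []
unique-snoc (a ∷ us) (n ∷ ns) = Allₚ.++⁺ a (n ∷ []) ∷ unique-snoc us ns

unique-++ˡ : {A : Set} (xs : List A) {ys : List A} → Unique (xs ++ ys) → Unique xs
unique-++ˡ []       u       = []
unique-++ˡ (x ∷ xs) (a ∷ u) = Allₚ.++⁻ˡ xs a ∷ unique-++ˡ xs u

unique-++ʳ : {A : Set} (xs : List A) {ys : List A} → Unique (xs ++ ys) → Unique ys
unique-++ʳ []       u       = u
unique-++ʳ (x ∷ xs) (a ∷ u) = unique-++ʳ xs u

module _ {A : Set} (ℓ : ℕ) where

  -- Moving the first entry to the back keeps the sequence free of repetitions, and a window shorter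
  -- than the period sees each entry at most once.
  LD-rotate : (p q : List A) → Unique (p ++ q) → ℓ < length (p ++ q) → LD ℓ (p ++ q ++ p)
  LD-rotate []      q u lt = subst (LD ℓ) (sym (++-identityʳ q)) (LD-unique ℓ u)
  LD-rotate (x ∷ p) q (a ∷ u) (s≤s le) =
    subst (All (x ≢_)) (trans (sym (take-long ℓ ℓ (p ++ q) le)) (cong (take ℓ) (++-assoc p q (x ∷ p)))) (Allₚ.take⁺ ℓ a) ,
    subst (LD ℓ) (cong (p ++_) (++-assoc q (x ∷ []) p))
      (LD-rotate p (q ++ x ∷ [])
        (subst Unique (++-assoc p q (x ∷ [])) (unique-snoc u (All.map (λ n e → n (sym e)) a)))
        (subst (λ l → ℓ < l) (trans (+-comm 1 (length (p ++ q))) (trans (sym (length-++ (p ++ q))) (cong length (++-assoc p q (x ∷ []))))) (s≤s le)))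

  LD-twice : (X : List A) → Unique X → ℓ < length X → LD ℓ (X ++ X)
  LD-twice X u lt = LD-rotate X [] (subst Unique (sym (++-identityʳ X)) u) (subst (λ l → ℓ < length l) (sym (++-identityʳ X)) lt)

  take-++⁺ : ∀ k {P : A → Set} (xs : List A) {ys} → All P xs → All P (take k ys) → All P (take k (xs ++ ys))
  take-++⁺ k       []       []       q = q
  take-++⁺ zero    (x ∷ xs) (p ∷ ps) q = []
  take-++⁺ (suc k) (x ∷ xs) {ys} (p ∷ ps) q = p ∷ take-++⁺ k xs ps (shorter k ys q)
    where
    shorter : ∀ k {P : A → Set} ys → All P (take (suc k) ys) → All P (take k ys)
    shorter zero    ys       q        = []
    shorter (suc k) []       q        = []
    shorter (suc k) (y ∷ ys) (q ∷ qs) = q ∷ shorter k ys qs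

corner : Bool → Z4
corner false = z0
corner true  = z3

-- A row is a vertex g of G = Q_{2k} together with its four copies in Z4 × G.  The tags lapᶜ ys and lapᵈ ys insert
-- a lap around the copies of g in which the closed walk ys is traversed twice: in the copies 2 and 0 of G for lapᶜ,
-- in the copies 3 and 1 for lapᵈ.
data Tag (k : ℕ) : Set where
  plain : Tag k
  lapᶜ  : List (Vec Z4 k) → Tag k
  lapᵈ  : List (Vec Z4 k) → Tag k

Row : ℕ → Set
Row k = Vec Z4 k × Tag k

module Rows {k : ℕ} where

  G : Set
  G = Vec Z4 k

  selᶜ selᵈ : Tag k → Maybe (List G)
  selᶜ (lapᶜ ys) = just ys
  selᶜ _         = nothing
  selᵈ (lapᵈ ys) = just ys
  selᵈ _         = nothing

  at : Z4 → List G → List (Vec Z4 (suc k))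
  at z = map (z ∷_)

  -- from (f , g) around the 4-cycle over g, with the loop traversed in the fibres s f and s³ f
  lap : Z4 → G → List G → List (Vec Z4 (suc k))
  lap f g ys = at (s f) (g ∷ ys) ++ (s (s f) ∷ g) ∷ (at (s (s (s f))) (g ∷ ys) ++ (f ∷ g) ∷ [])

  laps : Z4 → G → Maybe (List G) → List (Vec Z4 (suc k))
  laps f g nothing   = []
  laps f g (just ys) = lap f g ys

  strand : Z4 → (Tag k → Maybe (List G)) → List (Row k) → List (Vec Z4 (suc k))
  strand f sel []            = []
  strand f sel ((g , t) ∷ R) = (f ∷ g) ∷ (laps f g (sel t) ++ strand f sel R)

  Segs : Set
  Segs = List (G × List Z4)

  expand : Segs → List (Vec Z4 (suc k))
  expand []            = []
  expand ((g , σ) ∷ S) = map (_∷ g) σ ++ expand S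

  -- The two zigzags are always in opposite copies, one in 0 and the other in 3. At a plain row they
  -- change places, one by climbing through 1 and 2 and the other by the edge between 3 and 0, which
  -- together use up the 4-cycle. At a row with a lap they go straight on, since the lap uses the
  -- 4-cycle.
  zig₀ zig₃ : List (Row k) → Segs
  zig₀ []                 = []
  zig₀ ((g , plain)  ∷ R) = (g , z0 ∷ z1 ∷ z2 ∷ z3 ∷ []) ∷ zig₃ R
  zig₀ ((g , lapᶜ _) ∷ R) = (g , z0 ∷ []) ∷ zig₀ R
  zig₀ ((g , lapᵈ _) ∷ R) = (g , z0 ∷ []) ∷ zig₀ R
  zig₃ []                 = []
  zig₃ ((g , plain)  ∷ R) = (g , z3 ∷ z0 ∷ []) ∷ zig₀ R
  zig₃ ((g , lapᶜ _) ∷ R) = (g , z3 ∷ []) ∷ zig₃ R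
  zig₃ ((g , lapᵈ _) ∷ R) = (g , z3 ∷ []) ∷ zig₃ R

  odd-plain : List (Row k) → Bool
  odd-plain []                 = false
  odd-plain ((g , plain)  ∷ R) = not (odd-plain R)
  odd-plain ((g , lapᶜ _) ∷ R) = odd-plain R
  odd-plain ((g , lapᵈ _) ∷ R) = odd-plain R

  ClosedTag : Row k → Set
  ClosedTag (g , plain)   = ⊤
  ClosedTag (g , lapᶜ ys) = end g ys ≡ g
  ClosedTag (g , lapᵈ ys) = end g ys ≡ g

  module Weight (w : Vec Z4 (suc k) → Vec Z4 (suc k) → ℕ) where

    w∷ : Z4 → G → G → ℕ
    w∷ z u v = w (z ∷ u) (z ∷ v)

    ring : G → ℕ
    ring g = Σ₄ λ z → w (z ∷ g) (s z ∷ g)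

    loopw : Row k → ℕ
    loopw (g , plain)   = 0
    loopw (g , lapᶜ ys) = wt (w∷ z2) g ys + wt (w∷ z0) g ys
    loopw (g , lapᵈ ys) = wt (w∷ z3) g ys + wt (w∷ z1) g ys

    end-lap : ∀ f g ys → end (f ∷ g) (lap f g ys) ≡ f ∷ g
    end-lap f g ys = trans (end-++ (f ∷ g) (at (s f) (g ∷ ys)) _) (end-++ (s (s f) ∷ g) (at (s (s (s f))) (g ∷ ys)) _)

    end-laps : ∀ f g m → end (f ∷ g) (laps f g m) ≡ f ∷ g
    end-laps f g nothing   = refl
    end-laps f g (just ys) = end-lap f g ys

    wt-at : ∀ z g ys → wt w (z ∷ g) (at z ys) ≡ wt (w∷ z) g ys
    wt-at z g ys = wt-map (z ∷_) w g ys

    end-at : ∀ z g ys → end g ys ≡ g → end (z ∷ g) (at z ys) ≡ z ∷ g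
    end-at z g ys e = trans (end-map (z ∷_) g ys) (cong (z ∷_) e)

    wt-lap : ∀ f g ys → end g ys ≡ g → wt w (f ∷ g) (lap f g ys) ≡
             w (f ∷ g) (s f ∷ g) + (wt (w∷ (s f)) g ys + (w (s f ∷ g) (s (s f) ∷ g) +
               (w (s (s f) ∷ g) (s (s (s f)) ∷ g) + (wt (w∷ (s (s (s f)))) g ys + (w (s (s (s f)) ∷ g) (f ∷ g) + 0)))))
    wt-lap f g ys e = cong (w (f ∷ g) (s f ∷ g) +_) (trans (wt-++ w (s f ∷ g) (at (s f) ys) _)
      (cong₂ _+_ (wt-at (s f) g ys) (trans (cong (λ v → wt w v ((s (s f) ∷ g) ∷ (at (s (s (s f))) (g ∷ ys) ++ (f ∷ g) ∷ []))) (end-at (s f) g ys e))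
        (cong (λ n → w (s f ∷ g) (s (s f) ∷ g) + (w (s (s f) ∷ g) (s (s (s f)) ∷ g) + n))
          (trans (wt-++ w (s (s (s f)) ∷ g) (at (s (s (s f))) ys) _)
            (cong₂ _+_ (wt-at (s (s (s f))) g ys) (cong (λ v → w v (f ∷ g) + 0) (end-at (s (s (s f))) g ys e))))))))

    end-strand : ∀ f sel h R → end (f ∷ h) (strand f sel R) ≡ f ∷ end h (map proj₁ R)
    end-strand f sel h []            = refl
    end-strand f sel h ((g , t) ∷ R) = trans (end-++ (f ∷ g) (laps f g (sel t)) _)
      (trans (cong (λ v → end v (strand f sel R)) (end-laps f g (sel t))) (end-strand f sel g R))

    end-zig₀ : ∀ h R → end (z0 ∷ h) (expand (zig₀ R)) ≡ corner (odd-plain R) ∷ end h (map proj₁ R)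
    end-zig₃ : ∀ h R → end (z3 ∷ h) (expand (zig₃ R)) ≡ corner (not (odd-plain R)) ∷ end h (map proj₁ R)
    end-zig₀ h []                 = refl
    end-zig₀ h ((g , plain)  ∷ R) = end-zig₃ g R
    end-zig₀ h ((g , lapᶜ _) ∷ R) = end-zig₀ g R
    end-zig₀ h ((g , lapᵈ _) ∷ R) = end-zig₀ g R
    end-zig₃ h []                 = refl
    end-zig₃ h ((g , plain)  ∷ R) = trans (end-zig₀ g R) (cong (λ b → corner b ∷ end g (map proj₁ R)) (sym (not-involutive (odd-plain R))))
    end-zig₃ h ((g , lapᶜ _) ∷ R) = end-zig₃ g R
    end-zig₃ h ((g , lapᵈ _) ∷ R) = end-zig₃ g R

    wt-strand : ∀ f sel h g t R → wt w (f ∷ h) (strand f sel ((g , t) ∷ R)) ≡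
                w∷ f h g + (wt w (f ∷ g) (laps f g (sel t)) + wt w (f ∷ g) (strand f sel R))
    wt-strand f sel h g t R = cong (w∷ f h g +_) (trans (wt-++ w (f ∷ g) (laps f g (sel t)) _)
      (cong (λ v → wt w (f ∷ g) (laps f g (sel t)) + wt w v (strand f sel R)) (end-laps f g (sel t))))

    four : G → List (Row k) → ℕ
    four h R = (wt w (z1 ∷ h) (strand z1 selᶜ R) + wt w (z2 ∷ h) (strand z2 selᵈ R)) +
               (wt w (z0 ∷ h) (expand (zig₀ R)) + wt w (z3 ∷ h) (expand (zig₃ R)))

    regroup : ∀ b₀ b₁ b₂ b₃ t₀ t₁ t₂ t₃ r p l q →
      ((b₀ + (b₁ + (b₂ + b₃))) + r + l) + ((t₀ + (t₁ + (t₂ + t₃))) + p + q) ≡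
      (((b₀ + t₀) + ((b₁ + t₁) + ((b₂ + t₂) + (b₃ + t₃)))) + (r + p)) + (l + q)
    regroup = solve-∀

    four-≡ : ∀ h R → All ClosedTag R →
             four h R ≡ Σ₄ (λ z → wt (w∷ z) h (map proj₁ R)) + ∑ R (λ (g , _) → ring g) + ∑ R loopw
    four-≡ h []                  [] = refl
    four-≡ h ((g , plain) ∷ R)   (_ ∷ cs) = trans
      (lemma (w∷ z0 h g) (w∷ z1 h g) (w∷ z2 h g) (w∷ z3 h g)
        (w (z0 ∷ g) (z1 ∷ g)) (w (z1 ∷ g) (z2 ∷ g)) (w (z2 ∷ g) (z3 ∷ g)) (w (z3 ∷ g) (z0 ∷ g)) _ _ _ _)
      (trans (cong (Σ₄ (λ z → w∷ z h g) + ring g +_) (four-≡ g R cs))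
        (lemma′ (w∷ z0 h g) (w∷ z1 h g) (w∷ z2 h g) (w∷ z3 h g) _ _ _ _ (ring g) _ _))
      where
      lemma : ∀ b₀ b₁ b₂ b₃ a₀ a₁ a₂ a₃ c d x y →
        ((b₁ + c) + (b₂ + d)) + ((b₀ + (a₀ + (a₁ + (a₂ + y)))) + (b₃ + (a₃ + x))) ≡
        ((b₀ + (b₁ + (b₂ + b₃))) + (a₀ + (a₁ + (a₂ + a₃)))) + ((c + d) + (x + y))
      lemma = solve-∀
      lemma′ : ∀ b₀ b₁ b₂ b₃ t₀ t₁ t₂ t₃ r p q →
        ((b₀ + (b₁ + (b₂ + b₃))) + r) + ((t₀ + (t₁ + (t₂ + t₃))) + p + q) ≡
        (((b₀ + t₀) + ((b₁ + t₁) + ((b₂ + t₂) + (b₃ + t₃)))) + (r + p)) + q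
      lemma′ = solve-∀
    four-≡ h ((g , lapᶜ ys) ∷ R) (c ∷ cs) = trans
      (cong (λ n → (n + wt w (z2 ∷ h) (strand z2 selᵈ ((g , lapᶜ ys) ∷ R))) + (wt w (z0 ∷ h) (expand (zig₀ ((g , lapᶜ ys) ∷ R))) + wt w (z3 ∷ h) (expand (zig₃ ((g , lapᶜ ys) ∷ R)))))
        (trans (wt-strand z1 selᶜ h g (lapᶜ ys) R) (cong (λ n → w∷ z1 h g + (n + wt w (z1 ∷ g) (strand z1 selᶜ R))) (wt-lap z1 g ys c))))
      (trans (lemma (w∷ z0 h g) (w∷ z1 h g) (w∷ z2 h g) (w∷ z3 h g)
        (w (z0 ∷ g) (z1 ∷ g)) (w (z1 ∷ g) (z2 ∷ g)) (w (z2 ∷ g) (z3 ∷ g)) (w (z3 ∷ g) (z0 ∷ g)) (wt (w∷ z2) g ys) (wt (w∷ z0) g ys) _ _ _ _)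
      (trans (cong (Σ₄ (λ z → w∷ z h g) + ring g + (wt (w∷ z2) g ys + wt (w∷ z0) g ys) +_) (four-≡ g R cs))
        (regroup (w∷ z0 h g) (w∷ z1 h g) (w∷ z2 h g) (w∷ z3 h g) _ _ _ _ (ring g) _ (wt (w∷ z2) g ys + wt (w∷ z0) g ys) _)))
      where
      lemma : ∀ b₀ b₁ b₂ b₃ a₀ a₁ a₂ a₃ l m c d x y →
        ((b₁ + ((a₁ + (l + (a₂ + (a₃ + (m + (a₀ + 0)))))) + c)) + (b₂ + d)) + ((b₀ + x) + (b₃ + y)) ≡
        ((b₀ + (b₁ + (b₂ + b₃))) + (a₀ + (a₁ + (a₂ + a₃))) + (l + m)) + ((c + d) + (x + y))
      lemma = solve-∀
    four-≡ h ((g , lapᵈ ys) ∷ R) (c ∷ cs) = trans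
      (cong (λ n → (wt w (z1 ∷ h) (strand z1 selᶜ ((g , lapᵈ ys) ∷ R)) + n) + (wt w (z0 ∷ h) (expand (zig₀ ((g , lapᵈ ys) ∷ R))) + wt w (z3 ∷ h) (expand (zig₃ ((g , lapᵈ ys) ∷ R)))))
        (trans (wt-strand z2 selᵈ h g (lapᵈ ys) R) (cong (λ n → w∷ z2 h g + (n + wt w (z2 ∷ g) (strand z2 selᵈ R))) (wt-lap z2 g ys c))))
      (trans (lemma (w∷ z0 h g) (w∷ z1 h g) (w∷ z2 h g) (w∷ z3 h g)
        (w (z0 ∷ g) (z1 ∷ g)) (w (z1 ∷ g) (z2 ∷ g)) (w (z2 ∷ g) (z3 ∷ g)) (w (z3 ∷ g) (z0 ∷ g)) (wt (w∷ z3) g ys) (wt (w∷ z1) g ys) _ _ _ _)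
      (trans (cong (Σ₄ (λ z → w∷ z h g) + ring g + (wt (w∷ z3) g ys + wt (w∷ z1) g ys) +_) (four-≡ g R cs))
        (regroup (w∷ z0 h g) (w∷ z1 h g) (w∷ z2 h g) (w∷ z3 h g) _ _ _ _ (ring g) _ (wt (w∷ z3) g ys + wt (w∷ z1) g ys) _)))
      where
      lemma : ∀ b₀ b₁ b₂ b₃ a₀ a₁ a₂ a₃ l m c d x y →
        ((b₁ + c) + (b₂ + ((a₂ + (l + (a₃ + (a₀ + (m + (a₁ + 0)))))) + d))) + ((b₀ + x) + (b₃ + y)) ≡
        ((b₀ + (b₁ + (b₂ + b₃))) + (a₀ + (a₁ + (a₂ + a₃))) + (l + m)) + ((c + d) + (x + y))
      lemma = solve-∀

sss-≢ : ∀ {z} → z ≢ s (s (s z))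
sss-≢ {z0} ()
sss-≢ {z1} ()
sss-≢ {z2} ()
sss-≢ {z3} ()

-- The rows R₀, plain rows over tl and finally gl form a Hamiltonian cycle of G.  The trail follows it four times:
-- in copy 1 with the laps lapᶜ, in copy 2 with the laps lapᵈ, and in two zigzags between the copies 0 and 3,
-- which also traverse the 4-cycles over the plain rows.
module Circuit {k : ℕ} (R₀ : List (Row k)) (tl : List (Vec Z4 k)) (gl : Vec Z4 k) where
  open Rows {k}

  R : List (Row k)
  R = R₀ ++ map (_, plain) tl

  gs : List G
  gs = map proj₁ R

  S₁ S₂ Z₀ Z₃ : List (Vec Z4 (suc k))
  S₁ = strand z1 selᶜ R
  S₂ = strand z2 selᵈ R
  Z₀ = expand (zig₀ R)
  Z₃ = expand (zig₃ R)

  turn₁ turn₂ turn₃ : List (Vec Z4 (suc k)) → List (Vec Z4 (suc k))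
  turn₁ l = (z1 ∷ gl) ∷ (z2 ∷ gl) ∷ l
  turn₂ l = (z2 ∷ gl) ∷ (z3 ∷ gl) ∷ (z0 ∷ gl) ∷ l
  turn₃ l = (z3 ∷ gl) ∷ l

  back : List (Vec Z4 (suc k))
  back = (z0 ∷ gl) ∷ (z1 ∷ gl) ∷ []

  trail : Cycle (Vec Z4 (suc k))
  trail = record
    { root = z1 ∷ gl
    ; steps = S₁ ++ turn₁ (S₂ ++ turn₂ (Z₀ ++ turn₃ (Z₃ ++ back)))
    ; closed = trans (end-++ (z1 ∷ gl) S₁ _) (trans (end-++ (z2 ∷ gl) S₂ _)
                 (trans (end-++ (z0 ∷ gl) Z₀ _) (end-++ (z3 ∷ gl) Z₃ back))) }

  module TrailWeight (w : Vec Z4 (suc k) → Vec Z4 (suc k) → ℕ) where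
    open Weight w

    wt-join : ∀ x xs y ys e → end x xs ≡ e → wt w x (xs ++ y ∷ ys) ≡ wt w x xs + (w e y + wt w y ys)
    wt-join x xs y ys e refl = wt-++ w x xs (y ∷ ys)

    e : G
    e = end gl gs

    -- The first zigzag changes its copy at every plain row; with an odd number of them it arrives
    -- in copy 3, the start of the second one.
    trail-weight : odd-plain R ≡ true → All ClosedTag R →
      cw w trail ≡ Σ₄ (λ z → wt (w∷ z) gl (gs ++ gl ∷ [])) + ∑ (gs ++ gl ∷ []) ring + ∑ R loopw
    trail-weight odd cl = begin
      cw w trail
        ≡⟨ trans (wt-join (z1 ∷ gl) S₁ _ _ (z1 ∷ e) (end-strand z1 selᶜ gl R))
             (cong (λ n → wt w (z1 ∷ gl) S₁ + (w∷ z1 e gl + (w (z1 ∷ gl) (z2 ∷ gl) + n)))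
               (trans (wt-join (z2 ∷ gl) S₂ _ _ (z2 ∷ e) (end-strand z2 selᵈ gl R))
                 (cong (λ n → wt w (z2 ∷ gl) S₂ + (w∷ z2 e gl + (w (z2 ∷ gl) (z3 ∷ gl) + (w (z3 ∷ gl) (z0 ∷ gl) + n))))
                   (trans (wt-join (z0 ∷ gl) Z₀ _ _ (z3 ∷ e) (trans (end-zig₀ gl R) (cong (λ b → corner b ∷ e) odd)))
                     (cong (λ n → wt w (z0 ∷ gl) Z₀ + (w∷ z3 e gl + n))
                       (wt-join (z3 ∷ gl) Z₃ _ _ (z0 ∷ e) (trans (end-zig₃ gl R) (cong (λ b → corner (not b) ∷ e) odd)))))))) ⟩
      wt w (z1 ∷ gl) S₁ + (w∷ z1 e gl + (w (z1 ∷ gl) (z2 ∷ gl) +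
        (wt w (z2 ∷ gl) S₂ + (w∷ z2 e gl + (w (z2 ∷ gl) (z3 ∷ gl) + (w (z3 ∷ gl) (z0 ∷ gl) +
          (wt w (z0 ∷ gl) Z₀ + (w∷ z3 e gl + (wt w (z3 ∷ gl) Z₃ + (w∷ z0 e gl + (w (z0 ∷ gl) (z1 ∷ gl) + 0)))))))))))
        ≡⟨ lemma (wt w (z1 ∷ gl) S₁) (wt w (z2 ∷ gl) S₂) (wt w (z0 ∷ gl) Z₀) (wt w (z3 ∷ gl) Z₃)
             (w∷ z0 e gl) (w∷ z1 e gl) (w∷ z2 e gl) (w∷ z3 e gl)
             (w (z0 ∷ gl) (z1 ∷ gl)) (w (z1 ∷ gl) (z2 ∷ gl)) (w (z2 ∷ gl) (z3 ∷ gl)) (w (z3 ∷ gl) (z0 ∷ gl)) ⟩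
      four gl R + Σ₄ (λ z → w∷ z e gl) + ring gl
        ≡⟨ cong (λ n → n + Σ₄ (λ z → w∷ z e gl) + ring gl) (four-≡ gl R cl) ⟩
      Σ₄ (λ z → wt (w∷ z) gl gs) + ∑ R (λ (g , _) → ring g) + ∑ R loopw + Σ₄ (λ z → w∷ z e gl) + ring gl
        ≡⟨ lemma′ (Σ₄ (λ z → wt (w∷ z) gl gs)) (∑ R (λ (g , _) → ring g)) (∑ R loopw) (Σ₄ (λ z → w∷ z e gl)) (ring gl) ⟩
      (Σ₄ (λ z → wt (w∷ z) gl gs) + Σ₄ (λ z → w∷ z e gl)) + (∑ R (λ (g , _) → ring g) + (ring gl + 0)) + ∑ R loopw
        ≡⟨ cong₂ (λ a b → a + b + ∑ R loopw)
             (trans (sym (Σ₄-+ (λ z → wt (w∷ z) gl gs) (λ z → w∷ z e gl)))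
               (Σ₄-cong (λ z → sym (trans (wt-++ (w∷ z) gl gs (gl ∷ [])) (cong (wt (w∷ z) gl gs +_) (+-identityʳ _))))))
             (trans (cong (_+ (ring gl + 0)) (sym (∑-map proj₁ R ring))) (sym (∑-++ gs (gl ∷ []) ring))) ⟩
      Σ₄ (λ z → wt (w∷ z) gl (gs ++ gl ∷ [])) + ∑ (gs ++ gl ∷ []) ring + ∑ R loopw ∎
      where
      open ≡-Reasoning
      lemma : ∀ s₁ s₂ x y b₀ b₁ b₂ b₃ a₀ a₁ a₂ a₃ →
        s₁ + (b₁ + (a₁ + (s₂ + (b₂ + (a₂ + (a₃ + (x + (b₃ + (y + (b₀ + (a₀ + 0))))))))))) ≡
        ((s₁ + s₂) + (x + y)) + (b₀ + (b₁ + (b₂ + b₃))) + (a₀ + (a₁ + (a₂ + a₃)))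
      lemma = solve-∀
      lemma′ : ∀ a b c d e → a + b + c + d + e ≡ (a + d) + (b + (e + 0)) + c
      lemma′ = solve-∀

  module Windows (ℓ : ℕ) where

    GoodTag : Row k → Set
    GoodTag (g , plain)   = ⊤
    GoodTag (g , lapᶜ ys) = LD ℓ (g ∷ ys) × ℓ ≤ length ys
    GoodTag (g , lapᵈ ys) = LD ℓ (g ∷ ys) × ℓ ≤ length ys

    GoodSel : (Tag k → Maybe (List G)) → Row k → Set
    GoodSel sel (g , t) = ∀ ys → sel t ≡ just ys → LD ℓ (g ∷ ys) × ℓ ≤ length ys

    goodᶜ : ∀ r → GoodTag r → GoodSel selᶜ r
    goodᶜ (g , lapᶜ ys) h _ refl = h

    goodᵈ : ∀ r → GoodTag r → GoodSel selᵈ r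
    goodᵈ (g , lapᵈ ys) h _ refl = h

    -- The recent history of a strand in copy `f`: vertices of the second traversal of the latest
    -- loop, or strand vertices over rows that do not come again. Neither kind meets the rest of the
    -- strand or the next loop in the fibre `s f`.
    data Off (f : Z4) (hs : List G) : Vec Z4 (suc k) → Set where
      fibre : ∀ {g} → Off f hs (s (s (s f)) ∷ g)
      done  : ∀ {g} → All (g ≢_) hs → Off f hs (f ∷ g)

    all-at : ∀ {P : Vec Z4 (suc k) → Set} z (l : List G) → (∀ g → P (z ∷ g)) → All P (at z l)
    all-at z []      h = []
    all-at z (g ∷ l) h = h g ∷ all-at z l h

    LD-at : ∀ z {l} → LD ℓ l → LD ℓ (at z l)
    LD-at z {l} d = LD-map (z ∷_) (λ x y → ∷-injectiveʳ) ℓ l d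

    avoid : ∀ z {xs : List (Vec Z4 (suc k))} → All (λ x → ∀ v → x ≢ z ∷ v) xs → ∀ l → All (λ x → All (x ≢_) (at z l)) xs
    avoid z ps l = All.map (λ p → all-at z l p) ps

    off-later : ∀ {f g hs y} → Off f (g ∷ hs) y → Off f hs y
    off-later fibre         = fibre
    off-later (done (_ ∷ a)) = done a

    off-s : ∀ {f hs g y} → Off f hs y → y ≢ s f ∷ g
    off-s fibre    e = ss-≢ (sym (∷-injectiveˡ e))
    off-s (done _) e = s-≢ (∷-injectiveˡ e)

    off-run : ∀ {f g hs y} → Off f (g ∷ hs) y → y ≢ f ∷ g
    off-run fibre          e = sss-≢ (sym (∷-injectiveˡ e))
    off-run (done (n ∷ _)) e = n (∷-injectiveʳ e)

    module _ (f : Z4) (sel : Tag k → Maybe (List G)) where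

      rest : List (Row k) → List G
      rest Q = map proj₁ Q ++ tl

      off-tl : ∀ {hs y} → Off f hs y → All (y ≢_) (at f hs)
      off-tl {hs = []}     o = []
      off-tl {hs = h ∷ hs} o = off-run o ∷ off-tl (off-later o)

      snoc : ∀ {Y g hs} → LD ℓ Y → All (Off f (g ∷ hs)) Y → LD ℓ (Y ++ (f ∷ g) ∷ [])
      snoc d o = LD-++ ℓ d (LD-unique ℓ ([] ∷ [])) (All.map (λ p → off-run p ∷ []) o)

      -- The accumulator `Y` is the history since the last lap. Both traversals of a loop are long
      -- enough for `LD-glue`: the first separates `Y` from all that follows it, and the second
      -- becomes the new history.
      LD-strand : ∀ Q → All (GoodSel sel) Q → Unique (rest Q) → ∀ Y → LD ℓ Y → All (Off f (rest Q)) Y →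
                  LD ℓ (Y ++ strand f sel Q ++ at f tl)
      LD-strand []            []       u Y d o = LD-++ ℓ d (LD-at f (LD-unique ℓ u)) (All.map off-tl o)
      LD-strand ((g , t) ∷ Q) (h ∷ hs) (a ∷ u) Y d o with sel t
      ... | nothing = subst (LD ℓ) (++-assoc Y ((f ∷ g) ∷ []) _)
            (LD-strand Q hs u (Y ++ (f ∷ g) ∷ []) (snoc d o) (Allₚ.++⁺ (All.map off-later o) (done a ∷ [])))
      ... | just ys with h ys refl
      ... | dl , long = subst (LD ℓ) assoc
            (LD-glue ℓ (Y ++ (f ∷ g) ∷ []) L₁ long₁
              (LD-++ ℓ (snoc d o) (LD-at (s f) dl) (avoid (s f)
                 (Allₚ.++⁺ (All.map (λ p v → off-s p) o) ((λ v e → s-≢ (∷-injectiveˡ e)) ∷ [])) (g ∷ ys)))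
              (subst (LD ℓ) (++-assoc L₁ (mid ∷ []) _)
                (LD-glue ℓ (L₁ ++ mid ∷ []) L₃ long₃
                  (LD-++ ℓ (LD-++ ℓ (LD-at (s f) dl) (LD-unique ℓ ([] ∷ [])) (all-at (s f) (g ∷ ys) (λ v → (λ e → s-≢ (∷-injectiveˡ e)) ∷ [])))
                    (LD-at (s (s (s f))) dl)
                    (avoid (s (s (s f)))
                      (Allₚ.++⁺ (all-at (s f) (g ∷ ys) (λ _ v e → ss-≢ (∷-injectiveˡ e))) ((λ v e → s-≢ (∷-injectiveˡ e)) ∷ [])) (g ∷ ys)))
                  (subst (LD ℓ) (++-assoc L₃ ((f ∷ g) ∷ []) _)
                    (LD-strand Q hs u (L₃ ++ (f ∷ g) ∷ [])
                      (LD-++ ℓ (LD-at (s (s (s f))) dl) (LD-unique ℓ ([] ∷ [])) (all-at (s (s (s f))) (g ∷ ys) (λ v → (λ e → sss-≢ (sym (∷-injectiveˡ e))) ∷ [])))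
                      (Allₚ.++⁺ (all-at (s (s (s f))) (g ∷ ys) (λ v → fibre)) (done a ∷ [])))))))
            where
            L₁ L₃ : List (Vec Z4 (suc k))
            L₁ = at (s f) (g ∷ ys)
            L₃ = at (s (s (s f))) (g ∷ ys)
            mid : Vec Z4 (suc k)
            mid = s (s f) ∷ g
            long₁ : ℓ ≤ length L₁
            long₁ = m≤n⇒m≤1+n (≤-trans long (≤-reflexive (sym (length-map (s f ∷_) ys))))
            long₃ : ℓ ≤ length L₃
            long₃ = m≤n⇒m≤1+n (≤-trans long (≤-reflexive (sym (length-map (s (s (s f)) ∷_) ys))))
            U : List (Vec Z4 (suc k))
            U = strand f sel Q ++ at f tl
            assoc : (Y ++ (f ∷ g) ∷ []) ++ L₁ ++ mid ∷ (L₃ ++ (f ∷ g) ∷ U) ≡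
                    Y ++ ((f ∷ g) ∷ (lap f g ys ++ strand f sel Q)) ++ at f tl
            assoc = trans (++-assoc Y ((f ∷ g) ∷ []) _) (cong (λ l → Y ++ (f ∷ g) ∷ l)
              (sym (trans (++-assoc (lap f g ys) (strand f sel Q) (at f tl))
                (trans (++-assoc L₁ (mid ∷ (L₃ ++ (f ∷ g) ∷ [])) U)
                  (cong (λ l → L₁ ++ mid ∷ l) (++-assoc L₃ ((f ∷ g) ∷ []) U))))))

module Expand {k : ℕ} (ℓ : ℕ) where
  open Rows {k}

  data Seg : G × List Z4 → Set where
    seg : ∀ {g y σ} → Unique (y ∷ σ) → Seg (g , y ∷ σ)

  take-expand : ∀ n g z (S : Segs) → All Seg S → All (g ≢_) (take n (map proj₁ S)) →
                All ((z ∷ g) ≢_) (take n (expand S))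
  take-expand n       g z []      []       a = Allₚ.take⁺ n []
  take-expand zero    g z (_ ∷ S) (seg _ ∷ ss) a = []
  take-expand (suc n) g z ((h , y ∷ σ) ∷ S) (seg _ ∷ ss) (ne ∷ a) =
    (λ e → ne (∷-injectiveʳ e)) ∷ take-++⁺ ℓ n (map (_∷ h) σ) (others σ) (take-expand n g z S ss a)
    where
    others : ∀ σ → All ((z ∷ g) ≢_) (map (_∷ h) σ)
    others []      = []
    others (_ ∷ σ) = (λ e → ne (∷-injectiveʳ e)) ∷ others σ

  -- A repeated vertex would lie over a repeated row. Segments are nonempty and free of repetitions,
  -- so a window of vertices meets no more rows than it has entries.
  LD-expand : (S : Segs) → All Seg S → LD ℓ (map proj₁ S) → LD ℓ (expand S)
  LD-expand []            []           d       = tt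
  LD-expand ((g , σ) ∷ S) (seg u ∷ ss) (a , d) = inner σ u
    where
    inner : ∀ σ → Unique σ → LD ℓ (map (_∷ g) σ ++ expand S)
    inner []      []      = LD-expand S ss d
    inner (z ∷ σ) (n ∷ u) = take-++⁺ ℓ ℓ (map (_∷ g) σ) (Allₚ.map⁺ (All.map (λ ne e → ne (∷-injectiveˡ e)) n))
                              (take-expand ℓ g z S ss a) , inner σ u

  expand-++ : (S S′ : Segs) → expand (S ++ S′) ≡ expand S ++ expand S′
  expand-++ []            S′ = refl
  expand-++ ((g , σ) ∷ S) S′ = trans (cong (map (_∷ g) σ ++_) (expand-++ S S′)) (sym (++-assoc (map (_∷ g) σ) _ _))

  zig₀-rows : ∀ R → map proj₁ (zig₀ R) ≡ map proj₁ R
  zig₃-rows : ∀ R → map proj₁ (zig₃ R) ≡ map proj₁ R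
  zig₀-rows []                 = refl
  zig₀-rows ((g , plain)  ∷ R) = cong (g ∷_) (zig₃-rows R)
  zig₀-rows ((g , lapᶜ _) ∷ R) = cong (g ∷_) (zig₀-rows R)
  zig₀-rows ((g , lapᵈ _) ∷ R) = cong (g ∷_) (zig₀-rows R)
  zig₃-rows []                 = refl
  zig₃-rows ((g , plain)  ∷ R) = cong (g ∷_) (zig₀-rows R)
  zig₃-rows ((g , lapᶜ _) ∷ R) = cong (g ∷_) (zig₃-rows R)
  zig₃-rows ((g , lapᵈ _) ∷ R) = cong (g ∷_) (zig₃-rows R)

  single : ∀ {g z} → Seg (g , z ∷ [])
  single = seg ([] ∷ [])

  zig₀-seg : ∀ R → All Seg (zig₀ R)
  zig₃-seg : ∀ R → All Seg (zig₃ R)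
  zig₀-seg []                 = []
  zig₀-seg ((g , plain)  ∷ R) = seg (((λ ()) ∷ (λ ()) ∷ (λ ()) ∷ []) ∷ ((λ ()) ∷ (λ ()) ∷ []) ∷ ((λ ()) ∷ []) ∷ [] ∷ []) ∷ zig₃-seg R
  zig₀-seg ((g , lapᶜ _) ∷ R) = single ∷ zig₀-seg R
  zig₀-seg ((g , lapᵈ _) ∷ R) = single ∷ zig₀-seg R
  zig₃-seg []                 = []
  zig₃-seg ((g , plain)  ∷ R) = seg (((λ ()) ∷ []) ∷ [] ∷ []) ∷ zig₀-seg R
  zig₃-seg ((g , lapᶜ _) ∷ R) = single ∷ zig₃-seg R
  zig₃-seg ((g , lapᵈ _) ∷ R) = single ∷ zig₃-seg R

  straight : Z4 → List G → Segs
  straight z = map (_, z ∷ [])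

  expand-straight : ∀ z l → expand (straight z l) ≡ at z l
  expand-straight z []      = refl
  expand-straight z (g ∷ l) = cong ((z ∷ g) ∷_) (expand-straight z l)

  straight-rows : ∀ z l → map proj₁ (straight z l) ≡ l
  straight-rows z []      = refl
  straight-rows z (g ∷ l) = cong (g ∷_) (straight-rows z l)

  straight-seg : ∀ z l → All Seg (straight z l)
  straight-seg z []      = []
  straight-seg z (g ∷ l) = single ∷ straight-seg z l

module Local {k : ℕ} (R₀ : List (Row k)) (tl : List (Vec Z4 k)) (gl : Vec Z4 k) (ℓ : ℕ) where
  open Rows {k}
  open Circuit R₀ tl gl
  open Windows ℓ
  open Expand {k} ℓ

  X : List G
  X = gs ++ gl ∷ []

  gs≡ : gs ≡ map proj₁ R₀ ++ tl
  gs≡ = trans (map-++ proj₁ R₀ _) (cong (map proj₁ R₀ ++_) (go tl))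
    where
    go : ∀ l → map proj₁ (map {B = Row k} (_, plain) l) ≡ l
    go []      = refl
    go (g ∷ l) = cong (g ∷_) (go l)

  strand-plain : ∀ f sel → sel plain ≡ nothing → strand f sel R ≡ strand f sel R₀ ++ at f tl
  strand-plain f sel e = go R₀
    where
    run : ∀ l → strand f sel (map (_, plain) l) ≡ at f l
    run []      = refl
    run (g ∷ l) rewrite e = cong ((f ∷ g) ∷_) (run l)
    go : ∀ Q → strand f sel (Q ++ map (_, plain) tl) ≡ strand f sel Q ++ at f tl
    go []            = run tl
    go ((g , t) ∷ Q) = cong ((f ∷ g) ∷_) (trans (cong (laps f g (sel t) ++_) (go Q)) (sym (++-assoc (laps f g (sel t)) _ _)))

  end-part : List (Vec Z4 (suc k))
  end-part = turn₂ (Z₀ ++ turn₃ (Z₃ ++ back))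

  -- From the tail in copy 2 onwards there are no laps, and the trail follows the Hamiltonian cycle
  -- row by row. The sequence of its rows is the end of three rounds of `X`.
  segs : Segs
  segs = straight z2 tl ++ (gl , z2 ∷ z3 ∷ z0 ∷ []) ∷ zig₀ R ++ (gl , z3 ∷ []) ∷ zig₃ R ++ (gl , z0 ∷ z1 ∷ []) ∷ []

  expand-segs : expand segs ≡ at z2 tl ++ end-part
  expand-segs = trans (expand-++ (straight z2 tl) _) (cong₂ (λ a b → a ++ turn₂ b) (expand-straight z2 tl)
    (trans (expand-++ (zig₀ R) _) (cong (λ b → Z₀ ++ turn₃ b) (expand-++ (zig₃ R) _))))

  segs-rows : map proj₁ segs ≡ tl ++ gl ∷ gs ++ gl ∷ gs ++ gl ∷ []
  segs-rows = trans (map-++ proj₁ (straight z2 tl) _) (cong₂ (λ a b → a ++ gl ∷ b) (straight-rows z2 tl)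
    (trans (map-++ proj₁ (zig₀ R) _) (cong₂ (λ a b → a ++ gl ∷ b) (zig₀-rows R)
      (trans (map-++ proj₁ (zig₃ R) _) (cong (_++ gl ∷ []) (zig₃-rows R))))))

  module _ (u : Unique X) (lt : ℓ ≤ length tl) where

    ℓ<X : ℓ < length X
    ℓ<X = subst (λ l → ℓ < length (l ++ gl ∷ [])) (sym gs≡) (subst (ℓ <_) (sym len) (s≤s (≤-trans lt (m≤n+m _ (length (map proj₁ R₀))))))
      where
      len : length ((map proj₁ R₀ ++ tl) ++ gl ∷ []) ≡ suc (length (map proj₁ R₀) + length tl)
      len = trans (length-++ (map proj₁ R₀ ++ tl)) (trans (+-comm _ 1) (cong suc (length-++ (map proj₁ R₀))))

    LD-rows : LD ℓ (tl ++ gl ∷ gs ++ gl ∷ gs ++ gl ∷ [])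
    LD-rows = LD-suffix ℓ (map proj₁ R₀) (subst (LD ℓ) eq
      (LD-glue ℓ X X (<⇒≤ ℓ<X) (LD-twice ℓ X u ℓ<X) (LD-twice ℓ X u ℓ<X)))
      where
      eq : X ++ X ++ X ≡ map proj₁ R₀ ++ tl ++ gl ∷ gs ++ gl ∷ gs ++ gl ∷ []
      eq = trans (++-assoc gs (gl ∷ []) (X ++ X)) (trans
        (cong₂ (λ a b → a ++ gl ∷ b) gs≡ (++-assoc gs (gl ∷ []) X)) (++-assoc (map proj₁ R₀) tl _))

    claim₃ : LD ℓ (at z2 tl ++ end-part)
    claim₃ = subst (LD ℓ) expand-segs (LD-expand segs
      (Allₚ.++⁺ (straight-seg z2 tl) (seg (((λ ()) ∷ (λ ()) ∷ []) ∷ ((λ ()) ∷ []) ∷ [] ∷ []) ∷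
        Allₚ.++⁺ (zig₀-seg R) (single ∷ Allₚ.++⁺ (zig₃-seg R) (seg (((λ ()) ∷ []) ∷ [] ∷ []) ∷ []))))
      (subst (LD ℓ) (sym segs-rows) LD-rows))

    u′ : Unique ((map proj₁ R₀ ++ tl) ++ gl ∷ [])
    u′ = subst (λ l → Unique (l ++ gl ∷ [])) gs≡ u

    u-rest : Unique (map proj₁ R₀ ++ tl)
    u-rest = unique-++ˡ (map proj₁ R₀ ++ tl) u′

    gl-new : All (gl ≢_) (map proj₁ R₀ ++ tl)
    gl-new = go (map proj₁ R₀ ++ tl) u′
      where
      go : ∀ l → Unique (l ++ gl ∷ []) → All (gl ≢_) l
      go []      _       = []
      go (g ∷ l) (a ∷ u) with Allₚ.++⁻ʳ l a
      ... | n ∷ [] = (λ e → n (sym e)) ∷ go l u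

    module _ (good : All GoodTag R₀) where

      claim₁ : LD ℓ (((z1 ∷ gl) ∷ strand z1 selᶜ R₀) ++ at z1 tl)
      claim₁ = LD-strand z1 selᶜ R₀ (All.map (λ {r} → goodᶜ r) good) u-rest ((z1 ∷ gl) ∷ []) (LD-unique ℓ ([] ∷ []))
        (done gl-new ∷ [])

      claim₂ : LD ℓ ((at z1 tl ++ (z1 ∷ gl) ∷ (z2 ∷ gl) ∷ strand z2 selᵈ R₀) ++ at z2 tl)
      claim₂ = subst (LD ℓ) (trans (++-assoc (at z1 tl) _ _) (sym (++-assoc (at z1 tl) _ _)))
        (LD-strand z2 selᵈ R₀ (All.map (λ {r} → goodᵈ r) good) u-rest (at z1 tl ++ (z1 ∷ gl) ∷ (z2 ∷ gl) ∷ [])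
          (LD-++ ℓ (LD-at z1 (LD-unique ℓ (unique-++ʳ (map proj₁ R₀) u-rest)))
            (LD-unique ℓ (((λ ()) ∷ []) ∷ [] ∷ []))
            (Allₚ.map⁺ (All.map (λ n → (λ e → n (sym (∷-injectiveʳ e))) ∷ (λ ()) ∷ []) (Allₚ.++⁻ʳ (map proj₁ R₀) gl-new))))
          (Allₚ.++⁺ (all-at z1 tl (λ g → fibre)) (fibre ∷ done gl-new ∷ [])))

      -- The three claims overlap in the plain tails of the strands in copies 1 and 2; each tail has
      -- at least `ℓ` vertices, so they can be glued.
      LD-trail : LD ℓ (root trail ∷ steps trail)
      LD-trail = subst (LD ℓ) eq
        (LD-glue ℓ ((z1 ∷ gl) ∷ strand z1 selᶜ R₀) (at z1 tl) (long z1) claim₁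
          (subst (LD ℓ) (++-assoc (at z1 tl) _ _)
            (LD-glue ℓ (at z1 tl ++ (z1 ∷ gl) ∷ (z2 ∷ gl) ∷ strand z2 selᵈ R₀) (at z2 tl) (long z2) claim₂ claim₃)))
        where
        long : ∀ z → ℓ ≤ length (at z tl)
        long z = ≤-trans lt (≤-reflexive (sym (length-map (z ∷_) tl)))
        eq : ((z1 ∷ gl) ∷ strand z1 selᶜ R₀) ++ at z1 tl ++ (z1 ∷ gl) ∷ (z2 ∷ gl) ∷ strand z2 selᵈ R₀ ++ at z2 tl ++ end-part
             ≡ root trail ∷ steps trail
        eq = cong ((z1 ∷ gl) ∷_) (trans (sym (++-assoc (strand z1 selᶜ R₀) (at z1 tl) _))
          (cong₂ (λ a b → a ++ turn₁ b) (sym (strand-plain z1 selᶜ refl))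
            (trans (sym (++-assoc (strand z2 selᵈ R₀) (at z2 tl) end-part)) (cong (_++ end-part) (sym (strand-plain z2 selᵈ refl))))))

-- Hamiltonian cycles with columns

_≟ˣ_ : ∀ {m} (x y : Vec Z4 m) → Dec (x ≡ y)
_≟ˣ_ = vec-≡-dec _≟⁴_

occ : ∀ {m} → Vec Z4 m → Vec Z4 m → ℕ
occ x y = boolToℕ ⌊ x ≟ˣ y ⌋

occ-≡ : ∀ {m} (x : Vec Z4 m) → occ x x ≡ 1
occ-≡ x = yes-1 (x ≟ˣ x) refl

occ-≢ : ∀ {m} {x y : Vec Z4 m} → x ≢ y → occ x y ≡ 0
occ-≢ {x = x} {y} n = no-0 (x ≟ˣ y) n

ΣV-occ : ∀ m (x : Vec Z4 m) → ΣV m (occ x) ≡ 1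
ΣV-occ m x = trans (ΣV-single m x (λ y ne → occ-≢ λ e → ne (sym e))) (occ-≡ x)

unique-occ : ∀ {m} (l : List (Vec Z4 m)) → (∀ x → ∑ l (occ x) ≤ 1) → Unique l
unique-occ []      h = []
unique-occ {m} (x ∷ l) h = absent l (n≤0⇒n≡0 (+-cancelˡ-≤ 1 _ _ (subst (λ k → k + ∑ l (occ x) ≤ 1) (occ-≡ x) (h x)))) ∷
  unique-occ l (λ y → ≤-trans (m≤n+m _ (occ y x)) (h y))
  where
  absent : ∀ l → ∑ l (occ x) ≡ 0 → All (x ≢_) l
  absent []      e = []
  absent (y ∷ l) e = (λ { refl → 1≢0 (trans (sym (occ-≡ x)) (m+n≡0⇒m≡0 (occ x x) e)) }) ∷ absent l (m+n≡0⇒n≡0 (occ x y) e)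
    where
    1≢0 : 1 ≢ 0
    1≢0 ()

member-occ : ∀ {m} (x : Vec Z4 m) l → 1 ≤ ∑ l (occ x) → ∃₂ λ p q → l ≡ p ++ x ∷ q
member-occ x (y ∷ l) h = by (x ≟ˣ y)
  where
  by : Dec (x ≡ y) → ∃₂ λ p q → y ∷ l ≡ p ++ x ∷ q
  by (yes refl) = [] , l , refl
  by (no n) with member-occ x l (subst (λ k → 1 ≤ k + ∑ l (occ x)) (occ-≢ n) h)
  ... | p , q , refl = y ∷ p , q , refl

Simple : ∀ {m} → Cycle (Vec Z4 m) → Set
Simple C = ∀ x → ∑ (steps C) (occ x) ≤ 1

ham-simple : ∀ {m} {C : Cycle (Vec Z4 m)} → Ham C → Simple C
ham-simple {m} h x = ≤-reflexive (trans (h (occ x)) (ΣV-occ m x))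

ham-visits : ∀ {m} {C : Cycle (Vec Z4 m)} → Ham C → ∀ x → 1 ≤ ∑ (steps C) (occ x)
ham-visits {m} h x = ≤-reflexive (sym (trans (h (occ x)) (ΣV-occ m x)))

record Rooted {m} (C : Cycle (Vec Z4 m)) (g : Vec Z4 m) : Set where
  field
    around : List (Vec Z4 m)
    return : end g around ≡ g
    weight : ∀ w → wt w g around ≡ cw w C
    unique : Unique around
open Rooted public

reroot : ∀ {m} (C : Cycle (Vec Z4 m)) → Simple C → ∀ g → 1 ≤ ∑ (steps C) (occ g) → Rooted C g
reroot C sm g v with member-occ g (steps C) v
... | p , q , eq = record
  { around = q ++ p ++ g ∷ []
  ; return = trans (end-++ g q _) (end-++ (end g q) p _)
  ; weight = λ w → trans (wt-++ w g q (p ++ g ∷ [])) (trans (cong (λ v → wt w g q + wt w v (p ++ g ∷ [])) last)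
      (trans (+-comm (wt w g q) _) (sym (trans (cong (wt w (root C)) eq) (trans (wt-++ w (root C) p (g ∷ q))
        (trans (sym (+-assoc (wt w (root C) p) (w (end (root C) p) g) (wt w g q)))
          (cong (_+ wt w g q) (sym (trans (wt-++ w (root C) p (g ∷ [])) (cong (wt w (root C) p +_) (+-identityʳ _)))))))))))
  ; unique = unique-occ (q ++ p ++ g ∷ []) (λ x → ≤-trans (≤-reflexive (same x)) (sm x)) }
  where
  last : end g q ≡ root C
  last = trans (sym (end-++ (root C) p (g ∷ q))) (trans (cong (end (root C)) (sym eq)) (closed C))
  same : ∀ x → ∑ (q ++ p ++ g ∷ []) (occ x) ≡ ∑ (steps C) (occ x)
  same x = trans (∑-++ q _ (occ x)) (trans (cong (∑ q (occ x) +_) (∑-++ p _ (occ x)))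
    (trans (lemma (∑ q (occ x)) (∑ p (occ x)) (occ x g)) (sym (trans (cong (λ l → ∑ l (occ x)) eq) (∑-++ p (g ∷ q) (occ x))))))
    where
    lemma : ∀ a b c → a + (b + (c + 0)) ≡ b + (c + a)
    lemma = solve-∀

snoc-view : ∀ {A : Set} (l : List A) → 1 ≤ length l → ∃₂ λ p x → l ≡ p ++ x ∷ []
snoc-view (x ∷ [])     _ = [] , x , refl
snoc-view (x ∷ y ∷ l)  _ with snoc-view (y ∷ l) (s≤s z≤n)
... | p , z , e = x ∷ p , z , cong (x ∷_) e

-- The start is repeated only as the last entry, which lies outside its window because `ℓ` is
-- smaller than the length.
LD-closed : ∀ {A : Set} ℓ (g : A) ys → end g ys ≡ g → Unique ys → ℓ < length ys → LD ℓ (g ∷ ys)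
LD-closed ℓ g ys e u lt with snoc-view ys (≤-trans (s≤s z≤n) lt)
... | p , x , refl with trans (sym (end-++ g p (x ∷ []))) e
... | refl = subst (All (g ≢_)) (sym (take-long ℓ ℓ p le)) (Allₚ.take⁺ ℓ (new p u)) , LD-unique ℓ u
  where
  le : ℓ ≤ length p
  le = +-cancelˡ-≤ 1 _ _ (≤-trans lt (≤-reflexive (trans (length-++ p) (+-comm (length p) 1))))
  new : ∀ p → Unique (p ++ g ∷ []) → All (g ≢_) p
  new []      _       = []
  new (y ∷ p) (a ∷ u) with Allₚ.++⁻ʳ p a
  ... | n ∷ [] = (λ e → n (sym e)) ∷ new p u

flips : ∀ {A : Set} → List A → Bool
flips []      = false
flips (_ ∷ l) = not (flips l)

flips-even : ∀ {A : Set} (l : List A) j → length l ≡ j + j → flips l ≡ false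
flips-even []          j       e = refl
flips-even (x ∷ [])    (suc j) e with trans e (cong suc (+-suc j j))
... | ()
flips-even (x ∷ y ∷ l) (suc j) e =
  trans (not-involutive (flips l)) (flips-even l j (suc-injective (suc-injective (trans e (cong suc (+-suc j j))))))

flips-snoc : ∀ {A : Set} (l : List A) x → flips (l ++ x ∷ []) ≡ not (flips l)
flips-snoc []      x = refl
flips-snoc (y ∷ l) x = cong not (flips-snoc l x)

-- The vertices of a Hamiltonian cycle of Q_{2k} are grouped into columns ord b h, where b alternates from one
-- column to the next; col b h κ l is this column carrying one lap through the loop l, namely a lapᶜ for κ = false
-- and a lapᵈ for κ = true.
module Plan {k : ℕ} (H L : Set) (c : ℕ)
  (ord : Bool → H → List (Vec Z4 k)) (ord-length : ∀ b h → length (ord b h) ≡ c)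
  (cyc : L → Cycle (Vec Z4 k))
  (col : Bool → H → Bool → L → List (Row k))
  (col-ord : ∀ b h κ l → map proj₁ (col b h κ l) ≡ ord b h)
  (par : Bool) (col-par : ∀ b h κ l → Rows.odd-plain (col b h κ l) ≡ par)
  (col-closed : ∀ b h κ l → All Rows.ClosedTag (col b h κ l))
  (col-weightᶜ : ∀ w b h l → ∑ (col b h false l) (Rows.Weight.loopw w) ≡
     cw (Rows.Weight.w∷ w z2) (cyc l) + cw (Rows.Weight.w∷ w z0) (cyc l))
  (col-weightᵈ : ∀ w b h l → ∑ (col b h true l) (Rows.Weight.loopw w) ≡
     cw (Rows.Weight.w∷ w z3) (cyc l) + cw (Rows.Weight.w∷ w z1) (cyc l))
  where
  open Rows {k}

  Item : Set
  Item = H × Maybe (Bool × L)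

  column : Bool → Item → List (Row k)
  column b (h , nothing)      = map (_, plain) (ord b h)
  column b (h , just (κ , l)) = col b h κ l

  rows : Bool → List Item → List (Row k)
  rows b []       = []
  rows b (i ∷ is) = column b i ++ rows (not b) is

  vertices : Bool → List H → List G
  vertices b []       = []
  vertices b (h ∷ hs) = ord b h ++ vertices (not b) hs

  proj₁-plain : ∀ l → map proj₁ (map {B = Row k} (_, plain) l) ≡ l
  proj₁-plain []      = refl
  proj₁-plain (g ∷ l) = cong (g ∷_) (proj₁-plain l)

  column-ord : ∀ b i → map proj₁ (column b i) ≡ ord b (proj₁ i)
  column-ord b (h , nothing)      = proj₁-plain (ord b h)
  column-ord b (h , just (κ , l)) = col-ord b h κ l

  rows-vertices : ∀ b is → map proj₁ (rows b is) ≡ vertices b (map proj₁ is)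
  rows-vertices b []       = refl
  rows-vertices b (i ∷ is) = trans (map-++ proj₁ (column b i) _) (cong₂ _++_ (column-ord b i) (rows-vertices (not b) is))

  length-vertices : ∀ b hs → length (vertices b hs) ≡ length hs * c
  length-vertices b []       = refl
  length-vertices b (h ∷ hs) = trans (length-++ (ord b h)) (cong₂ _+_ (ord-length b h) (length-vertices (not b) hs))

  after : Bool → List H → Bool
  after b []       = b
  after b (_ ∷ hs) = after (not b) hs

  vertices-++ : ∀ b hs hs′ → vertices b (hs ++ hs′) ≡ vertices b hs ++ vertices (after b hs) hs′
  vertices-++ b []       hs′ = refl
  vertices-++ b (h ∷ hs) hs′ = trans (cong (ord b h ++_) (vertices-++ (not b) hs hs′)) (sym (++-assoc (ord b h) _ _))

  odd-plain-++ : ∀ (Q Q′ : List (Row k)) → odd-plain (Q ++ Q′) ≡ odd-plain Q xor odd-plain Q′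
  odd-plain-++ []                 Q′ = refl
  odd-plain-++ ((g , plain)  ∷ Q) Q′ = trans (cong not (odd-plain-++ Q Q′)) (not-xor (odd-plain Q) _)
    where
    not-xor : ∀ a b → not (a xor b) ≡ not a xor b
    not-xor true  true  = refl
    not-xor true  false = refl
    not-xor false true  = refl
    not-xor false false = refl
  odd-plain-++ ((g , lapᶜ _) ∷ Q) Q′ = odd-plain-++ Q Q′
  odd-plain-++ ((g , lapᵈ _) ∷ Q) Q′ = odd-plain-++ Q Q′

  odd-plain-flips : ∀ l → odd-plain (map (_, plain) l) ≡ flips l
  odd-plain-flips []      = refl
  odd-plain-flips (g ∷ l) = cong not (odd-plain-flips l)

  mark : Bool → List L → List H → List Item
  mark κ []       hs       = []
  mark κ (l ∷ ls) []       = []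
  mark κ (l ∷ ls) (h ∷ hs) = (h , just (κ , l)) ∷ mark κ ls hs

  mark-heads : ∀ κ ls hs → length ls ≡ length hs → map proj₁ (mark κ ls hs) ≡ hs
  mark-heads κ []       []       e = refl
  mark-heads κ (l ∷ ls) (h ∷ hs) e = cong (h ∷_) (mark-heads κ ls hs (suc-injective e))

  power : List L → Bool
  power []       = false
  power (l ∷ ls) = par xor power ls

  mark-par : ∀ κ ls hs → length ls ≡ length hs → ∀ b → odd-plain (rows b (mark κ ls hs)) ≡ power ls
  mark-par κ []       []       e b = refl
  mark-par κ (l ∷ ls) (h ∷ hs) e b = trans (odd-plain-++ (col b h κ l) _)
    (cong₂ _xor_ (col-par b h κ l) (mark-par κ ls hs (suc-injective e) (not b)))

  mark-closed : ∀ κ ls hs b → All ClosedTag (rows b (mark κ ls hs))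
  mark-closed κ []       hs       b = []
  mark-closed κ (l ∷ ls) []       b = []
  mark-closed κ (l ∷ ls) (h ∷ hs) b = Allₚ.++⁺ (col-closed b h κ l) (mark-closed κ ls hs (not b))

  mark-weight : ∀ w κ (v : L → ℕ) → (∀ b h l → ∑ (col b h κ l) (Weight.loopw w) ≡ v l) →
                ∀ ls hs → length ls ≡ length hs → ∀ b → ∑ (rows b (mark κ ls hs)) (Weight.loopw w) ≡ ∑ ls v
  mark-weight w κ v h []       []       e b = refl
  mark-weight w κ v h (l ∷ ls) (x ∷ hs) e b = trans (∑-++ (col b x κ l) _ _)
    (cong₂ _+_ (h b x l) (mark-weight w κ v h ls hs (suc-injective e) (not b)))

  module Link (ℓ : ℕ) (ls : List L) (hs₁ hs₂ hs₃ : List H)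
    (len₁ : length ls ≡ length hs₁) (len₂ : length ls ≡ length hs₂)
    -- One row more than `ℓ`: the last row is split off as `gl`, the others form `tl`.
    (room : suc ℓ ≤ length hs₃ * c) (even : ∃ λ j → length hs₃ * c ≡ j + j)
    (X : Cycle (Vec Z4 k)) (ham : Ham X) (steps-X : steps X ≡ vertices false (hs₁ ++ hs₂ ++ hs₃))
    (total : ∀ w → Sym w → cw w X + ∑ ls (λ l → cw w (cyc l)) ≡ E k w)
    (col-good : ∀ b h κ l → All (Circuit.Windows.GoodTag [] [] (root X) ℓ) (col b h κ l))
    where

    b₁ b₂ : Bool
    b₁ = after false hs₁
    b₂ = after b₁ hs₂

    R₀ : List (Row k)
    R₀ = rows false (mark false ls hs₁) ++ rows b₁ (mark true ls hs₂)

    heads : map proj₁ R₀ ≡ vertices false hs₁ ++ vertices b₁ hs₂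
    heads = trans (map-++ proj₁ (rows false (mark false ls hs₁)) _)
      (cong₂ _++_ (trans (rows-vertices false (mark false ls hs₁)) (cong (vertices false) (mark-heads false ls hs₁ len₁)))
        (trans (rows-vertices b₁ (mark true ls hs₂)) (cong (vertices b₁) (mark-heads true ls hs₂ len₂))))

    len₃ : length (vertices b₂ hs₃) ≡ length hs₃ * c
    len₃ = length-vertices b₂ hs₃

    view : ∃₂ λ p x → vertices b₂ hs₃ ≡ p ++ x ∷ []
    view = snoc-view (vertices b₂ hs₃) (≤-trans (s≤s z≤n) (subst (suc ℓ ≤_) (sym len₃) room))

    tl : List G
    tl = proj₁ view

    gl : G
    gl = proj₁ (proj₂ view)

    view-≡ : vertices b₂ hs₃ ≡ tl ++ gl ∷ []
    view-≡ = proj₂ (proj₂ view)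

    open Circuit R₀ tl gl
    open Local R₀ tl gl ℓ using (gs≡; LD-trail)
    open Circuit.Windows R₀ tl gl ℓ using (GoodTag)

    X-steps : steps X ≡ gs ++ gl ∷ []
    X-steps = trans steps-X (trans (vertices-++ false hs₁ (hs₂ ++ hs₃)) (trans
      (cong (vertices false hs₁ ++_) (trans (vertices-++ b₁ hs₂ hs₃) (cong (vertices b₁ hs₂ ++_) view-≡)))
      (trans (sym (++-assoc (vertices false hs₁) (vertices b₁ hs₂) _)) (trans (cong (_++ tl ++ gl ∷ []) (sym heads))
        (trans (sym (++-assoc (map proj₁ R₀) tl _)) (cong (_++ gl ∷ []) (sym gs≡)))))))

    root-X : root X ≡ gl
    root-X = trans (sym (closed X)) (trans (cong (end (root X)) X-steps) (end-++ (root X) gs _))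

    suc-tl : suc (length tl) ≡ length hs₃ * c
    suc-tl = trans (+-comm 1 (length tl)) (trans (sym (length-++ tl)) (trans (cong length (sym view-≡)) len₃))

    tl-long : ℓ ≤ length tl
    tl-long = +-cancelˡ-≤ 1 _ _ (subst (suc ℓ ≤_) (sym suc-tl) room)

    odd : odd-plain R ≡ true
    odd = trans (odd-plain-++ R₀ _) (trans (cong₂ _xor_ head-par (odd-plain-flips tl)) tl-odd)
      where
      head-par : odd-plain R₀ ≡ false
      -- The same loops are marked once with each kind of lap, so the parities of their columns
      -- cancel.
      head-par = trans (odd-plain-++ (rows false (mark false ls hs₁)) _)
        (trans (cong₂ _xor_ (mark-par false ls hs₁ len₁ false) (mark-par true ls hs₂ len₂ b₁)) (xor-same (power ls)))
      tl-odd : flips tl ≡ true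
      -- The unmarked rows are even in number, and `gl` is removed from them.
      tl-odd = trans (sym (not-involutive (flips tl))) (cong not (trans (sym (flips-snoc tl gl))
        (trans (cong flips (sym view-≡)) (flips-even (vertices b₂ hs₃) (proj₁ even) (trans len₃ (proj₂ even))))))

    all-plain : ∀ {P : Row k → Set} → (∀ g → P (g , plain)) → ∀ l → All P (map (_, plain) l)
    all-plain h []      = []
    all-plain h (g ∷ l) = h g ∷ all-plain h l

    closed-tags : All ClosedTag R
    closed-tags = Allₚ.++⁺ (Allₚ.++⁺ (mark-closed false ls hs₁ false) (mark-closed true ls hs₂ b₁)) (all-plain (λ g → tt) tl)

    mark-good : ∀ κ ls hs b → All GoodTag (rows b (mark κ ls hs))
    mark-good κ []       hs       b = []
    mark-good κ (l ∷ ls) []       b = []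
    mark-good κ (l ∷ ls) (h ∷ hs) b = Allₚ.++⁺ (All.map (λ {r} → convert r) (col-good b h κ l)) (mark-good κ ls hs (not b))
      where
      -- `GoodTag` speaks of the tag alone; the hypothesis has it for an empty circuit because `R₀`
      -- is not yet known there.
      convert : ∀ r → Circuit.Windows.GoodTag [] [] (root X) ℓ r → GoodTag r
      convert (g , plain)   q = tt
      convert (g , lapᶜ ys) q = q
      convert (g , lapᵈ ys) q = q

    good-tags : All GoodTag R₀
    good-tags = Allₚ.++⁺ (mark-good false ls hs₁ false) (mark-good true ls hs₂ b₁)

    trail-LD : LD ℓ (root trail ∷ steps trail)
    trail-LD = LD-trail (subst Unique X-steps (unique-occ (steps X) (ham-simple {C = X} ham))) tl-long good-tags

    module _ (w : Vec Z4 (suc k) → Vec Z4 (suc k) → ℕ) (w-sym : Sym w) where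
      open Weight w

      -- The lap of kind `lapᶜ` covers copies 2 and 0 of its loop, the one of kind `lapᵈ` copies 3
      -- and 1.
      loops-weight : ∑ R loopw ≡ Σ₄ λ z → ∑ ls (λ l → cw (w∷ z) (cyc l))
      loops-weight = begin
        ∑ R loopw ≡⟨ ∑-++ R₀ _ loopw ⟩
        ∑ R₀ loopw + ∑ (map (_, plain) tl) loopw ≡⟨ cong (∑ R₀ loopw +_) (plain-0 tl) ⟩
        ∑ R₀ loopw + 0 ≡⟨ +-identityʳ _ ⟩
        ∑ R₀ loopw ≡⟨ ∑-++ (rows false (mark false ls hs₁)) _ loopw ⟩
        ∑ (rows false (mark false ls hs₁)) loopw + ∑ (rows b₁ (mark true ls hs₂)) loopw
          ≡⟨ cong₂ _+_ (mark-weight w false _ (λ b h l → col-weightᶜ w b h l) ls hs₁ len₁ false)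
                       (mark-weight w true _ (λ b h l → col-weightᵈ w b h l) ls hs₂ len₂ b₁) ⟩
        ∑ ls (λ l → cw (w∷ z2) (cyc l) + cw (w∷ z0) (cyc l)) + ∑ ls (λ l → cw (w∷ z3) (cyc l) + cw (w∷ z1) (cyc l))
          ≡⟨ cong₂ _+_ (∑-+ ls _ _) (∑-+ ls _ _) ⟩
        (s₂ + s₀) + (s₃ + s₁) ≡⟨ lemma s₀ s₁ s₂ s₃ ⟩
        s₀ + (s₁ + (s₂ + s₃)) ∎
        where
        open ≡-Reasoning
        s₀ s₁ s₂ s₃ : ℕ
        s₀ = ∑ ls (λ l → cw (w∷ z0) (cyc l))
        s₁ = ∑ ls (λ l → cw (w∷ z1) (cyc l))
        s₂ = ∑ ls (λ l → cw (w∷ z2) (cyc l))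
        s₃ = ∑ ls (λ l → cw (w∷ z3) (cyc l))
        lemma : ∀ a b c d → (c + a) + (d + b) ≡ a + (b + (c + d))
        lemma = solve-∀
        plain-0 : ∀ l → ∑ (map (_, plain) l) loopw ≡ 0
        plain-0 []      = refl
        plain-0 (g ∷ l) = plain-0 l

      trail-total : cw w trail ≡ E (suc k) w
      trail-total = begin
        cw w trail ≡⟨ TrailWeight.trail-weight w odd closed-tags ⟩
        Σ₄ (λ z → wt (w∷ z) gl (gs ++ gl ∷ [])) + ∑ (gs ++ gl ∷ []) ring + ∑ R loopw
          ≡⟨ cong₂ (λ a b → a + b + ∑ R loopw)
               (Σ₄-cong λ z → sym (cong₂ (wt (w∷ z)) root-X X-steps))
               (trans (cong (λ l → ∑ l ring) (sym X-steps)) (trans (ham ring) (ΣV-Σ₄ k (λ z x → w (z ∷ x) (s z ∷ x))))) ⟩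
        Σ₄ (λ z → cw (w∷ z) X) + Σ₄ (λ z → ΣV k λ x → w (z ∷ x) (s z ∷ x)) + ∑ R loopw
          ≡⟨ cong (Σ₄ (λ z → cw (w∷ z) X) + rings +_) loops-weight ⟩
        Σ₄ (λ z → cw (w∷ z) X) + rings + Σ₄ (λ z → ∑ ls (λ l → cw (w∷ z) (cyc l)))
          ≡⟨ lemma (Σ₄ (λ z → cw (w∷ z) X)) rings _ ⟩
        rings + (Σ₄ (λ z → cw (w∷ z) X) + Σ₄ (λ z → ∑ ls (λ l → cw (w∷ z) (cyc l))))
          ≡⟨ cong (rings +_) (trans (sym (Σ₄-+ (λ z → cw (w∷ z) X) (λ z → ∑ ls (λ l → cw (w∷ z) (cyc l)))))
               (Σ₄-cong λ z → total (w∷ z) (λ u v → w-sym (z ∷ u) (z ∷ v)))) ⟩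
        rings + Σ₄ (λ z → E k (w∷ z)) ∎
        where
        open ≡-Reasoning
        rings : ℕ
        rings = Σ₄ (λ z → ΣV k λ x → w (z ∷ x) (s z ∷ x))
        lemma : ∀ a b c → a + b + c ≡ b + (a + c)
        lemma = solve-∀

-- Edge counts and the cutting of closed trails

quadruple : ∀ a → a + (a + (a + a)) ≡ 4 * a
quadruple = solve-∀

ΣV-1 : ∀ m → ΣV m (λ _ → 1) ≡ 4 ^ m
ΣV-1 zero    = refl
ΣV-1 (suc m) = trans (quadruple (ΣV m (λ _ → 1))) (cong (4 *_) (ΣV-1 m))

E-1 : ∀ m → E m (λ _ _ → 1) ≡ m * 4 ^ m
E-1 zero    = refl
E-1 (suc m) = trans
  (cong₂ _+_ (trans (quadruple (ΣV m (λ _ → 1))) (cong (4 *_) (ΣV-1 m)))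
    (trans (quadruple (E m (λ _ _ → 1))) (cong (4 *_) (E-1 m))))
  (lemma m (4 ^ m))
  where
  lemma : ∀ m p → 4 * p + 4 * (m * p) ≡ (1 + m) * (4 * p)
  lemma = solve-∀

2^-even : ∀ m → 2 ^ (m * 2) ≡ 4 ^ m
2^-even zero    = refl
2^-even (suc m) = trans (cong (λ p → 2 * (2 * p)) (2^-even m)) (lemma (4 ^ m))
  where
  lemma : ∀ p → 2 * (2 * p) ≡ 4 * p
  lemma = solve-∀

numEdges-even : ∀ m → numEdges (m * 2) ≡ m * 4 ^ m
numEdges-even zero    = refl
numEdges-even (suc m) = trans (lemma m (2 ^ (m * 2))) (cong (λ p → (1 + m) * (4 * p)) (2^-even m))
  where
  lemma : ∀ m p → (2 + m * 2) * (p + (p + 0)) ≡ (1 + m) * (4 * p)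
  lemma = solve-∀

cycle-length : ∀ {m} (C : Cycle (Vec Z4 m)) → length (steps C) ≡ cw (λ _ _ → 1) C
cycle-length C = sym (wt-1 (root C) (steps C))

ham-length : ∀ {m} (C : Cycle (Vec Z4 m)) → Ham C → length (steps C) ≡ 4 ^ m
ham-length {m} C h = trans (sym (trans (∑-const (steps C) 1) (*-identityʳ _))) (trans (h (λ _ → 1)) (ΣV-1 m))

trail-decomposition : ∀ m ℓ (C : Cycle (Vec Z4 m)) → LD ℓ (root C ∷ steps C) → (∀ w → Sym w → cw w C ≡ E m w) →
                      ℓ ∣ numEdges (m * 2) → PathDecomposition (m * 2) ℓ
trail-decomposition m ℓ C d total (divides r e) = assemble m ℓ (C ∷ [])
  ((d , r , trans (cycle-length C) (trans (total _ (λ _ _ → refl)) (trans (E-1 m) (trans (sym (numEdges-even m)) e)))) ∷ [])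
  (λ w w-sym → trans (+-identityʳ _) (total w w-sym))

hamiltonian-decomposition : ∀ m ℓ → HamDec m → ℓ ∣ 4 ^ m → ℓ < 4 ^ m → PathDecomposition (m * 2) ℓ
hamiltonian-decomposition m ℓ D (divides r e) lt = assemble m ℓ cycles (slices cycles ham) (λ w _ → total w)
  where
  open HamDec D
  slices : ∀ Cs → All Ham Cs → All (Sliceable ℓ) Cs
  slices []       []       = []
  slices (C ∷ Cs) (h ∷ hs) =
    (LD-closed ℓ (root C) (steps C) (closed C) (unique-occ (steps C) (ham-simple {C = C} h))
       (subst (ℓ <_) (sym (ham-length C h)) lt) ,
     r , trans (ham-length C h) e) ∷ slices Cs hs

rooted-length : ∀ {m} {C : Cycle (Vec Z4 m)} {g} (ρ : Rooted C g) → length (around ρ) ≡ length (steps C)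
rooted-length {C = C} {g} ρ = trans (sym (wt-1 g (around ρ))) (trans (weight ρ _) (sym (cycle-length C)))

tag : ∀ {k} → Bool → List (Vec Z4 k) → Tag k
tag false = lapᶜ
tag true  = lapᵈ

HamCycle : ℕ → Set
HamCycle m = Σ (Cycle (Vec Z4 m)) Ham

ham-rooted : ∀ {m} (C : HamCycle m) g → Rooted (proj₁ C) g
ham-rooted (C , h) g = reroot C (ham-simple {C = C} h) g (ham-visits {C = C} h g)

ham-cycles : ∀ {m} (Cs : List (Cycle (Vec Z4 m))) → All Ham Cs → List (HamCycle m)
ham-cycles []       []       = []
ham-cycles (C ∷ Cs) (h ∷ hs) = (C , h) ∷ ham-cycles Cs hs

ham-cycles-length : ∀ {m} (Cs : List (Cycle (Vec Z4 m))) hs → length (ham-cycles Cs hs) ≡ length Cs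
ham-cycles-length []       []       = refl
ham-cycles-length (C ∷ Cs) (h ∷ hs) = cong suc (ham-cycles-length Cs hs)

∑-ham-cycles : ∀ {m} (Cs : List (Cycle (Vec Z4 m))) hs (f : Cycle (Vec Z4 m) → ℕ) →
               ∑ (ham-cycles Cs hs) (λ C → f (proj₁ C)) ≡ ∑ Cs f
∑-ham-cycles []       []       f = refl
∑-ham-cycles (C ∷ Cs) (h ∷ hs) f = cong (f C +_) (∑-ham-cycles Cs hs f)

module Thirds {A : Set} (K r : ℕ) (l : List A) (e : length l ≡ K + (K + r)) where

  l₁ l₂ l₃ : List A
  l₁ = take K l
  l₂ = take K (drop K l)
  l₃ = drop K (drop K l)

  thirds : l₁ ++ l₂ ++ l₃ ≡ l
  thirds = trans (cong (l₁ ++_) (take++drop≡id K (drop K l))) (take++drop≡id K l)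

  len-l₁ : length l₁ ≡ K
  len-l₁ = trans (length-take K l) (m≤n⇒m⊓n≡m (subst (K ≤_) (sym e) (m≤m+n K _)))

  len-drop : length (drop K l) ≡ K + r
  len-drop = trans (length-drop K l) (trans (cong (_∸ K) e) (m+n∸m≡n K _))

  len-l₂ : length l₂ ≡ K
  len-l₂ = trans (length-take K (drop K l)) (m≤n⇒m⊓n≡m (subst (K ≤_) (sym len-drop) (m≤m+n K _)))

  len-l₃ : length l₃ ≡ r
  len-l₃ = trans (length-drop K (drop K l)) (trans (cong (_∸ K) len-drop) (m+n∸m≡n K _))

double : ∀ p → (2 * p) + (2 * p) ≡ 4 * p
double = solve-∀

even-rest : ∀ p k r → p + p ≡ k + (k + r) → ∃ λ j → r ≡ j + j
even-rest p k r e = p ∸ k , +-cancelˡ-≡ (k + k) _ _ (begin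
  k + k + r                   ≡⟨ +-assoc k k r ⟩
  k + (k + r)                 ≡⟨ e ⟨
  p + p                       ≡⟨ cong₂ _+_ (m+[n∸m]≡n k≤p) (m+[n∸m]≡n k≤p) ⟨
  (k + (p ∸ k)) + (k + (p ∸ k)) ≡⟨ +-interchange k (p ∸ k) k (p ∸ k) ⟩
  k + k + ((p ∸ k) + (p ∸ k)) ∎)
  where
  open ≡-Reasoning
  k≤p : k ≤ p
  k≤p = ≮⇒≥ λ lt → <-irrefl e (<-≤-trans (+-mono-< lt lt) (+-monoʳ-≤ k (m≤m+n k r)))

-- Linking for odd m

module OddCase {k : ℕ} (D : HamDec (suc k)) (ℓ r : ℕ) (cut-up : 4 ^ suc k ≡ k + (k + r)) (room : suc ℓ ≤ r) where
  open HamDec D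

  G : Set
  G = Vec Z4 (suc k)

  -- A column is a single vertex here: all loops are Hamiltonian, so each of them can be entered
  -- anywhere.
  col : Bool → G → Bool → HamCycle (suc k) → List (Row (suc k))
  col b g κ C = (g , tag κ (around (ham-rooted C g))) ∷ []

  col-par : ∀ b g κ C → Rows.odd-plain (col b g κ C) ≡ false
  col-par b g false C = refl
  col-par b g true  C = refl

  col-closed : ∀ b g κ C → All Rows.ClosedTag (col b g κ C)
  col-closed b g false C = return (ham-rooted C g) ∷ []
  col-closed b g true  C = return (ham-rooted C g) ∷ []

  col-weight : ∀ w g (C : HamCycle (suc k)) z z′ →
    wt (Rows.Weight.w∷ w z) g (around (ham-rooted C g)) + wt (Rows.Weight.w∷ w z′) g (around (ham-rooted C g)) + 0 ≡
    cw (Rows.Weight.w∷ w z) (proj₁ C) + cw (Rows.Weight.w∷ w z′) (proj₁ C)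
  col-weight w g C z z′ = trans (+-identityʳ _) (cong₂ _+_ (weight (ham-rooted C g) _) (weight (ham-rooted C g) _))

  open Plan G (HamCycle (suc k)) 1 (λ _ g → g ∷ []) (λ _ _ → refl) proj₁ col (λ _ _ _ _ → refl) false col-par col-closed
    (λ w b g C → col-weight w g C z2 z0) (λ w b g C → col-weight w g C z3 z1)

  vertices-id : ∀ b l → vertices b l ≡ l
  vertices-id b []      = refl
  vertices-id b (g ∷ l) = cong (g ∷_) (vertices-id (not b) l)

  ℓ< : ℓ < 4 ^ suc k
  ℓ< = ≤-trans room (subst (r ≤_) (sym cut-up) (≤-trans (m≤n+m r k) (m≤n+m _ k)))

  col-good : ∀ {x} b g κ C → All (Circuit.Windows.GoodTag [] [] x ℓ) (col b g κ C)
  col-good {x} b g κ C = good {x} κ ∷ []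
    where
    ρ : Rooted (proj₁ C) g
    ρ = ham-rooted C g
    long : ℓ < length (around ρ)
    long = subst (ℓ <_) (sym (trans (rooted-length ρ) (ham-length (proj₁ C) (proj₂ C)))) ℓ<
    good : ∀ {x} κ → Circuit.Windows.GoodTag [] [] x ℓ (g , tag κ (around ρ))
    good false = LD-closed ℓ g (around ρ) (return ρ) (unique ρ) long , <⇒≤ long
    good true  = LD-closed ℓ g (around ρ) (return ρ) (unique ρ) long , <⇒≤ long

  module _ (C : Cycle G) (h : Ham C) (Cs : List (Cycle G)) (hs : All Ham Cs) (count′ : length Cs ≡ k)
           (total′ : ∀ w → cw w C + ∑ Cs (cw w) ≡ E (suc k) w) where

    open Thirds k r (steps C) (trans (ham-length C h) cut-up)

    even-l₃ : ∃ λ j → length l₃ * 1 ≡ j + j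
    even-l₃ with even-rest (2 * 4 ^ k) k r (trans (double (4 ^ k)) cut-up)
    ... | j , e = j , trans (*-identityʳ _) (trans len-l₃ e)

    open Link ℓ (ham-cycles Cs hs) l₁ l₂ l₃
      (trans (ham-cycles-length Cs hs) (trans count′ (sym len-l₁)))
      (trans (ham-cycles-length Cs hs) (trans count′ (sym len-l₂)))
      (subst (suc ℓ ≤_) (sym (trans (*-identityʳ _) len-l₃)) room)
      even-l₃
      C h (trans (sym thirds) (sym (vertices-id false _)))
      (λ w _ → trans (cong (cw w C +_) (∑-ham-cycles Cs hs (cw w))) (total′ w))
      (col-good {root C})

    linked : ℓ ∣ numEdges (suc (suc k) * 2) → PathDecomposition (suc (suc k) * 2) ℓ
    linked = trail-decomposition (suc (suc k)) ℓ (Circuit.trail R₀ tl gl) trail-LD trail-total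

  odd-decomposition : ℓ ∣ numEdges (suc (suc k) * 2) → PathDecomposition (suc (suc k) * 2) ℓ
  odd-decomposition = go cycles count ham total
    where
    go : ∀ Cs → length Cs ≡ suc k → All Ham Cs → (∀ w → ∑ Cs (cw w) ≡ E (suc k) w) →
         ℓ ∣ numEdges (suc (suc k) * 2) → PathDecomposition (suc (suc k) * 2) ℓ
    go (C ∷ Cs) e (h ∷ hs) t = linked C h Cs hs (suc-injective e) t

-- The product of a 4-cycle and an even cycle

levels : Bool → List Z4
levels false = z0 ∷ z1 ∷ z2 ∷ z3 ∷ []
levels true  = z3 ∷ z2 ∷ z1 ∷ z0 ∷ []

-- The product decomposes into a Hamiltonian cycle (bous) and three more cycles:
-- the copies of the even cycle in levels 1 and 2, and the cycle zag, which alternates between levels 0 and 3.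
module Boustrophedon {m : ℕ} where

  private
    H : Set
    H = Vec Z4 m

  bous zag : Bool → List H → List (Vec Z4 (suc m))
  bous b []           = []
  bous b (h ∷ hs)     = map (_∷ h) (levels b) ++ bous (not b) hs
  zag b     []        = []
  zag false (h ∷ hs)  = (z3 ∷ h) ∷ (z0 ∷ h) ∷ zag true hs
  zag true  (h ∷ hs)  = (z0 ∷ h) ∷ (z3 ∷ h) ∷ zag false hs

  end-bous : ∀ b x ys → end (corner b ∷ x) (bous b ys) ≡ corner (b xor flips ys) ∷ end x ys
  end-bous false x []       = refl
  end-bous true  x []       = refl
  end-bous false x (y ∷ ys) = end-bous true y ys
  end-bous true  x (y ∷ ys) = trans (end-bous false y ys) (cong (λ b → corner b ∷ end y ys) (sym (not-involutive (flips ys))))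

  end-zag : ∀ b x ys → end (corner (not b) ∷ x) (zag b ys) ≡ corner (not (b xor flips ys)) ∷ end x ys
  end-zag false x []       = refl
  end-zag true  x []       = refl
  end-zag false x (y ∷ ys) = end-zag true y ys
  end-zag true  x (y ∷ ys) = trans (end-zag false y ys) (cong (λ b → corner (not b) ∷ end y ys) (sym (not-involutive (flips ys))))

  ∑-bous : ∀ b ys f → ∑ (bous b ys) f ≡ ∑ ys (λ y → Σ₄ λ z → f (z ∷ y))
  ∑-bous b     []       f = refl
  ∑-bous false (y ∷ ys) f = trans (lemma (f (z0 ∷ y)) (f (z1 ∷ y)) (f (z2 ∷ y)) (f (z3 ∷ y)) _) (cong (Σ₄ (λ z → f (z ∷ y)) +_) (∑-bous true ys f))
    where
    lemma : ∀ a b c d e → a + (b + (c + (d + e))) ≡ (a + (b + (c + d))) + e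
    lemma = solve-∀
  ∑-bous true  (y ∷ ys) f = trans (lemma (f (z0 ∷ y)) (f (z1 ∷ y)) (f (z2 ∷ y)) (f (z3 ∷ y)) _) (cong (Σ₄ (λ z → f (z ∷ y)) +_) (∑-bous false ys f))
    where
    lemma : ∀ a b c d e → d + (c + (b + (a + e))) ≡ (a + (b + (c + d))) + e
    lemma = solve-∀

  ∑-zag : ∀ b ys f → ∑ (zag b ys) f ≡ ∑ ys (λ y → f (z3 ∷ y) + f (z0 ∷ y))
  ∑-zag b     []       f = refl
  ∑-zag false (y ∷ ys) f = trans (sym (+-assoc (f (z3 ∷ y)) _ _)) (cong (f (z3 ∷ y) + f (z0 ∷ y) +_) (∑-zag true ys f))
  ∑-zag true  (y ∷ ys) f = trans (sym (+-assoc (f (z0 ∷ y)) _ _))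
    (cong₂ _+_ (+-comm (f (z0 ∷ y)) (f (z3 ∷ y))) (∑-zag false ys f))

  module _ (w : Vec Z4 (suc m) → Vec Z4 (suc m) → ℕ) (w-sym : Sym w) where
    open Rows.Weight {m} w using (w∷; ring)

    -- From one column to the next, `bous` moves on one of the levels 0 and 3 and `zag` on the
    -- other. Inside a column `bous` uses three edges of the 4-cycle and `zag` the edge between 3
    -- and 0. Every second column is traversed backwards, whence the symmetry of `w`.
    wt-product : ∀ b x ys → wt w (corner b ∷ x) (bous b ys) + wt w (corner (not b) ∷ x) (zag b ys) +
                   (wt (w∷ z1) x ys + wt (w∷ z2) x ys) ≡ Σ₄ (λ z → wt (w∷ z) x ys) + ∑ ys ring
    wt-product b     x []       = refl
    wt-product false x (y ∷ ys) = trans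
      (lemma (w∷ z0 x y) (w∷ z1 x y) (w∷ z2 x y) (w∷ z3 x y) (w (z0 ∷ y) (z1 ∷ y)) (w (z1 ∷ y) (z2 ∷ y)) (w (z2 ∷ y) (z3 ∷ y)) (w (z3 ∷ y) (z0 ∷ y)) _ _ _ _)
      (trans (cong (Σ₄ (λ z → w∷ z x y) + ring y +_) (wt-product true y ys))
        (lemma′ (w∷ z0 x y) (w∷ z1 x y) (w∷ z2 x y) (w∷ z3 x y) _ _ _ _ (ring y) _))
      where
      lemma : ∀ b₀ b₁ b₂ b₃ a₀ a₁ a₂ a₃ p q c d →
        (b₀ + (a₀ + (a₁ + (a₂ + p)))) + (b₃ + (a₃ + q)) + ((b₁ + c) + (b₂ + d)) ≡
        ((b₀ + (b₁ + (b₂ + b₃))) + (a₀ + (a₁ + (a₂ + a₃)))) + (p + q + (c + d))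
      lemma = solve-∀
      lemma′ : ∀ b₀ b₁ b₂ b₃ t₀ t₁ t₂ t₃ r s →
        ((b₀ + (b₁ + (b₂ + b₃))) + r) + ((t₀ + (t₁ + (t₂ + t₃))) + s) ≡
        ((b₀ + t₀) + ((b₁ + t₁) + ((b₂ + t₂) + (b₃ + t₃)))) + (r + s)
      lemma′ = solve-∀
    wt-product true  x (y ∷ ys) = trans
      (cong₂ (λ p q → (w∷ z3 x y + p) + (w∷ z0 x y + q) + ((w∷ z1 x y + wt (w∷ z1) y ys) + (w∷ z2 x y + wt (w∷ z2) y ys)))
        (cong₂ _+_ (w-sym (z3 ∷ y) (z2 ∷ y)) (cong₂ _+_ (w-sym (z2 ∷ y) (z1 ∷ y)) (cong (_+ wt w (z0 ∷ y) (bous false ys)) (w-sym (z1 ∷ y) (z0 ∷ y)))))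
        (cong (_+ wt w (z3 ∷ y) (zag false ys)) (w-sym (z0 ∷ y) (z3 ∷ y))))
      (trans (lemma (w∷ z0 x y) (w∷ z1 x y) (w∷ z2 x y) (w∷ z3 x y) (w (z0 ∷ y) (z1 ∷ y)) (w (z1 ∷ y) (z2 ∷ y)) (w (z2 ∷ y) (z3 ∷ y)) (w (z3 ∷ y) (z0 ∷ y)) _ _ _ _)
      (trans (cong (Σ₄ (λ z → w∷ z x y) + ring y +_) (wt-product false y ys))
        (lemma′ (w∷ z0 x y) (w∷ z1 x y) (w∷ z2 x y) (w∷ z3 x y) _ _ _ _ (ring y) _)))
      where
      lemma : ∀ b₀ b₁ b₂ b₃ a₀ a₁ a₂ a₃ p q c d →
        (b₃ + (a₂ + (a₁ + (a₀ + p)))) + (b₀ + (a₃ + q)) + ((b₁ + c) + (b₂ + d)) ≡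
        ((b₀ + (b₁ + (b₂ + b₃))) + (a₀ + (a₁ + (a₂ + a₃)))) + (p + q + (c + d))
      lemma = solve-∀
      lemma′ : ∀ b₀ b₁ b₂ b₃ t₀ t₁ t₂ t₃ r s →
        ((b₀ + (b₁ + (b₂ + b₃))) + r) + ((t₀ + (t₁ + (t₂ + t₃))) + s) ≡
        ((b₀ + t₀) + ((b₁ + t₁) + ((b₂ + t₂) + (b₃ + t₃)))) + (r + s)
      lemma′ = solve-∀

-- A cycle that meets every column, so that its laps can be put in any column.
record Loop (m : ℕ) : Set where
  field
    cyc    : Cycle (Vec Z4 (suc m))
    lvl    : Z4
    rooted : ∀ h → Rooted cyc (lvl ∷ h)
    long   : 4 ^ m ≤ length (steps cyc)

at-level : ∀ {m} → Z4 → Cycle (Vec Z4 m) → Cycle (Vec Z4 (suc m))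
at-level z C = record { root = z ∷ root C ; steps = map (z ∷_) (steps C)
                      ; closed = trans (end-map (z ∷_) (root C) (steps C)) (cong (z ∷_) (closed C)) }

level-loop : ∀ {m} → Z4 → HamCycle m → Loop m
level-loop z (C , h) = record
  { cyc = at-level z C ; lvl = z
  ; rooted = λ g → let ρ = ham-rooted (C , h) g in record
      { around = map (z ∷_) (around ρ)
      ; return = trans (end-map (z ∷_) g (around ρ)) (cong (z ∷_) (return ρ))
      ; weight = λ w → trans (wt-map (z ∷_) w g (around ρ)) (trans (weight ρ _) (sym (wt-map (z ∷_) w (root C) (steps C))))
      ; unique = Uniqueₚ.map⁺ ∷-injectiveʳ (unique ρ) }
  ; long = ≤-reflexive (sym (trans (length-map (z ∷_) (steps C)) (ham-length C h))) }

module EvenCase {k : ℕ} (ℓ : ℕ) (ℓ< : ℓ < 4 ^ suc k) where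

  private
    m : ℕ
    m = suc k
    H : Set
    H = Vec Z4 m

  open Boustrophedon {m}
  open Loop

  pick : Z4 → Z4 → Tag (suc m) → Tag (suc m)
  pick z y t = if does (z ≟⁴ y) then t else plain

  row : H → Bool → Z4 → List (Vec Z4 (suc m)) → Z4 → Row (suc m)
  row h κ y ys z = z ∷ h , pick z y (tag κ ys)

  column : Bool → H → Bool → Z4 → List (Vec Z4 (suc m)) → List (Row (suc m))
  column b h κ y ys = map (row h κ y ys) (levels b)

  col : Bool → H → Bool → Loop m → List (Row (suc m))
  col b h κ l = column b h κ (lvl l) (around (rooted l h))

  col-ord : ∀ b h κ l → map proj₁ (col b h κ l) ≡ map (_∷ h) (levels b)
  col-ord false h κ l = refl
  col-ord true  h κ l = refl

  -- One row carries the lap, which leaves three plain ones.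
  col-par : ∀ b h κ y ys → Rows.odd-plain (column b h κ y ys) ≡ true
  col-par false h false z0 ys = refl
  col-par false h false z1 ys = refl
  col-par false h false z2 ys = refl
  col-par false h false z3 ys = refl
  col-par false h true  z0 ys = refl
  col-par false h true  z1 ys = refl
  col-par false h true  z2 ys = refl
  col-par false h true  z3 ys = refl
  col-par true  h false z0 ys = refl
  col-par true  h false z1 ys = refl
  col-par true  h false z2 ys = refl
  col-par true  h false z3 ys = refl
  col-par true  h true  z0 ys = refl
  col-par true  h true  z1 ys = refl
  col-par true  h true  z2 ys = refl
  col-par true  h true  z3 ys = refl

  all-rows : ∀ {P : Row (suc m) → Set} h κ y ys → (∀ g → P (g , plain)) → P (y ∷ h , tag κ ys) →
             ∀ b → All P (column b h κ y ys)
  all-rows {P} h κ y ys p q = λ { false → each z0 ∷ each z1 ∷ each z2 ∷ each z3 ∷ []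
                                ; true  → each z3 ∷ each z2 ∷ each z1 ∷ each z0 ∷ [] }
    where
    each : ∀ z → P (row h κ y ys z)
    each z with z ≟⁴ y
    ... | yes refl = q
    ... | no _     = p (z ∷ h)

  col-closed : ∀ b h κ l → All Rows.ClosedTag (col b h κ l)
  col-closed b h κ l = all-rows h κ (lvl l) (around (rooted l h)) (λ g → tt) (here κ) b
    where
    here : ∀ κ → Rows.ClosedTag (lvl l ∷ h , tag κ (around (rooted l h)))
    here false = return (rooted l h)
    here true  = return (rooted l h)

  col-good : ∀ {x} b h κ l → All (Circuit.Windows.GoodTag [] [] x ℓ) (col b h κ l)
  col-good {x} b h κ l = all-rows h κ (lvl l) (around ρ) (λ g → tt) (here κ) b
    where
    ρ : Rooted (cyc l) (lvl l ∷ h)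
    ρ = rooted l h
    ℓ<ρ : ℓ < length (around ρ)
    ℓ<ρ = ≤-trans ℓ< (≤-trans (long l) (≤-reflexive (sym (rooted-length ρ))))
    here : ∀ κ → Circuit.Windows.GoodTag [] [] x ℓ (lvl l ∷ h , tag κ (around ρ))
    here false = LD-closed ℓ _ (around ρ) (return ρ) (unique ρ) ℓ<ρ , <⇒≤ ℓ<ρ
    here true  = LD-closed ℓ _ (around ρ) (return ρ) (unique ρ) ℓ<ρ , <⇒≤ ℓ<ρ

  module _ (w : Vec Z4 (suc (suc m)) → Vec Z4 (suc (suc m)) → ℕ) where
    open Rows.Weight {suc m} w

    ∑-column : ∀ b h κ y ys → ∑ (column b h κ y ys) loopw ≡ loopw (y ∷ h , tag κ ys)
    ∑-column b h κ y ys = trans (to-Σ₄ b) (trans (Σ₄-single y others) self)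
      where
      to-Σ₄ : ∀ b → ∑ (column b h κ y ys) loopw ≡ Σ₄ (λ z → loopw (row h κ y ys z))
      to-Σ₄ false = lemma (loopw (row h κ y ys z0)) (loopw (row h κ y ys z1)) (loopw (row h κ y ys z2)) (loopw (row h κ y ys z3))
        where
        lemma : ∀ a b c d → a + (b + (c + (d + 0))) ≡ a + (b + (c + d))
        lemma = solve-∀
      to-Σ₄ true = lemma (loopw (row h κ y ys z0)) (loopw (row h κ y ys z1)) (loopw (row h κ y ys z2)) (loopw (row h κ y ys z3))
        where
        lemma : ∀ a b c d → d + (c + (b + (a + 0))) ≡ a + (b + (c + d))
        lemma = solve-∀
      others : ∀ z → z ≢ y → loopw (row h κ y ys z) ≡ 0
      others z n with z ≟⁴ y
      ... | yes e = ⊥-elim (n e)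
      ... | no _  = refl
      self : loopw (row h κ y ys y) ≡ loopw (y ∷ h , tag κ ys)
      self with y ≟⁴ y
      ... | yes _ = refl
      ... | no n  = ⊥-elim (n refl)

    col-weight : ∀ h (l : Loop m) z z′ →
      wt (w∷ z) (lvl l ∷ h) (around (rooted l h)) + wt (w∷ z′) (lvl l ∷ h) (around (rooted l h)) ≡
      cw (w∷ z) (cyc l) + cw (w∷ z′) (cyc l)
    col-weight h l z z′ = cong₂ _+_ (weight (rooted l h) _) (weight (rooted l h) _)

  length-levels : ∀ b (h : H) → length (map (_∷ h) (levels b)) ≡ 4
  length-levels false h = refl
  length-levels true  h = refl

  open Plan H (Loop m) 4 (λ b h → map (_∷ h) (levels b)) length-levels cyc col col-ord
    true (λ b h κ l → col-par b h κ (lvl l) (around (rooted l h))) col-closed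
    (λ w b h l → trans (∑-column w b h false (lvl l) (around (rooted l h))) (col-weight w h l z2 z0))
    (λ w b h l → trans (∑-column w b h true (lvl l) (around (rooted l h))) (col-weight w h l z3 z1))

  twice : ∀ r → r * 4 ≡ r * 2 + r * 2
  twice = solve-∀

  vertices-bous : ∀ b hs → vertices b hs ≡ bous b hs
  vertices-bous b []       = refl
  vertices-bous b (h ∷ hs) = cong (map (_∷ h) (levels b) ++_) (vertices-bous (not b) hs)

  module _ (C : Cycle H) (ham : Ham C) where

    even-steps : flips (steps C) ≡ false
    even-steps = flips-even (steps C) (2 * 4 ^ k) (trans (ham-length C ham) (sym (double (4 ^ k))))

    X Z : Cycle (Vec Z4 (suc m))
    X = record { root = z0 ∷ root C ; steps = bous false (steps C)
               ; closed = trans (end-bous false (root C) (steps C)) (cong₂ (λ b g → corner b ∷ g) even-steps (closed C)) }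
    Z = record { root = z3 ∷ root C ; steps = zag false (steps C)
               ; closed = trans (end-zag false (root C) (steps C)) (cong₂ (λ b g → corner (not b) ∷ g) even-steps (closed C)) }

    X-ham : Ham X
    X-ham f = trans (∑-bous false (steps C) f) (trans (ham _) (ΣV-Σ₄ m (λ z x → f (z ∷ x))))

    ∑-Z : ∀ f → ∑ (steps Z) f ≡ ΣV m (λ x → f (z3 ∷ x)) + ΣV m (λ x → f (z0 ∷ x))
    ∑-Z f = trans (∑-zag false (steps C) f) (trans (ham _) (ΣV-+ m (λ x → f (z3 ∷ x)) (λ x → f (z0 ∷ x))))

    Z-simple : Simple Z
    Z-simple x = ≤-trans (≤-reflexive (∑-Z (occ x))) (≤-trans part (≤-reflexive (ΣV-occ (suc m) x)))
      where
      part : ΣV m (λ y → occ x (z3 ∷ y)) + ΣV m (λ y → occ x (z0 ∷ y)) ≤ ΣV (suc m) (occ x)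
      part = outer (ΣV m (λ y → occ x (z0 ∷ y))) (ΣV m (λ y → occ x (z1 ∷ y)))
                   (ΣV m (λ y → occ x (z2 ∷ y))) (ΣV m (λ y → occ x (z3 ∷ y)))
        where
        outer : ∀ a b c d → d + a ≤ a + (b + (c + d))
        outer a b c d = ≤-trans (≤-reflexive (+-comm d a)) (+-monoʳ-≤ a (≤-trans (m≤n+m d c) (m≤n+m (c + d) b)))

    Z-visits : ∀ h → 1 ≤ ∑ (steps Z) (occ (z3 ∷ h))
    Z-visits h = ≤-trans (≤-reflexive (sym once)) (≤-trans (m≤m+n _ _) (≤-reflexive (sym (∑-Z (occ (z3 ∷ h))))))
      where
      once : ΣV m (λ y → occ (z3 ∷ h) (z3 ∷ y)) ≡ 1
      once = trans (ΣV-single m h {λ y → occ (z3 ∷ h) (z3 ∷ y)} (λ y n → occ-≢ {x = z3 ∷ h} {z3 ∷ y} λ e → n (sym (∷-injectiveʳ e)))) (occ-≡ (z3 ∷ h))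

    Z-loop : Loop m
    Z-loop = record
      { cyc = Z ; lvl = z3 ; rooted = λ h → reroot Z Z-simple (z3 ∷ h) (Z-visits h)
      ; long = ≤-trans (m≤m+n _ _) (≤-reflexive (sym len)) }
      where
      len : length (steps Z) ≡ 4 ^ m + 4 ^ m
      len = trans (sym (trans (∑-const (steps Z) 1) (*-identityʳ _)))
        (trans (∑-Z (λ _ → 1)) (cong₂ _+_ (ΣV-1 m) (ΣV-1 m)))

    quad-loops : List (HamCycle m) → List (Loop m)
    quad-loops []       = []
    quad-loops (B ∷ Bs) = level-loop z0 B ∷ level-loop z1 B ∷ level-loop z2 B ∷ level-loop z3 B ∷ quad-loops Bs

    quad-length : ∀ Bs → length (quad-loops Bs) ≡ length Bs * 4
    quad-length []       = refl
    quad-length (B ∷ Bs) = cong (4 +_) (quad-length Bs)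

    module _ (Bs : List (HamCycle m)) (total′ : ∀ w → cw w C + ∑ Bs (λ B → cw w (proj₁ B)) ≡ E m w) where

      -- Of `C` only levels 1 and 2 occur, since `X` and `Z` share the edges of its levels 0 and 3;
      -- every other cycle gives four loops.
      ls : List (Loop m)
      ls = Z-loop ∷ level-loop z1 (C , ham) ∷ level-loop z2 (C , ham) ∷ quad-loops Bs

      total : ∀ w → Sym w → cw w X + ∑ ls (λ l → cw w (cyc l)) ≡ E (suc m) w
      total w w-sym = begin
        cw w X + (cw w Z + (cw w (at-level z1 C) + (cw w (at-level z2 C) + ∑ (quad-loops Bs) (λ l → cw w (cyc l)))))
          ≡⟨ cong₂ (λ p q → cw w X + (cw w Z + (p + (q + ∑ (quad-loops Bs) (λ l → cw w (cyc l)))))) (wt-level z1 C) (wt-level z2 C) ⟩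
        cw w X + (cw w Z + (cw (w∷ z1) C + (cw (w∷ z2) C + ∑ (quad-loops Bs) (λ l → cw w (cyc l)))))
          ≡⟨ lemma (cw w X) (cw w Z) (cw (w∷ z1) C) (cw (w∷ z2) C) _ ⟩
        (cw w X + cw w Z + (cw (w∷ z1) C + cw (w∷ z2) C)) + ∑ (quad-loops Bs) (λ l → cw w (cyc l))
          ≡⟨ cong₂ _+_ (wt-product w w-sym false (root C) (steps C)) (quads Bs) ⟩
        (Σ₄ (λ z → cw (w∷ z) C) + ∑ (steps C) ring) + Σ₄ (λ z → ∑ Bs (λ B → cw (w∷ z) (proj₁ B)))
          ≡⟨ cong (λ n → Σ₄ (λ z → cw (w∷ z) C) + n + Σ₄ (λ z → ∑ Bs (λ B → cw (w∷ z) (proj₁ B))))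
               (trans (ham ring) (ΣV-Σ₄ m (λ z x → w (z ∷ x) (s z ∷ x)))) ⟩
        (Σ₄ (λ z → cw (w∷ z) C) + rings) + Σ₄ (λ z → ∑ Bs (λ B → cw (w∷ z) (proj₁ B)))
          ≡⟨ lemma′ (Σ₄ (λ z → cw (w∷ z) C)) rings _ ⟩
        rings + (Σ₄ (λ z → cw (w∷ z) C) + Σ₄ (λ z → ∑ Bs (λ B → cw (w∷ z) (proj₁ B))))
          ≡⟨ cong (rings +_) (trans (sym (Σ₄-+ (λ z → cw (w∷ z) C) (λ z → ∑ Bs (λ B → cw (w∷ z) (proj₁ B)))))
               (Σ₄-cong λ z → total′ (w∷ z))) ⟩
        E (suc m) w ∎
        where
        open ≡-Reasoning
        open Rows.Weight {m} w using (w∷; ring)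
        rings : ℕ
        rings = Σ₄ (λ z → ΣV m λ x → w (z ∷ x) (s z ∷ x))
        wt-level : ∀ z (B : Cycle H) → cw w (at-level z B) ≡ cw (w∷ z) B
        wt-level z B = wt-map (z ∷_) w (root B) (steps B)
        lemma : ∀ a b c d e → a + (b + (c + (d + e))) ≡ (a + b + (c + d)) + e
        lemma = solve-∀
        lemma′ : ∀ a b c → (a + b) + c ≡ b + (a + c)
        lemma′ = solve-∀
        quads : ∀ Bs → ∑ (quad-loops Bs) (λ l → cw w (cyc l)) ≡ Σ₄ (λ z → ∑ Bs (λ B → cw (w∷ z) (proj₁ B)))
        quads []       = refl
        quads (B ∷ Bs) = trans (cong₂ _+_ (wt-level z0 (proj₁ B)) (cong₂ _+_ (wt-level z1 (proj₁ B))
          (cong₂ _+_ (wt-level z2 (proj₁ B)) (cong₂ _+_ (wt-level z3 (proj₁ B)) (quads Bs)))))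
          (regroup (cw (w∷ z0) (proj₁ B)) (cw (w∷ z1) (proj₁ B)) (cw (w∷ z2) (proj₁ B)) (cw (w∷ z3) (proj₁ B)) _ _ _ _)
          where
          regroup : ∀ a b c d p q r t → a + (b + (c + (d + (p + (q + (r + t)))))) ≡ (a + p) + ((b + q) + ((c + r) + (d + t)))
          regroup = solve-∀

      module _ (r : ℕ) (cut-up : 4 ^ m ≡ length ls + (length ls + r)) (room : suc ℓ ≤ r * 4) where

        open Thirds (length ls) r (steps C) (trans (ham-length C ham) cut-up)

        open Link ℓ ls l₁ l₂ l₃ (sym len-l₁) (sym len-l₂)
          (subst (λ n → suc ℓ ≤ n * 4) (sym len-l₃) room)
          (r * 2 , trans (cong (_* 4) len-l₃) (twice r))
          X X-ham (trans (cong (bous false) (sym thirds)) (sym (vertices-bous false (l₁ ++ l₂ ++ l₃))))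
          total (col-good {root X})

        linked : ℓ ∣ numEdges (suc (suc m) * 2) → PathDecomposition (suc (suc m) * 2) ℓ
        linked = trail-decomposition (suc (suc m)) ℓ (Circuit.trail R₀ tl gl) trail-LD trail-total

  even-decomposition : ∀ r → HamDec m → 4 ^ m ≡ (3 + k * 4) + ((3 + k * 4) + r) → suc ℓ ≤ r * 4 →
                       ℓ ∣ numEdges (suc (suc m) * 2) → PathDecomposition (suc (suc m) * 2) ℓ
  even-decomposition r D cut-up room = go cycles count ham (HamDec.total D)
    where
    open HamDec D
    go : ∀ Cs → length Cs ≡ m → All Ham Cs → (∀ w → ∑ Cs (cw w) ≡ E m w) →
         ℓ ∣ numEdges (suc (suc m) * 2) → PathDecomposition (suc (suc m) * 2) ℓ
    go (C ∷ Cs) e (h ∷ hs) t = linked C h (ham-cycles Cs hs)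
      (λ w → trans (cong (cw w C +_) (∑-ham-cycles Cs hs (cw w))) (t w)) r
      (trans cut-up (cong (λ n → n + (n + r)) (sym size))) room
      where
      size : 3 + length (quad-loops C h (ham-cycles Cs hs)) ≡ 3 + k * 4
      size = cong (3 +_) (trans (quad-length C h (ham-cycles Cs hs))
        (cong (_* 4) (trans (ham-cycles-length Cs hs) (suc-injective e))))

-- Choosing between linking and cutting

parity : ∀ m → ∃ λ c → (m ≡ c * 2) ⊎ (m ≡ suc (c * 2))
parity zero = 0 , inj₁ refl
parity (suc m) with parity m
... | c , inj₁ refl = c , inj₂ refl
... | c , inj₂ refl = suc c , inj₁ refl

4^-pos : ∀ m → 1 ≤ 4 ^ m
4^-pos m = m^n>0 4 m

4*-mono : ∀ {a b p} → a ≤ 4 * p → b ≤ 3 * (4 * p) → a + b ≤ 4 * (4 * p)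
4*-mono {p = p} h h′ = ≤-trans (+-mono-≤ h h′) (≤-reflexive (lemma p))
  where
  lemma : ∀ p → 4 * p + 3 * (4 * p) ≡ 4 * (4 * p)
  lemma = solve-∀

-- The left side is three times 2(1 + j) + 1, the number of laps plus one. One third of 3 * 4^(2+j)
-- is spent on it; the other two thirds are for `ℓ`.
growth-odd : ∀ j → 6 * j + 9 ≤ 4 ^ (2 + j)
growth-odd zero    = from-yes (9 ≤? 16)
growth-odd (suc j) = ≤-trans (≤-reflexive (lemma j)) (4*-mono {p = 4 ^ (1 + j)} (growth-odd j)
  (≤-trans (from-yes (6 ≤? 12)) (*-monoʳ-≤ 3 (*-monoʳ-≤ 4 (4^-pos (1 + j))))))
  where
  lemma : ∀ j → 6 * suc j + 9 ≡ (6 * j + 9) + 6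
  lemma = solve-∀

-- For K = 3 + 4(3 + j) laps of each kind the left side is 8K + 8. So the laps occupy at most three
-- quarters of the 4^(4+j) columns, and the free columns, of four rows each, have at least 4^(4+j)
-- rows.
growth-even : ∀ j → 32 * (4 + j) ≤ 3 * 4 ^ (4 + j)
growth-even zero    = from-yes (128 ≤? 768)
growth-even (suc j) = ≤-trans (≤-reflexive (lemma j)) (≤-trans
  (+-mono-≤ (growth-even j) (≤-trans (from-yes (32 ≤? 36)) (*-monoʳ-≤ 9 (≤-trans (from-yes (4 ≤? 256)) (*-monoʳ-≤ 256 (4^-pos j))))))
  (≤-reflexive (lemma′ (4 ^ j))))
  where
  lemma : ∀ j → 32 * (4 + suc j) ≡ 32 * (4 + j) + 32
  lemma = solve-∀
  lemma′ : ∀ p → 3 * (4 * (4 * (4 * (4 * p)))) + 9 * (256 * p) ≡ 3 * (4 * (4 * (4 * (4 * (4 * p)))))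
  lemma′ = solve-∀

-- For m = 3 + j, the m - 2 laps of each kind and a tail longer than ℓ fit in the 4^(m-1) rows.
odd-bound : ∀ j ℓ → ℓ * (3 + j) ≤ 2 * 4 ^ (2 + j) → suc ((1 + j) + (1 + j)) + ℓ ≤ 4 ^ (2 + j)
odd-bound j ℓ h = *-cancelˡ-≤ 3 (begin
  3 * (suc ((1 + j) + (1 + j)) + ℓ)    ≡⟨ lemma j ℓ ⟩
  (6 * j + 9) + ℓ * 3                  ≤⟨ +-mono-≤ (growth-odd j) (≤-trans (*-monoʳ-≤ ℓ (m≤m+n 3 j)) h) ⟩
  4 ^ (2 + j) + 2 * 4 ^ (2 + j)        ≡⟨⟩
  3 * 4 ^ (2 + j)                      ∎)
  where
  open ≤-Reasoning
  lemma : ∀ j ℓ → 3 * (suc ((1 + j) + (1 + j)) + ℓ) ≡ (6 * j + 9) + ℓ * 3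
  lemma = solve-∀

odd-case : ∀ c ℓ → ℓ * (suc (suc c * 2) * 2) ≤ 2 ^ (suc (suc c * 2) * 2) → ℓ ∣ numEdges (suc (suc c * 2) * 2) →
           PathDecomposition (suc (suc c * 2) * 2) ℓ
odd-case c ℓ le div = OddCase.odd-decomposition (even-hamDec (suc c) (s≤s z≤n)) ℓ (4 ^ (2 + j) ∸ 2K)
  (trans (sym (m+[n∸m]≡n (≤-trans (m≤n+m 2K 1) (≤-trans (m≤m+n (suc 2K) ℓ) bound)))) (+-assoc (1 + j) (1 + j) _))
  (+-cancelˡ-≤ 2K _ _ (≤-trans (≤-reflexive (+-suc 2K ℓ)) (≤-trans bound
    (≤-reflexive (sym (m+[n∸m]≡n (≤-trans (m≤n+m 2K 1) (≤-trans (m≤m+n (suc 2K) ℓ) bound))))))))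
  div
  where
  j 2K : ℕ
  j = c * 2
  2K = (1 + j) + (1 + j)
  bound : suc 2K + ℓ ≤ 4 ^ (2 + j)
  bound = odd-bound j ℓ (*-cancelʳ-≤ _ _ 2 (≤-trans (≤-reflexive (*-assoc ℓ (3 + j) 2))
    (≤-trans le (≤-reflexive (trans (2^-even (3 + j)) (lemma (4 ^ (2 + j))))))))
    where
    lemma : ∀ p → 4 * p ≡ 2 * p * 2
    lemma = solve-∀

below : ∀ m ℓ → ℓ > 0 → ℓ * (suc m * 2) ≤ 2 ^ (suc m * 2) → ℓ < 4 ^ suc m
below m ℓ pos le = <-≤-trans (<-≤-trans (m<m+n ℓ pos) (≤-trans (≤-reflexive (lemma ℓ))
  (*-monoʳ-≤ ℓ (m≤m+n 2 (m * 2))))) (≤-trans le (≤-reflexive (2^-even (suc m))))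
  where
  lemma : ∀ ℓ → ℓ + ℓ ≡ ℓ * 2
  lemma = solve-∀

one-case : ∀ ℓ → ℓ > 0 → ℓ * 2 ≤ 4 → ℓ ∣ 4 → PathDecomposition 2 ℓ
one-case ℓ pos le div = hamiltonian-decomposition 1 ℓ z4-hamDec div (below 0 ℓ pos le)

-- In dimension 4, and likewise in dimension 8, the number of edges is a power of two. Hence so is
-- `ℓ`, and being small it divides the length of a Hamiltonian cycle.
dim-4 : ∀ ℓ → ℓ ≤ 4 → ℓ ∣ 32 → ℓ ∣ 16
dim-4 ℓ le = from-yes (allUpTo? (λ ℓ → (ℓ ∣? 32) →-dec (ℓ ∣? 16)) 5) (s≤s le)

dim-8 : ∀ ℓ → ℓ ≤ 32 → ℓ ∣ 1024 → ℓ ∣ 256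
dim-8 ℓ le = from-yes (allUpTo? (λ ℓ → (ℓ ∣? 1024) →-dec (ℓ ∣? 256)) 33) (s≤s le)

-- 24576 is 3 * 2^13, whose neighbouring divisors are 64, 96 and 128. The check runs over the 25
-- offsets from 72.
quotient-96 : ∀ t → 72 ≤ t → t ≤ 96 → t ∣ 24576 → t ≡ 96
quotient-96 t 72≤t t≤96 d = trans (sym (m+[n∸m]≡n 72≤t))
  (from-yes (allUpTo? (λ u → ((72 + u) ∣? 24576) →-dec ((72 + u) ≟ 96)) 25)
    (s≤s (∸-monoˡ-≤ 72 t≤96)) (subst (_∣ 24576) (sym (m+[n∸m]≡n 72≤t)) d))

-- Here 256 ≤ ℓ ≤ 341, so the quotient 24576 / ℓ lies between 72 and 96; only 96 divides 24576.
dim-12 : ∀ ℓ → 256 ≤ ℓ → ℓ * 12 ≤ 4096 → ℓ ∣ 24576 → ℓ ∣ 4096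
dim-12 ℓ ge le (divides t e) = subst (_∣ 4096) (sym ℓ≡256) (divides 16 refl)
  where
  ℓ≤341 : ℓ ≤ 341
  ℓ≤341 = s≤s⁻¹ (*-cancelʳ-< 12 ℓ 342 (≤-trans (s≤s le) (from-yes (4097 ≤? 4104))))
  72≤t : 72 ≤ t
  72≤t = *-cancelʳ-< 341 71 t (≤-trans (from-yes (24212 ≤? 24576)) (≤-trans (≤-reflexive e) (*-monoʳ-≤ t ℓ≤341)))
  t≤96 : t ≤ 96
  t≤96 = *-cancelʳ-≤ t 96 256 (≤-trans (*-monoʳ-≤ t ge) (≤-reflexive (sym e)))
  ℓ≡256 : ℓ ≡ 256
  ℓ≡256 = *-cancelˡ-≡ ℓ 256 96 (trans (cong (_* ℓ) (sym (quotient-96 t 72≤t t≤96 (divides ℓ (trans e (*-comm t ℓ)))))) (sym e))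

-- From c = 4 on, the dimension 4(c + 1) is at least 20 and outweighs the factor 16 between 4^(2c)
-- and 4^(2c+2).
large : ∀ c ℓ → 4 ≤ c → ℓ * ((suc c * 2) * 2) ≤ 4 ^ (suc c * 2) → ℓ < 4 ^ (c * 2)
large c ℓ 4≤c le = short (4 ^ (c * 2)) (4^-pos (c * 2)) (≤-trans le (≤-reflexive (sym (*-assoc 4 4 (4 ^ (c * 2))))))
  where
  short : ∀ p → 1 ≤ p → ℓ * ((suc c * 2) * 2) ≤ 16 * p → ℓ < p
  short p 1≤p le = ≰⇒> λ ge → <-irrefl refl (begin-strict
    16 * p                    <⟨ *-monoˡ-< p {{>-nonZero 1≤p}} (from-yes (17 ≤? 20)) ⟩
    20 * p                    ≤⟨ *-monoʳ-≤ 20 ge ⟩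
    20 * ℓ                    ≡⟨ *-comm 20 ℓ ⟩
    ℓ * 20                    ≤⟨ *-monoʳ-≤ ℓ (*-monoˡ-≤ 2 (*-monoˡ-≤ 2 (s≤s 4≤c))) ⟩
    ℓ * ((suc c * 2) * 2)     ≤⟨ le ⟩
    16 * p                    ∎)
    where open ≤-Reasoning

-- In dimension 4(c + 1), either the Hamiltonian cycles themselves can be cut, or ℓ is shorter than those of Q_{4c},
-- which leaves room for linking.
dichotomy : ∀ c ℓ → ℓ * ((suc c * 2) * 2) ≤ 4 ^ (suc c * 2) → ℓ ∣ (suc c * 2) * 4 ^ (suc c * 2) →
            (ℓ ∣ 4 ^ (suc c * 2)) ⊎ (2 ≤ c × ℓ < 4 ^ (c * 2))
dichotomy 0 ℓ le div = inj₁ (dim-4 ℓ (*-cancelʳ-≤ ℓ 4 4 le) div)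
dichotomy 1 ℓ le div = inj₁ (dim-8 ℓ (*-cancelʳ-≤ ℓ 32 8 le) div)
dichotomy 2 ℓ le div with <-≤-connex ℓ 256
... | inj₁ lt = inj₂ (s≤s (s≤s z≤n) , lt)
... | inj₂ ge = inj₁ (dim-12 ℓ ge le div)
-- In dimension 16 the bound on `ℓ` is 65536 / 16 = 4096 = 4^6, so equality is the only case left
-- for cutting.
dichotomy 3 ℓ le div with <-≤-connex ℓ 4096
... | inj₁ lt = inj₂ (s≤s (s≤s z≤n) , lt)
... | inj₂ ge = inj₁ (subst (_∣ 65536) (≤-antisym ge (*-cancelʳ-≤ ℓ 4096 16 le)) (divides 16 refl))
dichotomy c@(suc (suc (suc (suc _)))) ℓ le div =
  inj₂ (s≤s (s≤s z≤n) , large c ℓ (s≤s (s≤s (s≤s (s≤s z≤n)))) le)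

even-link : ∀ c ℓ → ℓ < 4 ^ ((2 + c) * 2) → ℓ ∣ numEdges (((3 + c) * 2) * 2) → PathDecomposition (((3 + c) * 2) * 2) ℓ
even-link c ℓ lt div = EvenCase.even-decomposition ℓ lt (N ∸ 2K) (even-hamDec (2 + c) (s≤s z≤n))
  (trans (sym split) (+-assoc K K _)) room div
  where
  j k N K 2K : ℕ
  j = c * 2
  k = 3 + j
  N = 4 ^ (4 + j)
  K = 3 + k * 4
  2K = K + K
  8K≤3N : 4 * 2K ≤ 3 * N
  8K≤3N = ≤-trans (≤-trans (m≤m+n (4 * 2K) 8) (≤-reflexive (lemma j))) (growth-even j)
    where
    lemma : ∀ j → 4 * ((3 + (3 + j) * 4) + (3 + (3 + j) * 4)) + 8 ≡ 32 * (4 + j)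
    lemma = solve-∀
  2K≤N : 2K ≤ N
  2K≤N = *-cancelˡ-≤ 4 (≤-trans 8K≤3N (*-monoˡ-≤ N (from-yes (3 ≤? 4))))
  split : 2K + (N ∸ 2K) ≡ N
  split = m+[n∸m]≡n 2K≤N
  room : suc ℓ ≤ (N ∸ 2K) * 4
  room = ≤-trans lt (+-cancelˡ-≤ (3 * N) _ _ (begin
    3 * N + N               ≡⟨ lemma N ⟩
    4 * N                   ≡⟨ cong (4 *_) split ⟨
    4 * (2K + (N ∸ 2K))     ≡⟨ lemma′ 2K (N ∸ 2K) ⟩
    4 * 2K + (N ∸ 2K) * 4   ≤⟨ +-monoˡ-≤ _ 8K≤3N ⟩
    3 * N + (N ∸ 2K) * 4    ∎))
    where
    open ≤-Reasoning
    lemma : ∀ n → 3 * n + n ≡ 4 * n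
    lemma = solve-∀
    lemma′ : ∀ a b → 4 * (a + b) ≡ 4 * a + b * 4
    lemma′ = solve-∀

even-case : ∀ c ℓ → ℓ > 0 → ℓ * ((suc c * 2) * 2) ≤ 2 ^ ((suc c * 2) * 2) → ℓ ∣ numEdges ((suc c * 2) * 2) →
            PathDecomposition ((suc c * 2) * 2) ℓ
even-case c ℓ pos le div with dichotomy c ℓ (≤-trans le (≤-reflexive (2^-even (suc c * 2)))) (subst (ℓ ∣_) (numEdges-even (suc c * 2)) div)
... | inj₁ d = hamiltonian-decomposition (suc c * 2) ℓ (even-hamDec (suc c) (s≤s z≤n)) d (below (suc (c * 2)) ℓ pos le)
even-case (suc zero) ℓ pos le div | inj₂ (s≤s () , _)
even-case (suc (suc c)) ℓ pos le div | inj₂ (_ , lt) = even-link c ℓ lt div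

theorem3 : (n ℓ : ℕ) → n > 0 → 2 ∣ n → ℓ > 0 →
    ℓ * n ≤ 2 ^ n → ℓ ∣ numEdges n →
    PathDecomposition n ℓ
theorem3 _ ℓ n>0 (divides m refl) ℓ>0 le div with parity m
theorem3 _ ℓ ()  (divides _ refl) ℓ>0 le div | zero  , inj₁ refl
theorem3 _ ℓ n>0 (divides _ refl) ℓ>0 le div | suc c , inj₁ refl = even-case c ℓ ℓ>0 le div
theorem3 _ ℓ n>0 (divides _ refl) ℓ>0 le div | zero  , inj₂ refl = one-case ℓ ℓ>0 le div
theorem3 _ ℓ n>0 (divides _ refl) ℓ>0 le div | suc c , inj₂ refl = odd-case c ℓ le div
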